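{- Both parameterized problems $\mathrm{LCR}(\mathtt{D})$ and $\mathrm{LCR}(\mathtt{L})$ are $\mathsf{W}[1]$-hard.
   Context: $\mathsf{W}[1]$-hardness is with respect to parameterized reductions: algorithms transforming $(x,k)$ into an equivalent $(x',k')$ in time $g(k)\cdot|x|^{O(1)}$ for a computable $g$, where $k'$ is computed by a function depending only on $k$. Programs. A (shared memory) program is a tuple $\mathcal{A}=(D,a^0,(P_i)_{i\in[1..t]})$ with a finite data domain $D$, an initial memory value $a^0\in D$, and threads $P_i$. Let $\mathrm{Op}(D)=\{!a,?a \mid a\in D\}$ ($!a$ writes $a$ to the memory, $?a$ reads $a$ from it). Each thread is a nondeterministic finite automaton $P_i=(\mathrm{Op}(D),Q_i,q_i^0,\delta_i)$ with finite state set $Q_i$, initial state $q_i^0$ and transition relation $\delta_i\subseteq Q_i\times(\mathrm{Op}(D)\cup\{\varepsilon\})\times Q_i$. A configuration is a pair $(\mathit{pc},a)$ with $\mathit{pc}\in Q_1\times\dots\times Q_t$ and $a\in D$; the initial configuration is $c^0=((q_1^0,\dots,q_t^0),a^0)$. A step lets one thread $P_i$ take a transition from its current state $q$ to $q'$ (the other threads keep their states): a transition $(q,?a,q')$ is possible only if the memory holds $a$, and leaves the memory unchanged; a transition $(q,!b,q')$ is possible for any memory value and sets the memory to $b$; a transition $(q,\varepsilon,q')$ leaves the memory unchanged. Write $c\rightarrow^*_{\mathcal{A}}c'$ if $c'$ is reachable from $c$ by a finite sequence of steps. Leader Contributor Reachability ($\mathrm{LCR}$). Input: a program $\mathcal{A}=(D,a^0,(P_L,P_C))$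 with two threads, the leader $P_L$ (state set $Q_L$) and the contributor $P_C$ (state set $Q_C$), and a set $F_L\subseteq Q_L$ of unsafe states. For $t\in\mathbb{N}$, let $\mathcal{A}^t=(D,a^0,(P_L,(P_C)_{i\in[1..t]}))$ be the program with one leader and exactly $t$ copies of $P_C$, and let $C^f$ be the set of configurations in which the leader is in a state of $F_L$. Question: is there a $t\in\mathbb{N}$ such that $c^0\rightarrow^*_{\mathcal{A}^t}c$ for some $c\in C^f$? $\mathrm{LCR}(\mathtt{D})$ is $\mathrm{LCR}$ parameterized by $\mathtt{D}=|D|$ only; $\mathrm{LCR}(\mathtt{L})$ is $\mathrm{LCR}$ parameterized by $\mathtt{L}=|Q_L|$ only. -}

module Defs where

open import Data.Bool using (Bool; true; false; not)
open import Data.Bool.ListAction using () renaming (and to conjunction; or to disjunction)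
open import Data.Fin using (Fin; zero; suc; toℕ)
open import Data.Fin.Subset using (Subset; _∈_; ∣_∣)
open import Data.List using (List; []; _∷_; map; foldr)
open import Data.List.Membership.Propositional using () renaming (_∈_ to _∈ₗ_)
open import Data.Maybe using (Maybe; just; nothing)
open import Data.Nat using (ℕ; zero; suc; _+_; _*_; _^_; _⊔_; _≤_)
open import Data.Product using (Σ; ∃; ∃-syntax; Σ-syntax; _×_; _,_; proj₁; proj₂)
open import Data.Vec using (Vec; []; _∷_; lookup; replicate; toList)
open import Function.Bundles using (_⇔_)
open import Relation.Binary.Construct.Closure.ReflexiveTransitive using (Star)
open import Relation.Binary.PropositionalEquality using (_≡_; _≢_)

------------------------------------------------------------------------
-- Algorithms and their running time

-- Inputs and outputs of algorithms are binary trees (S-expressions with a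
-- single atom).

infixr 5 _∙_

data Tree : Set where
  nil : Tree
  _∙_ : Tree → Tree → Tree

size : Tree → ℕ
size nil     = 1
size (x ∙ y) = suc (size x + size y)

-- Jones's WHILE language in variable-free form: a program denotes a partial
-- function on trees.

infixl 6 _⨾_

data Prog : Set where
  nil id hd tl   : Prog
  cons           : Prog → Prog → Prog
  _⨾_            : Prog → Prog → Prog
  if_then_else_  : Prog → Prog → Prog → Prog
  while_loop_    : Prog → Prog → Prog

head tail : Tree → Tree
head nil     = nil
head (x ∙ y) = x
tail nil     = nil
tail (x ∙ y) = y

-- p ⊢ x ⇓ y [ t ]: on input x the program p halts in time t with output y.
-- nil is "false"; every other tree is "true".
--
-- Every operation is charged the size of the tree it is applied to, so that
-- values can be copied physically and size y ≤ t.  (With unit costs,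
-- iterating cons id id would build a tree of exponential size in linear
-- time.)  With this measure the language and multitape Turing machines
-- simulate each other with polynomial overhead.

infix 4 _⊢_⇓_[_]

data _⊢_⇓_[_] : Prog → Tree → Tree → ℕ → Set where
  nil : ∀ {x} → nil ⊢ x ⇓ nil [ size x ]
  id  : ∀ {x} → id ⊢ x ⇓ x [ size x ]
  hd  : ∀ {x} → hd ⊢ x ⇓ head x [ size x ]
  tl  : ∀ {x} → tl ⊢ x ⇓ tail x [ size x ]
  cons : ∀ {p q x y z s t} →
    p ⊢ x ⇓ y [ s ] → q ⊢ x ⇓ z [ t ] →
    cons p q ⊢ x ⇓ y ∙ z [ size x + (s + t) ]
  seq : ∀ {p q x y z s t} →
    p ⊢ x ⇓ y [ s ] → q ⊢ y ⇓ z [ t ] →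
    p ⨾ q ⊢ x ⇓ z [ size x + (s + t) ]
  if-true : ∀ {b p q x u v y s t} →
    b ⊢ x ⇓ u ∙ v [ s ] → p ⊢ x ⇓ y [ t ] →
    if b then p else q ⊢ x ⇓ y [ size x + (s + t) ]
  if-false : ∀ {b p q x y s t} →
    b ⊢ x ⇓ nil [ s ] → q ⊢ x ⇓ y [ t ] →
    if b then p else q ⊢ x ⇓ y [ size x + (s + t) ]
  while-stop : ∀ {b p x s} →
    b ⊢ x ⇓ nil [ s ] →
    while b loop p ⊢ x ⇓ x [ size x + s ]
  while-step : ∀ {b p x u v y z r s t} →
    b ⊢ x ⇓ u ∙ v [ r ] → p ⊢ x ⇓ y [ s ] →
    while b loop p ⊢ y ⇓ z [ t ] →
    while b loop p ⊢ x ⇓ z [ size x + (r + (s + t)) ]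

-- Numbers are encoded in unary.  This does not affect any complexity notion
-- below: a number in an encoding is either bounded by the number of objects
-- the instance consists of, or it is the parameter.

encℕ : ℕ → Tree
encℕ zero    = nil
encℕ (suc n) = nil ∙ encℕ n

encFin : ∀ {n} → Fin n → Tree
encFin i = encℕ (toℕ i)

encList : ∀ {A : Set} → (A → Tree) → List A → Tree
encList enc []       = nil
encList enc (a ∷ as) = enc a ∙ encList enc as

encBool : Bool → Tree
encBool false = nil
encBool true  = nil ∙ nil

encSubset : ∀ {n} → Subset n → Tree
encSubset S = encList encBool (toList S)

Computable : (ℕ → ℕ) → Set
Computable f = Σ[ p ∈ Prog ] ∀ n → ∃[ t ] p ⊢ encℕ n ⇓ encℕ (f n) [ t ]

------------------------------------------------------------------------
-- Parameterized problems and parameterized reductions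

-- A language L ⊆ Tree × ℕ is the case Instance = Tree × ℕ, encode = proj₁,
-- param = proj₂.

record Problem : Set₁ where
  field
    Instance : Set
    encode   : Instance → Tree
    param    : Instance → ℕ
    Yes      : Instance → Set

  input : Instance → Tree
  input I = encode I ∙ encℕ (param I)

open Problem

infix 4 _≤fpt_

record _≤fpt_ (P Q : Problem) : Set where
  field
    algorithm    : Prog
    g            : ℕ → ℕ
    g-computable : Computable g
    c            : ℕ
    h            : ℕ → ℕ
    h-computable : Computable h
    reduces      : (I : Instance P) →
      Σ[ J ∈ Instance Q ] ∃[ t ]
        algorithm ⊢ input P I ⇓ input Q J [ t ]
        × t ≤ g (param P I) * size (encode P I) ^ c
        × param Q J ≡ h (param P I)
        × (Yes P I ⇔ Yes Q J)

------------------------------------------------------------------------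
-- Boolean circuits and the W-hierarchy

-- A gate over w available wires; conjunctions and disjunctions have
-- in-degree at least 2.

data Gate (w : ℕ) : Set where
  neg      : Fin w → Gate w
  and or   : Fin w → Fin w → List (Fin w) → Gate w

-- Gates n w: an acyclic circuit with n inputs, its nodes numbered 0, …, w - 1
-- such that the most recently added gate is number 0 and the inputs have the
-- last n numbers.

infixl 5 _▹_

data Gates (n : ℕ) : ℕ → Set where
  []  : Gates n n
  _▹_ : ∀ {w} → Gates n w → Gate w → Gates n (suc w)

record Circuit : Set where
  field
    inputs : ℕ
    nodes  : ℕ
    gates  : Gates inputs nodes
    output : Fin nodes

open Circuit

predecessors : ∀ {w} → Gate w → List (Fin w)
predecessors (neg i)      = i ∷ []
predecessors (and i j ks) = i ∷ j ∷ ks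
predecessors (or i j ks)  = i ∷ j ∷ ks

gateValue : ∀ {w} → Gate w → Vec Bool w → Bool
gateValue (neg i)      v = not (lookup v i)
gateValue (and i j ks) v = conjunction (map (lookup v) (i ∷ j ∷ ks))
gateValue (or i j ks)  v = disjunction (map (lookup v) (i ∷ j ∷ ks))

values : ∀ {n w} → Gates n w → Vec Bool n → Vec Bool w
values []       ρ = ρ
values (gs ▹ g) ρ = gateValue g (values gs ρ) ∷ values gs ρ

-- For each node, the maximal total weight of the gates on a path from an
-- input to that node.

pathWeights : (∀ {w} → Gate w → ℕ) → ∀ {n w} → Gates n w → Vec ℕ w
pathWeights wt {n} []       = replicate n 0
pathWeights wt     (gs ▹ g) =
  wt g + foldr _⊔_ 0 (map (lookup ws) (predecessors g)) ∷ ws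
  where ws = pathWeights wt gs

-- 1 for gates of in-degree greater than 2, and 0 for all others.

large : ∀ {w} → Gate w → ℕ
large (neg _)           = 0
large (and _ _ [])      = 0
large (and _ _ (_ ∷ _)) = 1
large (or _ _ [])       = 0
large (or _ _ (_ ∷ _))  = 1

depth weft : Circuit → ℕ
depth C = lookup (pathWeights (λ _ → 1) (gates C)) (output C)
weft  C = lookup (pathWeights large (gates C)) (output C)

-- An assignment is given by the set of inputs that are set to true.

_satisfies_ : (C : Circuit) → Subset (inputs C) → Set
C satisfies ρ = lookup (values (gates C) ρ) (output C) ≡ true

encGate : ∀ {w} → Gate w → Tree
encGate g = encℕ (tag g) ∙ encList encFin (predecessors g)
  where
  tag : ∀ {w} → Gate w → ℕ
  tag (neg _)     = 0
  tag (and _ _ _) = 1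
  tag (or _ _ _)  = 2

encGates : ∀ {n w} → Gates n w → Tree
encGates []       = nil
encGates (gs ▹ g) = encGate g ∙ encGates gs

encCircuit : Circuit → Tree
encCircuit C = encℕ (inputs C) ∙ encGates (gates C) ∙ encFin (output C)

-- Weighted circuit satisfiability for circuits of weft ≤ t and depth ≤ d:
-- is there a satisfying assignment with exactly k inputs set to true?

WCS : (t d : ℕ) → Problem
WCS t d = record
  { Instance = (Σ[ C ∈ Circuit ] weft C ≤ t × depth C ≤ d) × ℕ
  ; encode   = λ I → encCircuit (proj₁ (proj₁ I))
  ; param    = proj₂
  ; Yes      = λ ((C , _) , k) →
                 Σ[ ρ ∈ Subset (inputs C) ] ∣ ρ ∣ ≡ k × (C satisfies ρ)
  }

W[_] : ℕ → Problem → Set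
W[ t ] P = ∃[ d ] P ≤fpt WCS t d

W[_]-hard : ℕ → Problem → Set₁
W[ t ]-hard Q = (P : Problem) → W[ t ] P → P ≤fpt Q

------------------------------------------------------------------------
-- Shared memory programs

data Op (d : ℕ) : Set where
  write read : Fin d → Op d

-- nothing is the label ε.

Label : ℕ → Set
Label d = Maybe (Op d)

record Thread (d : ℕ) : Set where
  field
    states      : ℕ
    init        : Fin states
    transitions : List (Fin states × Label d × Fin states)

open Thread

record Program : Set where
  field
    domain  : ℕ
    initial : Fin domain
    threads : ℕ
    thread  : Fin threads → Thread domain

record Config (A : Program) : Set where
  open Program A
  field
    pc  : (i : Fin threads) → Fin (states (thread i))
    mem : Fin domain

data MemStep {d : ℕ} : Label d → Fin d → Fin d → Set where
  read    : ∀ {a}   → MemStep (just (read a)) a a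
  write   : ∀ {a b} → MemStep (just (write b)) a b
  silent  : ∀ {a}   → MemStep nothing a a

module _ (A : Program) where
  open Program A
  open Config

  c⁰ : Config A
  c⁰ = record { pc = λ i → init (thread i) ; mem = initial }

  Step : Config A → Config A → Set
  Step c c′ = ∃[ i ] ∃[ l ]
    (pc c i , l , pc c′ i) ∈ₗ transitions (thread i)
    × (∀ j → j ≢ i → pc c′ j ≡ pc c j)
    × MemStep l (mem c) (mem c′)

  Reachable : Config A → Set
  Reachable c = Star Step c⁰ c

------------------------------------------------------------------------
-- Leader contributor reachability

record LCRInstance : Set where
  field
    domain      : ℕ
    initial     : Fin domain
    leader      : Thread domain
    contributor : Thread domain
    unsafe      : Subset (states leader)

  -- The leader, as thread zero, and t copies of the contributor.

  instantiate : ℕ → Program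
  instantiate t = record
    { domain  = domain
    ; initial = initial
    ; threads = suc t
    ; thread  = λ { zero → leader ; (suc _) → contributor }
    }

  UnsafeReachable : Set
  UnsafeReachable = ∃[ t ] Σ[ c ∈ Config (instantiate t) ]
    Reachable (instantiate t) c × Config.pc c zero ∈ unsafe

encLabel : ∀ {d} → Label d → Tree
encLabel nothing      = nil
encLabel (just (write a)) = encℕ 1 ∙ encFin a
encLabel (just (read a)) = encℕ 2 ∙ encFin a

encThread : ∀ {d} → Thread d → Tree
encThread P = encℕ (states P) ∙ encFin (init P) ∙
  encList (λ (q , l , q′) → encFin q ∙ encLabel l ∙ encFin q′) (transitions P)

encLCR : LCRInstance → Tree
encLCR I = encℕ domain ∙ encFin initial ∙
  encThread leader ∙ encThread contributor ∙ encSubset unsafe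
  where open LCRInstance I

LCR : (LCRInstance → ℕ) → Problem
LCR κ = record
  { Instance = LCRInstance
  ; encode   = encLCR
  ; param    = κ
  ; Yes      = LCRInstance.UnsafeReachable
  }

LCR[D] LCR[L] : Problem
LCR[D] = LCR LCRInstance.domain
LCR[L] = LCR (λ I → states (LCRInstance.leader I))

{-# OPTIONS --safe #-}

-- Only the depth bound of the circuits matters, not their weft.  A circuit of
-- depth d unfolds into a formula of polynomial size, and the formula into a
-- nondeterministic straight-line program that verifies it.  Its elementary
-- checks ask whether register i contains input x, where k registers hold the
-- inputs that are set to true.  In LCR(L) the leader needs k + 2 states to
-- publish the registers in a large domain, and a contributor walks through the
-- program.  In LCR(D) the leader itself walks through the program, and k
-- contributors, each of which has guessed the contents of one register, follow
-- it and censor the checks; since all walks send the same number of messages,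
-- a contributor that has missed one cannot count up to the end.

module Submission where

open import Defs
open import Data.Bool using (Bool; true; false; not)
open import Data.Bool.ListAction using () renaming (and to conjunction; or to disjunction)
open import Data.Empty using (⊥; ⊥-elim)
open import Data.Fin using (Fin; zero; suc; toℕ; fromℕ; inject₁; _≟_; combine; _↑ˡ_; _↑ʳ_; splitAt)
open import Data.Fin.Properties
  using (any?; injective⇒≤; suc-injective; toℕ-injective; toℕ<n; toℕ-fromℕ; toℕ-inject₁; toℕ-combine; toℕ-↑ˡ;
    toℕ-↑ʳ; combine-injective; fromℕ≢inject₁; inject₁-injective; splitAt-↑ˡ; splitAt-↑ʳ; ↑ˡ-injective; ↑ʳ-injective)
open import Data.Fin.Relation.Unary.Top using (view; ‵fromℕ; ‵inject₁)
open import Data.Fin.Subset using (Subset; ∣_∣; inside; outside) renaming (_∈_ to _∈ₛ_)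
open import Data.Fin.Subset.Properties using (∉⊥)
open import Data.List using (List; []; _∷_; _++_; map; concatMap; length; drop; foldr)
open import Data.List.Membership.Propositional using (_∈_; find; lose)
open import Data.List.Membership.Propositional.Properties
  using (∈-concatMap⁺; ∈-concatMap⁻; ∈-map⁺; ∈-map⁻; ∈-++⁺ˡ; ∈-++⁺ʳ; ∈-++⁻)
open import Data.List.Properties using (concatMap-map; ++-assoc; ++-identityʳ)
open import Data.List.Relation.Unary.All as All using (All; []; _∷_)
open import Data.List.Relation.Unary.Any using (Any; here; there)
open import Data.Maybe using (just; nothing)
open import Data.Nat using (ℕ; zero; suc; pred; _+_; _*_; _∸_; _^_; _⊔_; _≤_; _<_; z≤n; s≤s; s≤s⁻¹)
open import Data.Nat.Properties
  using (≤-refl; ≤-reflexive; ≤-trans; ≤-antisym; module ≤-Reasoning; n≤1+n; 1+n≰n; m≤n⇒m<n∨m≡n; m≤n⇒m≤1+n;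
    m≤m+n; m≤n+m; m≤n⇒m≤n+o; m≤n⇒m≤o+n; m≤m⊔n; m≤n⊔m; m∸n≤m; +-assoc; +-comm; +-suc; +-mono-≤; +-monoˡ-≤; +-monoʳ-≤;
    *-assoc; *-comm; *-identityʳ; *-distribʳ-+; *-mono-≤; *-monoˡ-≤; *-monoʳ-≤; [m*n]*[o*p]≡[m*o]*[n*p];
    ^-*-assoc; ^-distribˡ-+-*; ^-monoˡ-≤)
  renaming (suc-injective to ℕ-suc-injective)
open import Data.Product using (∃-syntax; Σ-syntax; _×_; _,_; proj₁; proj₂)
open import Data.Sum using (inj₁; inj₂)
open import Data.Unit using (⊤; tt)
open import Data.Vec using (Vec; []; _∷_; lookup; replicate; tabulate; _[_]≔_; here; there)
open import Data.Vec.Properties using (lookup∘tabulate; lookup∘update; lookup∘update′; lookup-replicate)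
open import Data.Vec.Relation.Unary.All as VAll using ([]; _∷_)
open import Function.Base using (_∘_; case_of_)
open import Function.Bundles using (_⇔_; mk⇔; Equivalence)
open import Function.Construct.Composition using (_⇔-∘_)
open import Function.Definitions using (Injective)
open import Relation.Binary.Construct.Closure.ReflexiveTransitive using (Star; ε; _◅_; _◅◅_; gmap)
open import Relation.Binary.PropositionalEquality using (_≡_; _≢_; refl; sym; trans; cong; cong₂; subst)
open import Relation.Nullary using (does; yes; no)

open Equivalence using (to; from)

-- Polynomial-time functions on trees

-- A reduction must be an explicit program with a proved time bound, in a language without variables
-- or recursion. The sublanguage `Fun` has bounded loops only and cannot recurse along a circuit;
-- but `d` is fixed together with the reduction, so the program may be nested `d` levels deep. In
-- shared memory programs a message may be overwritten unread, read many times or missed, and the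
-- number of contributors is out of control. For LCR(L) this is harmless because the leader
-- announces each register once and never returns to it: all echoes of a register agree, however
-- many there are. For LCR(D) the contents cannot be sent at all, as the number of inputs is not
-- bounded by the parameter, and contributors standing for the same register may have guessed
-- differently. What counts is that at least one survives for each register: every surviving content
-- is compatible with all claims made, so any choice of one survivor per register yields contents on
-- which the code runs.

append reverseOnto : Tree → Tree → Tree
append nil     b = b
append (x ∙ y) b = x ∙ append y b
reverseOnto nil     b = b
reverseOnto (x ∙ y) b = reverseOnto y (x ∙ b)

forEach : (Tree → Tree) → Tree → Tree → Tree
forEach f nil     e = nil
forEach f (x ∙ y) e = append (f ((x ∙ y) ∙ e)) (forEach f y e)

stripCommon : Tree → Tree → Tree
stripCommon a       nil     = a ∙ nil
stripCommon nil     (y ∙ b) = nil ∙ (y ∙ b)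
stripCommon (x ∙ a) (y ∙ b) = stripCommon a b

stripBoth : Tree → Tree
stripBoth nil     = nil
stripBoth (a ∙ b) = stripCommon a b

-- Every Fun runs in polynomial time.  The body of a loop gets the remaining
-- list rather than its first element, so that unary numbers and positions in
-- lists can serve as loop indices; strip provides subtraction, comparison and
-- indexing.

infixl 6 _⨟_

data Fun : Set where
  nil id hd tl strip : Fun
  cons          : Fun → Fun → Fun
  _⨟_           : Fun → Fun → Fun
  if_then_else_ : Fun → Fun → Fun → Fun
  for_collect_       : Fun → Fun → Fun

choose : Tree → Tree → Tree → Tree
choose nil     a b = b
choose (_ ∙ _) a b = a

⟦_⟧ : Fun → Tree → Tree
⟦ nil ⟧ x = nil
⟦ id ⟧ x = x
⟦ hd ⟧ x = head x
⟦ tl ⟧ x = tail x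
⟦ strip ⟧ x = stripBoth x
⟦ cons p q ⟧ x = ⟦ p ⟧ x ∙ ⟦ q ⟧ x
⟦ p ⨟ q ⟧ x = ⟦ q ⟧ (⟦ p ⟧ x)
⟦ if b then p else q ⟧ x = choose (⟦ b ⟧ x) (⟦ p ⟧ x) (⟦ q ⟧ x)
⟦ for p collect q ⟧ x = forEach ⟦ q ⟧ (⟦ p ⟧ x) x

-- Polynomial bounds and running times.

data Poly : Set where
  var : Poly
  con : ℕ → Poly
  _⊕_ _⊗_ _⊚_ : Poly → Poly → Poly

infixl 6 _⊕_
infixl 7 _⊗_
infixr 8 _⊚_

eval : Poly → ℕ → ℕ
eval var n = n
eval (con c) n = c
eval (p ⊕ q) n = eval p n + eval q n
eval (p ⊗ q) n = eval p n * eval q n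
eval (p ⊚ q) n = eval p (eval q n)

eval-mono : ∀ p {m n} → m ≤ n → eval p m ≤ eval p n
eval-mono var m≤n = m≤n
eval-mono (con c) m≤n = ≤-refl
eval-mono (p ⊕ q) m≤n = +-mono-≤ (eval-mono p m≤n) (eval-mono q m≤n)
eval-mono (p ⊗ q) m≤n = *-mono-≤ (eval-mono p m≤n) (eval-mono q m≤n)
eval-mono (p ⊚ q) m≤n = eval-mono p (eval-mono q m≤n)

infix 4 _⊢_⇓_≤_

_⊢_⇓_≤_ : Prog → Tree → Tree → ℕ → Set
p ⊢ x ⇓ y ≤ B = ∃[ t ] (p ⊢ x ⇓ y [ t ]) × t ≤ B

size≥1 : ∀ x → 1 ≤ size x
size≥1 nil     = s≤s z≤n
size≥1 (x ∙ y) = s≤s z≤n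

size-head : ∀ x → size (head x) ≤ size x
size-head nil = ≤-refl
size-head (x ∙ y) = m≤n⇒m≤1+n (m≤m+n _ _)

size-tail : ∀ x → size (tail x) ≤ size x
size-tail nil = ≤-refl
size-tail (x ∙ y) = m≤n⇒m≤1+n (m≤n+m _ (size x))

-- Each rule charges the size of its input, which pays for the new node of `cons`. So a time bound
-- also bounds the size of the value that the next program in a sequence receives.
output≤time : ∀ {p x y t} → p ⊢ x ⇓ y [ t ] → size y ≤ t
output≤time {x = x} nil = size≥1 x
output≤time id = ≤-refl
output≤time {x = x} hd = size-head x
output≤time {x = x} tl = size-tail x
output≤time {x = x} (cons p q) = +-mono-≤ (size≥1 x) (+-mono-≤ (output≤time p) (output≤time q))
output≤time {x = x} (seq p q) = m≤n⇒m≤o+n (size x) (m≤n⇒m≤o+n _ (output≤time q))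
output≤time {x = x} (if-true b p) = m≤n⇒m≤o+n (size x) (m≤n⇒m≤o+n _ (output≤time p))
output≤time {x = x} (if-false b p) = m≤n⇒m≤o+n (size x) (m≤n⇒m≤o+n _ (output≤time p))
output≤time {x = x} (while-stop b) = m≤m+n (size x) _
output≤time {x = x} (while-step {r = r} {s = s} b p w) =
  m≤n⇒m≤o+n (size x) (m≤n⇒m≤o+n r (m≤n⇒m≤o+n s (output≤time w)))

weaken : ∀ {p x y B C} → p ⊢ x ⇓ y ≤ B → B ≤ C → p ⊢ x ⇓ y ≤ C
weaken (t , r , le) h = t , r , ≤-trans le h

nil≤ : ∀ {x N} → size x ≤ N → nil ⊢ x ⇓ nil ≤ N
nil≤ h = _ , nil , h
id≤ : ∀ {x N} → size x ≤ N → id ⊢ x ⇓ x ≤ N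
id≤ h = _ , id , h
hd≤ : ∀ {x N} → size x ≤ N → hd ⊢ x ⇓ head x ≤ N
hd≤ h = _ , hd , h
tl≤ : ∀ {x N} → size x ≤ N → tl ⊢ x ⇓ tail x ≤ N
tl≤ h = _ , tl , h

cons≤ : ∀ {p q x y z N A B} → size x ≤ N → p ⊢ x ⇓ y ≤ A → q ⊢ x ⇓ z ≤ B →
  cons p q ⊢ x ⇓ y ∙ z ≤ N + (A + B)
cons≤ h (_ , p , a) (_ , q , b) = _ , cons p q , +-mono-≤ h (+-mono-≤ a b)

seq≤ : ∀ {p q x y z N A B} → size x ≤ N → p ⊢ x ⇓ y ≤ A → q ⊢ y ⇓ z ≤ B →
  p ⨾ q ⊢ x ⇓ z ≤ N + (A + B)
seq≤ h (_ , p , a) (_ , q , b) = _ , seq p q , +-mono-≤ h (+-mono-≤ a b)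

-- Charging both branches makes the bound independent of the outcome of the test.
if≤ : ∀ {b p q x u y z N A B C} → size x ≤ N → b ⊢ x ⇓ u ≤ A → p ⊢ x ⇓ y ≤ B → q ⊢ x ⇓ z ≤ C →
  if b then p else q ⊢ x ⇓ choose u y z ≤ N + (A + (B + C))
if≤ {u = nil} {B = B} h (_ , b , a) _ (_ , q , c) =
  _ , if-false b q , +-mono-≤ h (+-mono-≤ a (m≤n⇒m≤o+n B c))
if≤ {u = _ ∙ _} {C = C} h (_ , b , a) (_ , p , c) _ =
  _ , if-true b p , +-mono-≤ h (+-mono-≤ a (m≤n⇒m≤n+o C c))

stop≤ : ∀ {b p x N A} → size x ≤ N → b ⊢ x ⇓ nil ≤ A → while b loop p ⊢ x ⇓ x ≤ N + A
stop≤ h (_ , b , a) = _ , while-stop b , +-mono-≤ h a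

step≤ : ∀ {b p x u v y z N A B C} → size x ≤ N → b ⊢ x ⇓ u ∙ v ≤ A → p ⊢ x ⇓ y ≤ B →
  while b loop p ⊢ y ⇓ z ≤ C → while b loop p ⊢ x ⇓ z ≤ (N + A + B) + C
step≤ {N = N} {A} {B} {C} h (_ , b , a) (_ , p , b') (_ , w , c) = _ , while-step b p w ,
  ≤-trans (+-mono-≤ h (+-mono-≤ a (+-mono-≤ b' c)))
          (≤-reflexive (trans (cong (N +_) (sym (+-assoc A B C))) (trans (sym (+-assoc N (A + B) C)) (cong (_+ C) (sym (+-assoc N A B))))))

-- Compilation of `Fun` and its cost.

reverseP : Prog
reverseP = while hd loop cons (hd ⨾ tl) (cons (hd ⨾ hd) tl)

stripP : Prog
stripP = while (if hd then tl else nil) loop cons (hd ⨾ tl) (tl ⨾ tl)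

-- The loop state is `acc ∙ (ys ∙ e)`: results so far, rest of the list, environment. Each result is
-- pushed onto `acc` by `reverseP`, whose own state ends with `nil` in front; hence the `tl` after
-- it.
forP : Prog → Prog → Prog
forP p q =
  cons p id ⨾ cons nil id
  ⨾ (while (tl ⨾ hd) loop
       cons (cons (tl ⨾ q) hd ⨾ reverseP ⨾ tl)
            (tl ⨾ cons (hd ⨾ tl) tl))
  ⨾ cons hd nil ⨾ reverseP ⨾ tl

compile : Fun → Prog
compile nil = nil
compile id = id
compile hd = hd
compile tl = tl
compile strip = stripP
compile (cons p q) = cons (compile p) (compile q)
compile (p ⨟ q) = compile p ⨾ compile q
compile (if b then p else q) = if compile b then compile p else compile q
compile (for p collect q) = forP (compile p) (compile q)

-- In the cost bounds of loops the variable stands for a bound on the size of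
-- the loop state.
revIter revCost : Poly
revIter = var ⊕ var ⊕ (var ⊕ ((var ⊕ (var ⊕ var)) ⊕ (var ⊕ ((var ⊕ (var ⊕ var)) ⊕ var))))
revCost = var ⊗ revIter ⊕ (var ⊕ var)

size-rotate : ∀ x y b → size (y ∙ (x ∙ b)) ≡ size ((x ∙ y) ∙ b)
size-rotate x y b = cong suc (trans (+-suc (size y) _) (cong suc
  (trans (sym (+-assoc (size y) (size x) (size b))) (cong (_+ size b) (+-comm (size y) (size x))))))

count : ∀ K R {a b} → suc a ≤ b → K + (a * K + R) ≤ b * K + R
count K R {a} h = ≤-trans (≤-reflexive (sym (+-assoc K (a * K) R))) (+-monoˡ-≤ R (*-monoˡ-≤ K h))

size-tail< : ∀ x y → suc (size y) ≤ size (x ∙ y)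
size-tail< x y = s≤s (m≤n+m (size y) (size x))

-- Moving an entry from one list to the other keeps the size of the state, so one bound `S` serves
-- all iterations, of which there are at most `size a`.
reverse≤ : ∀ a b {S} → size (a ∙ b) ≤ S →
  reverseP ⊢ a ∙ b ⇓ nil ∙ reverseOnto a b ≤ size a * eval revIter S + (S + S)
reverse≤ nil b {S} h = weaken (stop≤ h (hd≤ h)) (m≤n+m _ (eval revIter S + 0))
reverse≤ (x ∙ y) b {S} h = weaken
  (step≤ h (hd≤ h) (cons≤ h (seq≤ h (hd≤ h) (tl≤ ha)) (cons≤ h (seq≤ h (hd≤ h) (hd≤ ha)) (tl≤ h)))
         (reverse≤ y (x ∙ b) (≤-trans (≤-reflexive (size-rotate x y b)) h)))
  (count (eval revIter S) (S + S) (size-tail< x y))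
  where ha = ≤-trans (size-head ((x ∙ y) ∙ b)) h

reverse-bound : ∀ a b {S} → size (a ∙ b) ≤ S → reverseP ⊢ a ∙ b ⇓ nil ∙ reverseOnto a b ≤ eval revCost S
reverse-bound a b {S} h = weaken (reverse≤ a b h) (+-monoˡ-≤ (S + S) (*-monoˡ-≤ (eval revIter S) (≤-trans (size-head (a ∙ b)) h)))

stripIter stripCost : Poly
stripIter = var ⊕ (var ⊕ (var ⊕ (var ⊕ var)))
  ⊕ (var ⊕ ((var ⊕ (var ⊕ var)) ⊕ (var ⊕ (var ⊕ var))))
stripCost = var ⊗ stripIter ⊕ (var ⊕ (var ⊕ (var ⊕ (var ⊕ var))))

strip≤ : ∀ a b {S} → size (a ∙ b) ≤ S →
  stripP ⊢ a ∙ b ⇓ stripCommon a b ≤ size a * eval stripIter S + (S + (S + (S + (S + S))))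
strip≤ nil nil {S} h = weaken (stop≤ h (if≤ h (hd≤ h) (tl≤ h) (nil≤ h))) (m≤n+m _ (eval stripIter S + 0))
strip≤ (x ∙ a) nil {S} h = weaken (stop≤ h (if≤ h (hd≤ h) (tl≤ h) (nil≤ h))) (m≤n+m _ (size (x ∙ a) * eval stripIter S))
strip≤ nil (y ∙ b) {S} h = weaken (stop≤ h (if≤ h (hd≤ h) (tl≤ h) (nil≤ h))) (m≤n+m _ (eval stripIter S + 0))
strip≤ (x ∙ a) (y ∙ b) {S} h = weaken
  (step≤ h (if≤ h (hd≤ h) (tl≤ h) (nil≤ h))
     (cons≤ h (seq≤ h (hd≤ h) (tl≤ (≤-trans (size-head ((x ∙ a) ∙ (y ∙ b))) h)))
              (seq≤ h (tl≤ h) (tl≤ (≤-trans (size-tail ((x ∙ a) ∙ (y ∙ b))) h))))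
     (strip≤ a b (≤-trans (s≤s (+-mono-≤ (size-tail (x ∙ a)) (size-tail (y ∙ b)))) h)))
  (count (eval stripIter S) _ (size-tail< x a))

strip-bound : ∀ x {S} → size x ≤ S → stripP ⊢ x ⇓ stripBoth x ≤ eval stripCost S
strip-bound nil {S} h = weaken (stop≤ h (if≤ h (hd≤ h) (tl≤ h) (nil≤ h))) (m≤n+m _ (S * eval stripIter S))
strip-bound (a ∙ b) {S} h = weaken (strip≤ a b h)
  (+-monoˡ-≤ _ (*-monoˡ-≤ (eval stripIter S) (≤-trans (size-head (a ∙ b)) h)))

append-nil : ∀ x → append x nil ≡ x
append-nil nil     = refl
append-nil (x ∙ y) = cong (x ∙_) (append-nil y)

reverseOnto-reverseOnto : ∀ x y z → reverseOnto (reverseOnto x y) z ≡ reverseOnto y (append x z)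
reverseOnto-reverseOnto nil     y z = refl
reverseOnto-reverseOnto (x ∙ a) y z = reverseOnto-reverseOnto a (x ∙ y) z

size-reverseOnto : ∀ a b → size (reverseOnto a b) ≤ size a + size b
size-reverseOnto nil     b = n≤1+n _
size-reverseOnto (x ∙ y) b = ≤-trans (size-reverseOnto y (x ∙ b))
  (≤-reflexive (ℕ-suc-injective (size-rotate x y b)))

-- The loop of forP produces its results in reverse order.
accumulate : (Tree → Tree) → Tree → Tree → Tree → Tree
accumulate f nil     e acc = acc
accumulate f (x ∙ y) e acc = accumulate f y e (reverseOnto (f ((x ∙ y) ∙ e)) acc)

accumulate-forEach : ∀ f xs e acc → reverseOnto (accumulate f xs e acc) nil ≡ reverseOnto acc (forEach f xs e)
accumulate-forEach f nil     e acc = refl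
accumulate-forEach f (x ∙ y) e acc = trans
  (accumulate-forEach f y e (reverseOnto r acc)) (reverseOnto-reverseOnto r acc (forEach f y e))
  where r = f ((x ∙ y) ∙ e)

-- `E` bounds the input of the loop body, `Q` its time and thereby its output, and `W` the
-- accumulator.
module For (f : Tree → Tree) (q : Prog) (e : Tree) (E Q W : ℕ)
  (run : ∀ ys → size (ys ∙ e) ≤ E → q ⊢ ys ∙ e ⇓ f (ys ∙ e) ≤ Q) where

  S V : ℕ
  S = suc (W + E)
  V = suc (Q + W)

  guard : Prog
  guard = tl ⨾ hd

  body : Prog
  body = cons (cons (tl ⨾ q) hd ⨾ reverseP ⨾ tl) (tl ⨾ cons (hd ⨾ tl) tl)

  revV bodyCost iterCost : ℕ
  revV = eval revCost V
  bodyCost = S + ((S + ((S + ((S + ((S + (S + Q)) + S)) + revV)) + revV)) + (S + (S + (E + ((E + (E + E)) + E)))))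
  iterCost = S + (S + (S + E)) + bodyCost

  size-state : ∀ {acc ys} → size acc ≤ W → size (ys ∙ e) ≤ E → size (acc ∙ (ys ∙ e)) ≤ S
  size-state a b = s≤s (+-mono-≤ a b)

  guard≤ : ∀ acc ys → size acc ≤ W → size (ys ∙ e) ≤ E → guard ⊢ acc ∙ (ys ∙ e) ⇓ ys ≤ S + (S + E)
  guard≤ acc ys hW hE = seq≤ st (tl≤ st) (hd≤ hE)
    where st = size-state {acc} {ys} hW hE

  body≤ : ∀ acc x y → size acc ≤ W → size ((x ∙ y) ∙ e) ≤ E →
    body ⊢ acc ∙ ((x ∙ y) ∙ e) ⇓ reverseOnto (f ((x ∙ y) ∙ e)) acc ∙ (y ∙ e) ≤ bodyCost
  body≤ acc x y hW hE with run (x ∙ y) hE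
  ... | r@(_ , q⇓ , q≤) with reverse-bound (f ((x ∙ y) ∙ e)) acc {V} (s≤s (+-mono-≤ (≤-trans (output≤time q⇓) q≤) hW))
  ... | v@(_ , v⇓ , v≤) =
    cons≤ st (seq≤ st (seq≤ st (cons≤ st (seq≤ st (tl≤ st) r) (hd≤ st)) v) (tl≤ (≤-trans (output≤time v⇓) v≤)))
             (seq≤ st (tl≤ st) (cons≤ hE (seq≤ hE (hd≤ hE) (tl≤ (≤-trans (size-head ((x ∙ y) ∙ e)) hE))) (tl≤ hE)))
    where st = size-state {acc} {x ∙ y} hW hE

  -- A potential: an iteration adds at most `Q` to the accumulator and shortens the remaining list
  -- by at least one unit of size, so the sum never grows.
  Fits : Tree → Tree → Set
  Fits xs acc = size acc + size xs * Q ≤ W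

  fits⇒≤ : ∀ xs acc → Fits xs acc → size acc ≤ W
  fits⇒≤ xs acc hW = ≤-trans (m≤m+n (size acc) _) hW

  shrink : ∀ x y → size ((x ∙ y) ∙ e) ≤ E → size (y ∙ e) ≤ E
  shrink x y hE = ≤-trans (s≤s (+-monoˡ-≤ (size e) (size-tail (x ∙ y)))) hE

  fits-step : ∀ x y acc → size ((x ∙ y) ∙ e) ≤ E → Fits (x ∙ y) acc → Fits y (reverseOnto (f ((x ∙ y) ∙ e)) acc)
  fits-step x y acc hE hW with run (x ∙ y) hE
  ... | _ , q⇓ , q≤ = begin
      size (reverseOnto r acc) + size y * Q ≤⟨ +-monoˡ-≤ _ (size-reverseOnto r acc) ⟩
      size r + size acc + size y * Q        ≤⟨ +-monoˡ-≤ _ (+-monoˡ-≤ (size acc) (≤-trans (output≤time q⇓) q≤)) ⟩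
      Q + size acc + size y * Q             ≡⟨ cong (_+ size y * Q) (+-comm Q (size acc)) ⟩
      size acc + Q + size y * Q             ≡⟨ +-assoc (size acc) Q _ ⟩
      size acc + suc (size y) * Q           ≤⟨ +-monoʳ-≤ (size acc) (*-monoˡ-≤ Q (size-tail< x y)) ⟩
      size acc + size (x ∙ y) * Q           ≤⟨ hW ⟩
      W ∎
    where
    open ≤-Reasoning
    r = f ((x ∙ y) ∙ e)

  loop≤ : ∀ xs acc → size (xs ∙ e) ≤ E → Fits xs acc →
    while guard loop body ⊢ acc ∙ (xs ∙ e) ⇓ accumulate f xs e acc ∙ (nil ∙ e) ≤ size xs * iterCost + (S + (S + (S + E)))
  loop≤ nil acc hE hW = weaken (stop≤ (size-state {acc} {nil} hW′ hE) (guard≤ acc nil hW′ hE)) (m≤n+m _ (iterCost + 0))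
    where hW′ = fits⇒≤ nil acc hW
  loop≤ (x ∙ y) acc hE hW = weaken
    (step≤ (size-state {acc} {x ∙ y} hW′ hE) (guard≤ acc (x ∙ y) hW′ hE) (body≤ acc x y hW′ hE)
       (loop≤ y _ (shrink x y hE) (fits-step x y acc hE hW)))
    (count iterCost (S + (S + (S + E))) (size-tail< x y))
    where hW′ = fits⇒≤ (x ∙ y) acc hW

  size-accumulate : ∀ xs acc → size (xs ∙ e) ≤ E → Fits xs acc → size (accumulate f xs e acc) ≤ W
  size-accumulate nil     acc hE hW = fits⇒≤ nil acc hW
  size-accumulate (x ∙ y) acc hE hW = size-accumulate y _ (shrink x y hE) (fits-step x y acc hE hW)

  H : ℕ
  H = suc (W + 1)

  run≤ : ∀ {p} xs {m P} → size e ≤ m → size (xs ∙ e) ≤ E → size xs ≤ P → 1 + P * Q ≤ W → p ⊢ e ⇓ xs ≤ P →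
    forP p q ⊢ e ⇓ forEach f xs e ≤
      m + ((m + ((m + ((m + ((m + ((m + (P + m)) + (E + (E + E)))) + (P * iterCost + (S + (S + (S + E)))))) + (S + (S + S)))) + eval revCost H)) + eval revCost H)
  run≤ xs {m} {P} hx hE hP hW p with reverse-bound (accumulate f xs e nil) nil (s≤s (+-monoˡ-≤ 1 (size-accumulate xs nil hE fits)))
    where
    fits : Fits xs nil
    fits = ≤-trans (s≤s (*-monoˡ-≤ Q hP)) hW
  ... | v@(_ , v⇓ , v≤) = subst (λ z → forP _ q ⊢ e ⇓ z ≤ _) (accumulate-forEach f xs e nil)
    (seq≤ hx (seq≤ hx (seq≤ hx (seq≤ hx
        (seq≤ hx (cons≤ hx p (id≤ hx)) (cons≤ hE (nil≤ hE) (id≤ hE)))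
        (weaken (loop≤ xs nil hE fits) (+-monoˡ-≤ _ (*-monoˡ-≤ iterCost hP))))
        (cons≤ st (hd≤ st) (nil≤ st)))
        v)
        (tl≤ (≤-trans (output≤time v⇓) v≤)))
    where
    fits : Fits xs nil
    fits = ≤-trans (s≤s (*-monoˡ-≤ Q hP)) hW
    st = size-state {accumulate f xs e nil} {nil} (size-accumulate xs nil hE fits)
           (≤-trans (s≤s (+-monoˡ-≤ (size e) (size≥1 xs))) hE)

-- A transcription of the bound of `run≤` with the least admissible `E`, `Q` and `W`. Keeping its
-- shape lets `compile-correct` hold by computation, without any arithmetic.
forBound : Poly → Poly → Poly
forBound P B =
  var ⊕ ((var ⊕ ((var ⊕ ((var ⊕ ((var ⊕ ((var ⊕ (P ⊕ var)) ⊕ (E ⊕ (E ⊕ E)))) ⊕ (P ⊗ iter ⊕ (S ⊕ (S ⊕ (S ⊕ E)))))) ⊕ (S ⊕ (S ⊕ S)))) ⊕ revH)) ⊕ revH)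
  where
  E = con 1 ⊕ (P ⊕ var)
  Q = B ⊚ E
  W = con 1 ⊕ P ⊗ Q
  S = con 1 ⊕ (W ⊕ E)
  revV = revCost ⊚ (con 1 ⊕ (Q ⊕ W))
  revH = revCost ⊚ (con 1 ⊕ (W ⊕ con 1))
  iter = S ⊕ (S ⊕ (S ⊕ E)) ⊕ (S ⊕ ((S ⊕ ((S ⊕ ((S ⊕ ((S ⊕ (S ⊕ Q)) ⊕ S)) ⊕ revV)) ⊕ revV)) ⊕ (S ⊕ (S ⊕ (E ⊕ ((E ⊕ (E ⊕ E)) ⊕ E))))))

bound : Fun → Poly
bound nil = var
bound id = var
bound hd = var
bound tl = var
bound strip = stripCost
bound (cons p q) = var ⊕ (bound p ⊕ bound q)
bound (p ⨟ q) = var ⊕ (bound p ⊕ bound q ⊚ bound p)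
bound (if b then p else q) = var ⊕ (bound b ⊕ (bound p ⊕ bound q))
bound (for p collect q) = forBound (bound p) (bound q)

compile-correct : ∀ F x {m} → size x ≤ m → compile F ⊢ x ⇓ ⟦ F ⟧ x ≤ eval (bound F) m
compile-correct nil x h = nil≤ h
compile-correct id x h = id≤ h
compile-correct hd x h = hd≤ h
compile-correct tl x h = tl≤ h
compile-correct strip x h = strip-bound x h
compile-correct (cons p q) x h = cons≤ h (compile-correct p x h) (compile-correct q x h)
compile-correct (p ⨟ q) x h with compile-correct p x h
... | r@(_ , p⇓ , p≤) = seq≤ h r (compile-correct q _ (≤-trans (output≤time p⇓) p≤))
compile-correct (if b then p else q) x h = if≤ h (compile-correct b x h) (compile-correct p x h) (compile-correct q x h)
compile-correct (for p collect q) x {m} h with compile-correct p x h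
... | r@(_ , p⇓ , p≤) = For.run≤ ⟦ q ⟧ (compile q) x (suc (P + m)) Q (suc (P * Q))
    (λ ys hE → compile-correct q (ys ∙ x) hE)
    (⟦ p ⟧ x) h (s≤s (+-mono-≤ hP h)) hP ≤-refl r
  where
  P = eval (bound p) m
  Q = eval (bound q) (suc (P + m))
  hP = ≤-trans (output≤time p⇓) p≤

-- Polynomial-time and parameterized reductions

-- Environments are lists, the innermost variable coming first.

v₀ v₁ v₂ v₃ v₄ : Fun
v₀ = hd
v₁ = tl ⨟ hd
v₂ = tl ⨟ v₁
v₃ = tl ⨟ v₂
v₄ = tl ⨟ v₃

-- `_⊞_` concatenates by a loop over a list of two entries, which on unary numbers is addition. In
-- `_⊠_` the `tl` removes the loop variable before `q` is run.
_⊞_ _⊠_ : Fun → Fun → Fun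
p ⊞ q = for cons p (cons q nil) collect (hd ⨟ hd)
p ⊠ q = for p collect (tl ⨟ q)

numeral : ℕ → Fun
numeral zero    = nil
numeral (suc n) = cons nil (numeral n)

append-encℕ : ∀ m n → append (encℕ m) (encℕ n) ≡ encℕ (m + n)
append-encℕ zero    n = refl
append-encℕ (suc m) n = cong (nil ∙_) (append-encℕ m n)

⊞-append : ∀ p q x → ⟦ p ⊞ q ⟧ x ≡ append (⟦ p ⟧ x) (⟦ q ⟧ x)
⊞-append p q x = cong (append (⟦ p ⟧ x)) (append-nil (⟦ q ⟧ x))

⊞-encℕ : ∀ p q {x m n} → ⟦ p ⟧ x ≡ encℕ m → ⟦ q ⟧ x ≡ encℕ n → ⟦ p ⊞ q ⟧ x ≡ encℕ (m + n)
⊞-encℕ p q {x} {m} {n} hp hq = trans (⊞-append p q x) (trans (cong₂ append hp hq) (append-encℕ m n))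

⊠-encℕ : ∀ p q {x m n} → ⟦ p ⟧ x ≡ encℕ m → ⟦ q ⟧ x ≡ encℕ n → ⟦ p ⊠ q ⟧ x ≡ encℕ (m * n)
⊠-encℕ p q {x} {m} {n} hp hq = trans (cong (λ y → forEach ⟦ tl ⨟ q ⟧ y x) hp) (go m)
  where
  go : ∀ m → forEach ⟦ tl ⨟ q ⟧ (encℕ m) x ≡ encℕ (m * n)
  go zero    = refl
  go (suc m) = trans (cong₂ append hq (go m)) (append-encℕ n (m * n))

numeral-encℕ : ∀ n {x} → ⟦ numeral n ⟧ x ≡ encℕ n
numeral-encℕ zero    = refl
numeral-encℕ (suc n) = cong (nil ∙_) (numeral-encℕ n)

polyFun : Poly → Fun
polyFun var     = id
polyFun (con c) = numeral c
polyFun (p ⊕ q) = polyFun p ⊞ polyFun q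
polyFun (p ⊗ q) = polyFun p ⊠ polyFun q
polyFun (p ⊚ q) = polyFun q ⨟ polyFun p

polyFun-eval : ∀ p n → ⟦ polyFun p ⟧ (encℕ n) ≡ encℕ (eval p n)
polyFun-eval var     n = refl
polyFun-eval (con c) n = numeral-encℕ c
polyFun-eval (p ⊕ q) n = ⊞-encℕ (polyFun p) (polyFun q) (polyFun-eval p n) (polyFun-eval q n)
polyFun-eval (p ⊗ q) n = ⊠-encℕ (polyFun p) (polyFun q) (polyFun-eval p n) (polyFun-eval q n)
polyFun-eval (p ⊚ q) n = trans (cong ⟦ polyFun p ⟧ (polyFun-eval q n)) (polyFun-eval p (eval q n))

polynomial-computable : ∀ p → Computable (eval p)
polynomial-computable p = compile (polyFun p) , λ n →
  let (t , run , _) = compile-correct (polyFun p) (encℕ n) ≤-refl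
  in t , subst (λ y → compile (polyFun p) ⊢ encℕ n ⇓ y [ t ]) (polyFun-eval p n) run

∘-computable : ∀ {f g} → Computable f → Computable g → Computable (f ∘ g)
∘-computable (p , P) (q , Q) = q ⨾ p , λ n → _ , seq (proj₂ (Q n)) (proj₂ (P _))

combine-computable : (F : Fun) (_⊛_ : ℕ → ℕ → ℕ) →
  (∀ m n → ⟦ F ⟧ (encℕ m ∙ encℕ n) ≡ encℕ (m ⊛ n)) →
  ∀ {f g} → Computable f → Computable g → Computable (λ n → f n ⊛ g n)
combine-computable F _⊛_ F≡ {f} {g} (p , P) (q , Q) = cons p q ⨾ compile F , λ n →
  let (t , run , _) = compile-correct F (encℕ (f n) ∙ encℕ (g n)) ≤-refl
  in _ , seq (cons (proj₂ (P n)) (proj₂ (Q n)))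
             (subst (λ y → compile F ⊢ encℕ (f n) ∙ encℕ (g n) ⇓ y [ t ]) (F≡ (f n) (g n)) run)

+-computable : ∀ {f g} → Computable f → Computable g → Computable (λ n → f n + g n)
+-computable = combine-computable (hd ⊞ tl) _+_ (λ m n → ⊞-encℕ hd tl {encℕ m ∙ encℕ n} refl refl)

*-computable : ∀ {f g} → Computable f → Computable g → Computable (λ n → f n * g n)
*-computable = combine-computable (hd ⊠ tl) _*_ (λ m n → ⊠-encℕ hd tl {encℕ m ∙ encℕ n} refl refl)

^-computable : ∀ {f} → Computable f → ∀ c → Computable (λ n → f n ^ c)
^-computable F zero    = polynomial-computable (con 1)
^-computable F (suc c) = *-computable F (^-computable F c)

degree : Poly → ℕ
degree var     = 1
degree (con c) = 0
degree (p ⊕ q) = degree p + degree q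
degree (p ⊗ q) = degree p + degree q
degree (p ⊚ q) = degree q * degree p

^≥1 : ∀ {s} → 1 ≤ s → ∀ c → 1 ≤ s ^ c
^≥1 h zero    = ≤-refl
^≥1 h (suc c) = *-mono-≤ h (^≥1 h c)

m≤m*n′ : ∀ m {n} → 1 ≤ n → m ≤ m * n
m≤m*n′ m h = ≤-trans (≤-reflexive (sym (*-identityʳ m))) (*-monoʳ-≤ m h)

m≤n*m′ : ∀ m {n} → 1 ≤ n → m ≤ n * m
m≤n*m′ m {n} h = ≤-trans (m≤m*n′ m h) (≤-reflexive (*-comm m n))

-- This separates parameter from size: inputs have size at most b · s with `b` depending on the
-- parameter alone, so a polynomial bound takes the form g(k) · s^c that a reduction asks for.
eval-scale : ∀ p b {s} → 1 ≤ s → eval p (b * s) ≤ eval p b * s ^ degree p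
eval-scale var     b {s} h = ≤-reflexive (cong (b *_) (sym (*-identityʳ s)))
eval-scale (con c) b h = ≤-reflexive (sym (*-identityʳ c))
eval-scale (p ⊕ q) b {s} h = begin
  eval p (b * s) + eval q (b * s)               ≤⟨ +-mono-≤ (eval-scale p b h) (eval-scale q b h) ⟩
  eval p b * s ^ m + eval q b * s ^ n           ≤⟨ +-mono-≤ (*-monoʳ-≤ (eval p b) (m≤m*n′ (s ^ m) (^≥1 h n))) (*-monoʳ-≤ (eval q b) (m≤n*m′ (s ^ n) (^≥1 h m))) ⟩
  eval p b * (s ^ m * s ^ n) + eval q b * (s ^ m * s ^ n) ≡⟨ *-distribʳ-+ _ (eval p b) (eval q b) ⟨
  (eval p b + eval q b) * (s ^ m * s ^ n)       ≡⟨ cong ((eval p b + eval q b) *_) (^-distribˡ-+-* s m n) ⟨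
  (eval p b + eval q b) * s ^ (m + n)           ∎
  where
  open ≤-Reasoning
  m = degree p
  n = degree q
eval-scale (p ⊗ q) b {s} h = begin
  eval p (b * s) * eval q (b * s)               ≤⟨ *-mono-≤ (eval-scale p b h) (eval-scale q b h) ⟩
  (eval p b * s ^ m) * (eval q b * s ^ n)       ≡⟨ [m*n]*[o*p]≡[m*o]*[n*p] (eval p b) (s ^ m) (eval q b) (s ^ n) ⟩
  (eval p b * eval q b) * (s ^ m * s ^ n)       ≡⟨ cong ((eval p b * eval q b) *_) (^-distribˡ-+-* s m n) ⟨
  (eval p b * eval q b) * s ^ (m + n)           ∎
  where
  open ≤-Reasoning
  m = degree p
  n = degree q
eval-scale (p ⊚ q) b {s} h = begin
  eval p (eval q (b * s))                       ≤⟨ eval-mono p (eval-scale q b h) ⟩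
  eval p (eval q b * s ^ n)                     ≤⟨ eval-scale p (eval q b) (^≥1 h n) ⟩
  eval p (eval q b) * (s ^ n) ^ m               ≡⟨ cong (eval p (eval q b) *_) (^-*-assoc s n m) ⟩
  eval p (eval q b) * s ^ (n * m)               ∎
  where
  open ≤-Reasoning
  m = degree p
  n = degree q

*-^ : ∀ c a b → (a * b) ^ c ≡ a ^ c * b ^ c
*-^ zero    a b = refl
*-^ (suc c) a b = trans (cong (a * b *_) (*-^ c a b)) ([m*n]*[o*p]≡[m*o]*[n*p] a b (a ^ c) (b ^ c))

size-encℕ : ∀ n → size (encℕ n) ≡ n + suc n
size-encℕ zero    = refl
size-encℕ (suc n) = trans (cong (λ z → suc (suc z)) (size-encℕ n)) (cong suc (sym (+-suc n (suc n))))

open Problem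

-- The value is 2k + 3: `encℕ k` has size 2k + 1, the node above it adds 1, and s + (2k + 2) is at
-- most (2k + 3) · s as `s` is positive.
paramSize : Poly
paramSize = con 2 ⊕ (var ⊕ (con 1 ⊕ var))

size-input : ∀ P I → size (input P I) ≤ eval paramSize (param P I) * size (encode P I)
size-input P I = begin
  suc (s + size (encℕ k))       ≡⟨ cong (λ z → suc (s + z)) (size-encℕ k) ⟩
  suc (s + (k + suc k))         ≡⟨ cong suc (+-comm s _) ⟩
  suc (k + suc k) + s           ≤⟨ +-monoˡ-≤ s (m≤m*n′ (suc (k + suc k)) h) ⟩
  suc (k + suc k) * s + s       ≡⟨ +-comm _ s ⟩
  suc (suc (k + suc k)) * s     ∎
  where
  open ≤-Reasoning
  s = size (encode P I)
  k = param P I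
  h = size≥1 (encode P I)

polytime-reduction : ∀ {P Q : Problem} (F : Fun) (h : Poly) (f : Instance P → Instance Q) →
  (∀ I → ⟦ F ⟧ (input P I) ≡ input Q (f I)) →
  (∀ I → param Q (f I) ≡ eval h (param P I)) →
  (∀ I → Yes P I ⇔ Yes Q (f I)) →
  P ≤fpt Q
polytime-reduction {P} {Q} F h f output≡ param≡ Yes-⇔ = record
  { algorithm    = compile F
  ; g            = eval (bound F ⊚ paramSize)
  ; g-computable = polynomial-computable (bound F ⊚ paramSize)
  ; c            = degree (bound F)
  ; h            = eval h
  ; h-computable = polynomial-computable h
  ; reduces      = λ I →
      let (t , run , t≤) = compile-correct F (input P I) (size-input P I) in
      f I , t , subst (λ y → compile F ⊢ input P I ⇓ y [ t ]) (output≡ I) run ,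
      ≤-trans t≤ (eval-scale (bound F) (eval paramSize (param P I)) (size≥1 (encode P I))) ,
      param≡ I , Yes-⇔ I
  }

-- Membership in W[1] is itself a reduction, so hardness of a problem follows by composing with a
-- reduction from `WCS`.
≤fpt-trans : ∀ {P Q R} → P ≤fpt Q → Q ≤fpt R → P ≤fpt R
≤fpt-trans {P} {Q} {R} P≤Q Q≤R = record
  { algorithm    = A.algorithm ⨾ B.algorithm
  ; g            = g
  ; g-computable = +-computable (polynomial-computable paramSize)
      (+-computable A.g-computable
        (*-computable (∘-computable B.g-computable A.h-computable) (^-computable A.g-computable B.c)))
  ; c            = c
  ; h            = B.h ∘ A.h
  ; h-computable = ∘-computable B.h-computable A.h-computable
  ; reduces      = reduces
  }
  where
  module A = _≤fpt_ P≤Q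
  module B = _≤fpt_ Q≤R
  g : ℕ → ℕ
  g k = eval paramSize k + (A.g k + B.g (A.h k) * A.g k ^ B.c)
  -- The summands account for reading the input, the first algorithm and the second one; since `s`
  -- is positive, each of the three powers of `s` is at most `s ^ c`.
  c = 1 + (A.c + A.c * B.c)
  reduces : ∀ I → Σ[ J ∈ Instance R ] ∃[ t ] A.algorithm ⨾ B.algorithm ⊢ input P I ⇓ input R J [ t ]
    × t ≤ g (param P I) * size (encode P I) ^ c × param R J ≡ B.h (A.h (param P I)) × (Yes P I ⇔ Yes R J)
  reduces I with A.reduces I
  ... | J , t , run , t≤ , J≡ , P⇔Q with B.reduces J
  ... | K , u , run′ , u≤ , K≡ , Q⇔R =
    K , _ , seq run run′ , time , trans K≡ (cong B.h J≡) , (Q⇔R ⇔-∘ P⇔Q)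
    where
    open ≤-Reasoning
    k = param P I
    s = size (encode P I)
    1≤s = size≥1 (encode P I)
    -- The intermediate instance is written within time `t`, so its size is at most `t`.
    J≤t : size (encode Q J) ≤ t
    J≤t = ≤-trans (≤-trans (m≤m+n _ _) (n≤1+n _)) (output≤time run)
    s≤ : s ≤ s ^ c
    s≤ = m≤m*n′ s (^≥1 1≤s (A.c + A.c * B.c))
    mid≤ : s ^ A.c ≤ s ^ c
    mid≤ = ≤-trans (m≤m*n′ _ (^≥1 1≤s (A.c * B.c))) (≤-trans (≤-reflexive (sym (^-distribˡ-+-* s A.c _))) (m≤n*m′ _ 1≤s))
    last≤ : s ^ (A.c * B.c) ≤ s ^ c
    last≤ = ≤-trans (m≤n*m′ _ (^≥1 1≤s A.c)) (≤-trans (≤-reflexive (sym (^-distribˡ-+-* s A.c _))) (m≤n*m′ _ 1≤s))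
    u≤′ : u ≤ B.g (A.h k) * A.g k ^ B.c * s ^ c
    u≤′ = begin
      u                                                ≤⟨ u≤ ⟩
      B.g (param Q J) * size (encode Q J) ^ B.c        ≡⟨ cong (λ z → B.g z * size (encode Q J) ^ B.c) J≡ ⟩
      B.g (A.h k) * size (encode Q J) ^ B.c            ≤⟨ *-monoʳ-≤ (B.g (A.h k)) (^-monoˡ-≤ B.c (≤-trans J≤t t≤)) ⟩
      B.g (A.h k) * (A.g k * s ^ A.c) ^ B.c            ≡⟨ cong (B.g (A.h k) *_) (*-^ B.c (A.g k) (s ^ A.c)) ⟩
      B.g (A.h k) * (A.g k ^ B.c * (s ^ A.c) ^ B.c)    ≡⟨ cong (λ z → B.g (A.h k) * (A.g k ^ B.c * z)) (^-*-assoc s A.c B.c) ⟩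
      B.g (A.h k) * (A.g k ^ B.c * s ^ (A.c * B.c))    ≡⟨ *-assoc (B.g (A.h k)) _ _ ⟨
      B.g (A.h k) * A.g k ^ B.c * s ^ (A.c * B.c)      ≤⟨ *-monoʳ-≤ (B.g (A.h k) * A.g k ^ B.c) last≤ ⟩
      B.g (A.h k) * A.g k ^ B.c * s ^ c                ∎
    time : size (input P I) + (t + u) ≤ g k * s ^ c
    time = begin
      size (input P I) + (t + u)
        ≤⟨ +-mono-≤ (≤-trans (size-input P I) (*-monoʳ-≤ (eval paramSize k) s≤))
             (+-mono-≤ (≤-trans t≤ (*-monoʳ-≤ (A.g k) mid≤)) u≤′) ⟩
      eval paramSize k * s ^ c + (A.g k * s ^ c + B.g (A.h k) * A.g k ^ B.c * s ^ c)
        ≡⟨ cong (eval paramSize k * s ^ c +_) (*-distribʳ-+ (s ^ c) (A.g k) _) ⟨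
      eval paramSize k * s ^ c + (A.g k + B.g (A.h k) * A.g k ^ B.c) * s ^ c
        ≡⟨ *-distribʳ-+ (s ^ c) (eval paramSize k) _ ⟨
      g k * s ^ c ∎

-- Enumerations and the loops that generate them

-- In descending order, as a loop over a unary number runs through them.
fins : ∀ n → List (Fin n)
fins zero    = []
fins (suc n) = fromℕ n ∷ map inject₁ (fins n)

-- The elements of a list, each with the number of elements after it.
slots : ∀ {A : Set} (c : List A) → List (Fin (length c) × A)
slots []      = []
slots (a ∷ c) = (fromℕ (length c) , a) ∷ map (λ (r , b) → inject₁ r , b) (slots c)

module _ {B : Set} {encB : B → Tree} where

  append-encList : ∀ xs ys → append (encList encB xs) (encList encB ys) ≡ encList encB (xs ++ ys)
  append-encList []       ys = refl
  append-encList (x ∷ xs) ys = cong (encB x ∙_) (append-encList xs ys)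

  ⊞-encList : ∀ p q {x xs ys} → ⟦ p ⟧ x ≡ encList encB xs → ⟦ q ⟧ x ≡ encList encB ys →
    ⟦ p ⊞ q ⟧ x ≡ encList encB (xs ++ ys)
  ⊞-encList p q {x} {xs} {ys} hp hq = trans (⊞-append p q x) (trans (cong₂ append hp hq) (append-encList xs ys))

  forEach-encList : ∀ {A : Set} {encA : A → Tree} f {e} (F : A → List B) xs →
    (∀ a ys → f ((encA a ∙ ys) ∙ e) ≡ encList encB (F a)) →
    forEach f (encList encA xs) e ≡ encList encB (concatMap F xs)
  forEach-encList f F []       h = refl
  forEach-encList f F (x ∷ xs) h =
    trans (cong₂ append (h x _) (forEach-encList f F xs h)) (append-encList (F x) (concatMap F xs))

  -- In a loop over a unary number the tail of the remaining list is the index itself. This is why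
  -- the generators below refer to it as `v₀ ⨟ tl`, or `v₁ ⨟ tl` from inside another loop.
  forEach-fins : ∀ f {e} n (F : Fin n → List B) →
    (∀ i → f ((nil ∙ encFin i) ∙ e) ≡ encList encB (F i)) →
    forEach f (encℕ n) e ≡ encList encB (concatMap F (fins n))
  forEach-fins f         zero    F h = refl
  forEach-fins f {e} (suc n) F h = trans
    (cong₂ append
      (trans (cong (λ m → f ((nil ∙ encℕ m) ∙ e)) (sym (toℕ-fromℕ n))) (h (fromℕ n)))
      (trans (forEach-fins f n (F ∘ inject₁)
               (λ i → trans (cong (λ m → f ((nil ∙ encℕ m) ∙ e)) (sym (toℕ-inject₁ i))) (h (inject₁ i))))
             (cong (encList encB) (sym (concatMap-map F inject₁ (fins n))))))
    (append-encList (F (fromℕ n)) (concatMap F (map inject₁ (fins n))))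

  -- The position of an instruction is the length of the list after it, which a loop body can
  -- compute with `lengthOf` from the remaining list.
  forEach-slots : ∀ {A : Set} {encA : A → Tree} f {e} c (F : Fin (length c) × A → List B) →
    (∀ r a rest → toℕ r ≡ length rest → f ((encA a ∙ encList encA rest) ∙ e) ≡ encList encB (F (r , a))) →
    forEach f (encList encA c) e ≡ encList encB (concatMap F (slots c))
  forEach-slots f []      F h = refl
  forEach-slots f (a ∷ c) F h = trans
    (cong₂ append (h (fromℕ (length c)) a c (toℕ-fromℕ (length c)))
      (trans (forEach-slots f c (λ (r , b) → F (inject₁ r , b))
               (λ r b rest eq → h (inject₁ r) b rest (trans (toℕ-inject₁ r) eq)))
             (cong (encList encB) (sym (concatMap-map F _ (slots c))))))
    (append-encList (F _) (concatMap F (map _ (slots c))))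

lengthOf : Fun → Fun
lengthOf p = for p collect cons nil nil

lengthOf-encList : ∀ p {A : Set} {encA : A → Tree} {x} (xs : List A) → ⟦ p ⟧ x ≡ encList encA xs → ⟦ lengthOf p ⟧ x ≡ encℕ (length xs)
lengthOf-encList p {encA = encA} {x} xs h = trans (cong (λ y → forEach ⟦ cons nil nil ⟧ y x) h) (go xs)
  where
  go : ∀ xs → forEach ⟦ cons nil nil ⟧ (encList encA xs) x ≡ encℕ (length xs)
  go []       = refl
  go (_ ∷ xs) = cong (nil ∙_) (go xs)

-- Stripping leaves a nonempty remainder on one side exactly if the two numbers differ; the
-- conditional is the disjunction of both sides.
differ : Fun → Fun → Fun
differ p q = cons p q ⨟ strip ⨟ (if hd then cons nil nil else tl)

unless : {A : Set} → Bool → List A → List A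
unless true  xs = []
unless false xs = xs

choose-differ : ∀ {n} (i j : Fin n) {B : Set} {encB : B → Tree} {u xs} → u ≡ encList encB xs →
  choose (⟦ differ hd tl ⟧ (encFin i ∙ encFin j)) u nil ≡ encList encB (unless (does (i ≟ j)) xs)
choose-differ zero    zero    h = refl
choose-differ zero    (suc j) h = h
choose-differ (suc i) zero    h = h
choose-differ (suc i) (suc j) h = choose-differ i j h

-- Register codes: straight-line programs over k registers with constant
-- contents v 0, …, v (k - 1) < n.  An instruction is passed either by a check
-- (some listed pair (i , x) has v i ≡ x) or by a jump over one of the
-- listed numbers of instructions.

Instr : ℕ → ℕ → Set
Instr k n = List (Fin k × Fin n) × List ℕ

Code : ℕ → ℕ → Set
Code k n = List (Instr k n)

data Run {k n} (v : Fin k → Fin n) : Code k n → Set where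
  done  : Run v []
  check : ∀ {L ms c i} → (i , v i) ∈ L → Run v c → Run v ((L , ms) ∷ c)
  jump  : ∀ {L ms c m} → m ∈ ms → Run v (drop m c) → Run v ((L , ms) ∷ c)

encPair : ∀ {k n} → Fin k × Fin n → Tree
encPair (i , x) = encFin i ∙ encFin x

encInstr : ∀ {k n} → Instr k n → Tree
encInstr (L , ms) = encList encPair L ∙ encList encℕ ms

record CodeInstance : Set where
  field
    registers range : ℕ
    code : Code registers range

RegisterCode : Problem
RegisterCode = record
  { Instance = CodeInstance
  ; encode   = λ I → let open CodeInstance I in encℕ range ∙ encList encInstr code
  ; param    = CodeInstance.registers
  ; Yes      = λ I → let open CodeInstance I in Σ[ v ∈ (Fin registers → Fin range) ] Run v code
  }

-- De Morgan's laws: that a gate has value `b` means that all, or some, of its predecessors have a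
-- certain value. A negation counts as a conjunction with a single member.
childPolarity isConjunctive : ∀ {w} → Gate w → Bool → Bool
childPolarity (neg _)     b = not b
childPolarity (and _ _ _) b = b
childPolarity (or _ _ _)  b = b
isConjunctive (neg _)     b = true
isConjunctive (and _ _ _) b = b
isConjunctive (or _ _ _)  b = not b

module _ {k n : ℕ} where

  -- Checks express equality only, so an inequality is stated as the disjunction over all other
  -- contents.
  noteq : Fin k → Fin n → List (Fin k × Fin n)
  noteq i x = concatMap (λ y → unless (does (x ≟ y)) ((i , y) ∷ [])) (fins n)

  literal : Bool → Fin n → Code k n
  literal true  x = (concatMap (λ i → (i , x) ∷ []) (fins k) , []) ∷ []
  literal false x = concatMap (λ i → (noteq i x , []) ∷ []) (fins k)

  -- The assignment must have weight exactly `k`, so no two registers may hold the same input: for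
  -- each `x`, one of the two registers contains something else.
  distinct : Code k n
  distinct = concatMap (λ i → concatMap (λ j → unless (does (i ≟ j))
    (concatMap (λ x → (noteq i x ++ noteq j x , []) ∷ []) (fins n))) (fins k)) (fins k)

  goto : List ℕ → Instr k n
  goto ms = [] , ms

  -- Between the blocks of a disjunction control is either at a goto (some
  -- disjunct has been verified) or one instruction later (none has been yet).
  block : Code k n → Code k n
  block c = goto (suc (length c) ∷ []) ∷ goto (0 ∷ suc (length c) ∷ []) ∷ c

  connect : Bool → List (Code k n) → Code k n
  connect true  cs = concatMap (λ c → c) cs
  -- The first jump enters the first block at its second instruction, as nothing is verified yet. At
  -- the end, success arrives at the penultimate instruction and jumps over the last one, a dead end
  -- that stops a run without a verified disjunct.
  connect false cs = goto (1 ∷ []) ∷ concatMap block cs ++ goto (1 ∷ []) ∷ goto [] ∷ []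

  -- A gate is copied once for every path to it, which stays polynomial only because `d` is a
  -- constant. Recursion on `d` rather than on the circuit alone is what `verifyF` can imitate.
  verify : ℕ → Bool → ∀ {w} → Gates n w → Fin w → Code k n
  verify d       b []       x       = literal b x
  verify d       b (gs ▹ g) (suc i) = verify d b gs i
  verify zero    b (gs ▹ g) zero    = []
  verify (suc d) b (gs ▹ g) zero    =
    connect (isConjunctive g b) (map (verify d (childPolarity g b) gs) (predecessors g))

-- Generating the register code of a circuit.

noteqF : Fun
-- The environment is `i`, `x`, `n`. The first `v₂` is `n`; in the body, behind the loop variable,
-- `v₂` is `x`.
noteqF = for v₂ collect (if differ v₂ (v₀ ⨟ tl) then cons (cons v₁ (v₀ ⨟ tl)) nil else nil)

noteqF-correct : ∀ {k n} (i : Fin k) (x : Fin n) e →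
  ⟦ noteqF ⟧ (encFin i ∙ encFin x ∙ encℕ n ∙ e) ≡ encList encPair (noteq i x)
noteqF-correct {n = n} i x e = forEach-fins _ n _ λ y → choose-differ x y refl

literalF : Fun
literalF = if hd
  then cons (cons (for k collect cons (cons (v₀ ⨟ tl) v₂) nil) nil) nil
  else (for k collect cons (cons (cons (v₀ ⨟ tl) (cons v₂ (cons v₃ nil)) ⨟ noteqF) nil) nil)
  where k = tl ⨟ tl ⨟ tl

literalF-correct : ∀ {k n} b (x : Fin n) →
  ⟦ literalF ⟧ (encBool b ∙ encFin x ∙ encℕ n ∙ encℕ k) ≡ encList encInstr (literal {k} b x)
literalF-correct {k} true x = cong (λ z → (z ∙ nil) ∙ nil) (forEach-fins _ k _ (λ i → refl))
literalF-correct {k} false x = forEach-fins _ k _ (λ i → cong (λ z → (z ∙ nil) ∙ nil) (noteqF-correct i x nil))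

distinctF : Fun
distinctF = for tl collect (for tl ⨟ tl collect (if differ (v₁ ⨟ tl) (v₀ ⨟ tl) then
  (for v₂ collect cons (cons (noteq′ (v₂ ⨟ tl) ⊞ noteq′ (v₁ ⨟ tl)) nil) nil) else nil))
  where
  noteq′ : Fun → Fun
  noteq′ p = cons p (cons (v₀ ⨟ tl) (cons v₃ nil)) ⨟ noteqF

distinctF-correct : ∀ {k n} → ⟦ distinctF ⟧ (encℕ n ∙ encℕ k) ≡ encList encInstr (distinct {k} {n})
distinctF-correct {k} {n} = forEach-fins _ k _ λ i → forEach-fins _ k _ λ j →
  choose-differ i j (forEach-fins _ n _ λ x → cong (λ z → (z ∙ nil) ∙ nil)
    (⊞-encList (cons (v₂ ⨟ tl) (cons (v₀ ⨟ tl) (cons v₃ nil)) ⨟ noteqF) (cons (v₁ ⨟ tl) (cons (v₀ ⨟ tl) (cons v₃ nil)) ⨟ noteqF)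
      {(nil ∙ encFin x) ∙ (nil ∙ encFin j) ∙ (nil ∙ encFin i) ∙ encℕ n ∙ encℕ k}
      (noteqF-correct i x nil) (noteqF-correct j x nil)))

connectF : Fun
connectF = if tl then (for hd collect (v₀ ⨟ hd)) else
  cons (cons nil (cons (numeral 1) nil))
    ((for hd collect (v₀ ⨟ hd ⨟ cons (cons nil (cons jumpLength nil)) (cons (cons nil (cons nil (cons jumpLength nil))) id)))
      ⊞ cons (cons nil (cons (numeral 1) nil)) (cons (cons nil nil) nil))
  where jumpLength = cons nil (lengthOf id)

connectF-correct : ∀ {k n} b (cs : List (Code k n)) →
  ⟦ connectF ⟧ (encList (encList encInstr) cs ∙ encBool b) ≡ encList encInstr (connect b cs)
connectF-correct true  cs = forEach-encList _ (λ c → c) cs (λ c ys → refl)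
connectF-correct {k} {n} false cs = cong (_ ∙_)
  (⊞-encList
    (for hd collect (v₀ ⨟ hd ⨟ cons (cons nil (cons jumpLength nil)) (cons (cons nil (cons nil (cons jumpLength nil))) id)))
    (cons (cons nil (cons (numeral 1) nil)) (cons (cons nil nil) nil))
    {encList (encList encInstr) cs ∙ encBool false} {ys = goto (1 ∷ []) ∷ goto [] ∷ []}
    (forEach-encList _ block cs λ c ys →
      cong (λ z → (nil ∙ (nil ∙ z) ∙ nil) ∙ ((nil ∙ nil ∙ (nil ∙ z) ∙ nil) ∙ encList encInstr c)) (lengthOf-encList id c refl))
    refl)
  where jumpLength = cons nil (lengthOf id)

notF : Fun → Fun
notF p = if p then nil else cons nil nil

-- Stripping the node number against the list of gates does the lookup. If gates remain, their first
-- one is the node; otherwise the remainder of the number is the index of an input, since inputs are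
-- numbered last.
verifyF gateF : ℕ → Fun
verifyF d = cons v₀ (cons (cons v₁ v₂ ⨟ strip) (tl ⨟ tl ⨟ tl)) ⨟
  (if v₁ ⨟ tl then gateF d else (cons v₀ (cons (v₁ ⨟ hd) (tl ⨟ tl)) ⨟ literalF))

gateF zero    = nil
gateF (suc d) =
  -- The tags 0, 1, 2 of `neg`, `and`, `or` are told apart by testing the tag and its tail; the two
  -- entries are `childPolarity` and `isConjunctive`.
  cons (if tag then v₀ else notF v₀)
    (cons (if tag then (if tag ⨟ tl then notF v₀ else v₀) else cons nil nil)
      (cons (gate ⨟ tl) (cons (v₁ ⨟ tl ⨟ tl) (tl ⨟ tl)))) ⨟
  cons (for v₂ collect cons (cons v₁ (cons (v₀ ⨟ hd) (tl ⨟ tl ⨟ tl ⨟ tl)) ⨟ verifyF d) nil) v₁ ⨟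
  connectF
  where
  gate = v₁ ⨟ tl ⨟ hd
  tag  = gate ⨟ hd

verifyF-correct : ∀ {k n} d b {w} (gs : Gates n w) i →
  ⟦ verifyF d ⟧ (encBool b ∙ encFin i ∙ encGates gs ∙ encℕ n ∙ encℕ k) ≡ encList encInstr (verify {k} d b gs i)

gateF-correct : ∀ {k n} d b {w} (gs : Gates n w) g →
  ⟦ gateF d ⟧ (encBool b ∙ (nil ∙ encGates (gs ▹ g)) ∙ encℕ n ∙ encℕ k) ≡ encList encInstr (verify {k} d b (gs ▹ g) zero)

verifyF-correct d b []       x       = literalF-correct b x
verifyF-correct d b (gs ▹ g) zero    = gateF-correct d b gs g
verifyF-correct d b (gs ▹ g) (suc i) = verifyF-correct d b gs i

gateF-correct zero    b gs g = refl
gateF-correct {k} {n} (suc d) b gs g = trans (shape b g)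
  (trans (cong (λ z → ⟦ connectF ⟧ (z ∙ encBool (isConjunctive g b))) (children (childPolarity g b) (predecessors g)))
    (connectF-correct (isConjunctive g b) (map (verify d (childPolarity g b) gs) (predecessors g))))
  where
  child : Tree → Tree
  child = ⟦ cons (cons v₁ (cons (v₀ ⨟ hd) (tl ⨟ tl ⨟ tl ⨟ tl)) ⨟ verifyF d) nil ⟧
  env : ∀ b g → Tree
  env b g = encBool (childPolarity g b) ∙ encBool (isConjunctive g b) ∙ encList encFin (predecessors g) ∙ encGates gs ∙ encℕ n ∙ encℕ k
  shape : ∀ b g → ⟦ gateF (suc d) ⟧ (encBool b ∙ (nil ∙ encGates (gs ▹ g)) ∙ encℕ n ∙ encℕ k) ≡
    ⟦ connectF ⟧ (forEach child (encList encFin (predecessors g)) (env b g) ∙ encBool (isConjunctive g b))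
  shape true  (neg _)     = refl
  shape true  (and _ _ _) = refl
  shape true  (or _ _ _)  = refl
  shape false (neg _)     = refl
  shape false (and _ _ _) = refl
  shape false (or _ _ _)  = refl
  children : ∀ p js {c l} → forEach child (encList encFin js) (encBool p ∙ c ∙ l ∙ encGates gs ∙ encℕ n ∙ encℕ k) ≡
    encList (encList encInstr) (map (verify {k} d p gs) js)
  children p []       = refl
  children p (j ∷ js) = cong₂ _∙_ (verifyF-correct d p gs j) (children p js)

-- Correctness of the verification code.

module _ {A B : Set} {F : A → List B} where

  collect⁺ : ∀ {a xs y} → a ∈ xs → y ∈ F a → y ∈ concatMap F xs
  collect⁺ {a} a∈ y∈ = ∈-concatMap⁺ F (lose a∈ y∈)

  collect⁻ : ∀ xs {y} → y ∈ concatMap F xs → ∃[ a ] a ∈ xs × y ∈ F a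
  collect⁻ xs y∈ = find (∈-concatMap⁻ F {xs = xs} y∈)

∈-fins : ∀ {n} (i : Fin n) → i ∈ fins n
∈-fins {suc n} i with view i
... | ‵fromℕ     = here refl
... | ‵inject₁ j = there (∈-map⁺ inject₁ (∈-fins j))

∈-unless⁻ : ∀ {n} {A : Set} (i j : Fin n) {xs : List A} {a} → a ∈ unless (does (i ≟ j)) xs → i ≢ j × a ∈ xs
∈-unless⁻ i j a∈ with i ≟ j
... | no i≢j = i≢j , a∈

∈-unless⁺ : ∀ {n} {A : Set} (i j : Fin n) {xs : List A} {a} → i ≢ j → a ∈ xs → a ∈ unless (does (i ≟ j)) xs
∈-unless⁺ i j i≢j a∈ with i ≟ j
... | yes i≡j = ⊥-elim (i≢j i≡j)
... | no _    = a∈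

Connected : Bool → {A : Set} → (A → Set) → List A → Set
Connected true  = All
Connected false = Any

drop-++ : ∀ {A : Set} (xs : List A) {ys} → drop (length xs) (xs ++ ys) ≡ ys
drop-++ []       = refl
drop-++ (x ∷ xs) = drop-++ xs

∈-noteq : ∀ {k n} {i : Fin k} {x : Fin n} {j y} → (j , y) ∈ noteq i x ⇔ (j ≡ i × y ≢ x)
∈-noteq {n = n} {i} {x} {j} {y} = mk⇔ f g
  where
  f : (j , y) ∈ noteq i x → j ≡ i × y ≢ x
  f h with collect⁻ (fins n) h
  ... | z , _ , z∈ with ∈-unless⁻ x z z∈
  ... | x≢z , here refl = refl , λ e → x≢z (sym e)
  g : j ≡ i × y ≢ x → (j , y) ∈ noteq i x
  g (refl , y≢x) = collect⁺ (∈-fins y) (∈-unless⁺ x y (λ e → y≢x (sym e)) (here refl))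

all-fins : ∀ {m} {P : Fin m → Set} → (∀ i → P i) → All P (fins m)
all-fins h = All.tabulate (λ {i} _ → h i)

all-fins-⇔ : ∀ {m} {P : Fin m → Set} → All P (fins m) ⇔ (∀ i → P i)
all-fins-⇔ = mk⇔ (λ hs i → All.lookup hs (∈-fins i)) all-fins

concatMap-id : ∀ {A B : Set} (F : A → List B) xs → concatMap (λ c → c) (map F xs) ≡ concatMap F xs
concatMap-id F []       = refl
concatMap-id F (x ∷ xs) = cong (F x ++_) (concatMap-id F xs)

module _ {k n : ℕ} (v : Fin k → Fin n) where

  -- Quantifying over the continuation `r` makes the specification compositional: in effect, control
  -- leaves the code only at its end, and can do so exactly if `P` holds.
  Verifies : Code k n → Set → Set
  Verifies c P = ∀ r → Run v (c ++ r) ⇔ (P × Run v r)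

  verifies-⇔ : ∀ {c P Q} → P ⇔ Q → Verifies c P → Verifies c Q
  verifies-⇔ e h r = mk⇔
    (λ run → let (p , run′) = to (h r) run in to e p , run′)
    (λ (q , run′) → from (h r) (from e q , run′))

  verifies-concatMap : ∀ {A : Set} {F : A → Code k n} {P : A → Set} {xs} →
    All (λ a → Verifies (F a) (P a)) xs → Verifies (concatMap F xs) (All P xs)
  verifies-concatMap [] r = mk⇔ ([] ,_) proj₂
  verifies-concatMap {F = F} {xs = a ∷ xs} (h ∷ hs) r rewrite ++-assoc (F a) (concatMap F xs) r = mk⇔
    (λ run → let (p , run′) = to (h _) run ; (ps , run″) = to (verifies-concatMap hs r) run′ in p ∷ ps , run″)
    (λ { (p ∷ ps , run) → from (h _) (p , from (verifies-concatMap hs r) (ps , run)) })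

  verifies-check : ∀ {L} → Verifies ((L , []) ∷ []) (∃[ i ] (i , v i) ∈ L)
  verifies-check r = mk⇔ (λ { (check i∈ run) → (_ , i∈) , run ; (jump () _) }) (λ ((_ , i∈) , run) → check i∈ run)

  module Disjunction {A : Set} {F : A → Code k n} {P : A → Set} (r : Code k n) where

    blocks : List A → Code k n
    blocks xs = concatMap block (map F xs) ++ goto (1 ∷ []) ∷ goto [] ∷ r

    -- `verified` and `unverified` describe the two entry points of a block; only the second depends
    -- on what the disjuncts verify.
    verified : ∀ xs → Run v (blocks xs) ⇔ Run v r
    verified [] = mk⇔ (λ { (jump (here refl) run) → run ; (jump (there ()) _) ; (check () _) }) (jump (here refl))
    verified (a ∷ xs) rewrite ++-assoc (F a) (concatMap block (map F xs)) (goto (1 ∷ []) ∷ goto [] ∷ r) = mk⇔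
      (λ { (jump (here refl) run) → to (verified xs) (subst (Run v) (drop-++ (F a)) run) ; (jump (there ()) _) ; (check () _) })
      (λ run → jump (here refl) (subst (Run v) (sym (drop-++ (F a))) (from (verified xs) run)))

    skip≡ : ∀ a xs → drop (suc (length (F a))) (F a ++ blocks xs) ≡ drop 1 (blocks xs)
    skip≡ a xs = go (F a)
      where
      go : ∀ c → drop (suc (length c)) (c ++ blocks xs) ≡ drop 1 (blocks xs)
      go []      = refl
      go (_ ∷ c) = go c

    unverified : ∀ {xs} → All (λ a → Verifies (F a) (P a)) xs → Run v (drop 1 (blocks xs)) ⇔ (Any P xs × Run v r)
    unverified [] = mk⇔ (λ { (jump () _) ; (check () _) }) (λ { (() , _) })
    unverified {a ∷ xs} (h ∷ hs) rewrite ++-assoc (F a) (concatMap block (map F xs)) (goto (1 ∷ []) ∷ goto [] ∷ r) = mk⇔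
      (λ { (jump (here refl) run) →
             let (p , run′) = to (h _) run in here p , to (verified xs) run′
         ; (jump (there (here refl)) run) →
             let (p , run′) = to (unverified hs) (subst (Run v) (skip≡ a xs) run) in there p , run′
         ; (jump (there (there ())) _) ; (check () _) })
      (λ { (here p , run) → jump (here refl) (from (h _) (p , from (verified xs) run))
         ; (there p , run) → jump (there (here refl))
             (subst (Run v) (sym (skip≡ a xs)) (from (unverified hs) (p , run))) })

  verifies-connect : ∀ b {A : Set} {F : A → Code k n} {P : A → Set} {xs} →
    All (λ a → Verifies (F a) (P a)) xs → Verifies (connect b (map F xs)) (Connected b P xs)
  verifies-connect true {F = F} {xs = xs} hs r rewrite concatMap-id F xs = verifies-concatMap hs r
  verifies-connect false {F = F} {xs = xs} hs r
    rewrite ++-assoc (concatMap block (map F xs)) (goto (1 ∷ []) ∷ goto [] ∷ []) r = mk⇔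
      (λ { (jump (here refl) run) → to (unverified hs) run ; (jump (there ()) _) ; (check () _) })
      (λ pr → jump (here refl) (from (unverified hs) pr))
    where open Disjunction {F = F} r

  verifies-distinct : Verifies distinct (∀ i j → i ≢ j → v i ≢ v j)
  verifies-distinct = verifies-⇔
    (mk⇔ (λ h i j → to all-fins-⇔ (to all-fins-⇔ h i) j) (λ h → all-fins λ i → all-fins λ j → h i j))
    (verifies-concatMap (all-fins λ i → verifies-concatMap (all-fins λ j → pair i j)))
    where
    pair : ∀ i j → Verifies (unless (does (i ≟ j)) (concatMap (λ x → (noteq i x ++ noteq j x , []) ∷ []) (fins n))) (i ≢ j → v i ≢ v j)
    pair i j with i ≟ j
    ... | yes refl = λ r → mk⇔ (λ run → (λ i≢i → ⊥-elim (i≢i refl)) , run) proj₂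
    ... | no i≢j = verifies-⇔ (mk⇔ (λ h _ → f (to all-fins-⇔ h)) (λ h → all-fins (g (h i≢j))))
                     (verifies-concatMap (all-fins λ x → verifies-check))
      where
      f : (∀ x → ∃[ l ] (l , v l) ∈ noteq i x ++ noteq j x) → v i ≢ v j
      -- If both registers held `v i`, the check for that content could not be passed by either of
      -- them.
      f h e with h (v i)
      ... | l , l∈ with ∈-++⁻ (noteq i (v i)) l∈
      ... | inj₁ l∈ with to (∈-noteq {i = i} {v i}) l∈
      ... | refl , ne = ne refl
      f h e | l , _ | inj₂ l∈ with to (∈-noteq {i = j} {v i}) l∈
      ... | refl , ne = ne (sym e)
      g : v i ≢ v j → ∀ x → ∃[ l ] (l , v l) ∈ noteq i x ++ noteq j x
      g vi≢vj x with v i ≟ x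
      ... | no vi≢x = i , ∈-++⁺ˡ (from ∈-noteq (refl , vi≢x))
      ... | yes refl = j , ∈-++⁺ʳ (noteq i x) (from ∈-noteq (refl , (λ e → vi≢vj (sym e))))

not-≡ : ∀ {x b} → not x ≡ b ⇔ x ≡ not b
not-≡ {false} {false} = mk⇔ sym sym
not-≡ {false} {true}  = mk⇔ (λ _ → refl) (λ _ → refl)
not-≡ {true} {false}  = mk⇔ (λ _ → refl) (λ _ → refl)
not-≡ {true} {true}   = mk⇔ sym sym

module _ {A : Set} (f : A → Bool) where

  conjunction-true : ∀ xs → conjunction (map f xs) ≡ true ⇔ All (λ a → f a ≡ true) xs
  conjunction-true [] = mk⇔ (λ _ → []) (λ _ → refl)
  conjunction-true (x ∷ xs) with f x in eq
  ... | true  = mk⇔ (λ h → eq ∷ to (conjunction-true xs) h) (λ { (_ ∷ hs) → from (conjunction-true xs) hs })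
  ... | false = mk⇔ (λ ()) (λ { (h ∷ _) → trans (sym eq) h })

  conjunction-false : ∀ xs → conjunction (map f xs) ≡ false ⇔ Any (λ a → f a ≡ false) xs
  conjunction-false [] = mk⇔ (λ ()) (λ ())
  conjunction-false (x ∷ xs) with f x in eq
  ... | true  = mk⇔ (λ h → there (to (conjunction-false xs) h))
                    (λ { (here h) → case trans (sym eq) h of λ () ; (there h) → from (conjunction-false xs) h })
  ... | false = mk⇔ (λ _ → here eq) (λ _ → refl)

  disjunction-false : ∀ xs → disjunction (map f xs) ≡ false ⇔ All (λ a → f a ≡ false) xs
  disjunction-false [] = mk⇔ (λ _ → []) (λ _ → refl)
  disjunction-false (x ∷ xs) with f x in eq
  ... | false = mk⇔ (λ h → eq ∷ to (disjunction-false xs) h) (λ { (_ ∷ hs) → from (disjunction-false xs) hs })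
  ... | true  = mk⇔ (λ ()) (λ { (h ∷ _) → trans (sym eq) h })

  disjunction-true : ∀ xs → disjunction (map f xs) ≡ true ⇔ Any (λ a → f a ≡ true) xs
  disjunction-true [] = mk⇔ (λ ()) (λ ())
  disjunction-true (x ∷ xs) with f x in eq
  ... | false = mk⇔ (λ h → there (to (disjunction-true xs) h))
                    (λ { (here h) → case trans (sym eq) h of λ () ; (there h) → from (disjunction-true xs) h })
  ... | true  = mk⇔ (λ _ → here eq) (λ _ → refl)

gateValue-⇔ : ∀ {w} (g : Gate w) b u →
  gateValue g u ≡ b ⇔ Connected (isConjunctive g b) (λ j → lookup u j ≡ childPolarity g b) (predecessors g)
gateValue-⇔ (neg i)      b     u = mk⇔ (λ h → to not-≡ h ∷ []) (λ { (h ∷ []) → from not-≡ h })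
gateValue-⇔ (and i j ks) true  u = conjunction-true (lookup u) (i ∷ j ∷ ks)
gateValue-⇔ (and i j ks) false u = conjunction-false (lookup u) (i ∷ j ∷ ks)
gateValue-⇔ (or i j ks)  true  u = disjunction-true (lookup u) (i ∷ j ∷ ks)
gateValue-⇔ (or i j ks)  false u = disjunction-false (lookup u) (i ∷ j ∷ ks)

foldr-⊔≤ : ∀ {A : Set} (f : A → ℕ) xs {d} → foldr _⊔_ 0 (map f xs) ≤ d → All (λ a → f a ≤ d) xs
foldr-⊔≤ f []       h = []
foldr-⊔≤ f (x ∷ xs) h = ≤-trans (m≤m⊔n (f x) _) h ∷ foldr-⊔≤ f xs (≤-trans (m≤n⊔m (f x) _) h)

-- Kept apart from injectivity: the literals depend only on the set of contents, and injectivity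
-- enters through the weight.
IsRange : ∀ {k n} → (Fin k → Fin n) → Subset n → Set
IsRange v ρ = ∀ x → lookup ρ x ≡ true ⇔ (∃[ i ] v i ≡ x)

module _ {k n : ℕ} (v : Fin k → Fin n) (ρ : Subset n) (v↠ρ : IsRange v ρ) where

  verifies-literal : ∀ b x → Verifies v (literal b x) (lookup ρ x ≡ b)
  verifies-literal true x = verifies-⇔ v (mk⇔ f g) (verifies-check v)
    where
    f : ∃[ i ] (i , v i) ∈ concatMap (λ i → (i , x) ∷ []) (fins k) → lookup ρ x ≡ true
    f (i , i∈) with collect⁻ (fins k) i∈
    ... | j , _ , here refl = from (v↠ρ x) (j , refl)
    g : lookup ρ x ≡ true → ∃[ i ] (i , v i) ∈ concatMap (λ i → (i , x) ∷ []) (fins k)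
    g h with to (v↠ρ x) h
    ... | i , refl = i , collect⁺ (∈-fins i) (here refl)
  verifies-literal false x = verifies-⇔ v (mk⇔ f g) (verifies-concatMap v (all-fins λ i → verifies-check v))
    where
    f : All (λ i → ∃[ l ] (l , v l) ∈ noteq i x) (fins k) → lookup ρ x ≡ false
    f h with lookup ρ x in eq
    ... | false = refl
    ... | true with to (v↠ρ x) eq
    ... | i , e with to all-fins-⇔ h i
    ... | l , l∈ with to (∈-noteq {i = i} {x}) l∈
    ... | refl , ne = ⊥-elim (ne e)
    g : lookup ρ x ≡ false → All (λ i → ∃[ l ] (l , v l) ∈ noteq i x) (fins k)
    g h = all-fins λ i → i , from ∈-noteq (refl , λ e → case trans (sym h) (from (v↠ρ x) (i , e)) of λ ())

  verifies-verify : ∀ d b {w} (gs : Gates n w) i → lookup (pathWeights (λ _ → 1) gs) i ≤ d →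
    Verifies v (verify d b gs i) (lookup (values gs ρ) i ≡ b)
  verifies-verify d       b []       x       h = verifies-literal b x
  verifies-verify d       b (gs ▹ g) (suc i) h = verifies-verify d b gs i h
  -- Every gate has depth at least one, so the default code `[]` is excluded by the depth bound.
  verifies-verify zero    b (gs ▹ g) zero    ()
  verifies-verify (suc d) b (gs ▹ g) zero    (s≤s h) =
    verifies-⇔ v (mk⇔ (from e) (to e))
      (verifies-connect v (isConjunctive g b)
        (All.map (λ {j} → verifies-verify d (childPolarity g b) gs j) (foldr-⊔≤ (lookup (pathWeights (λ _ → 1) gs)) (predecessors g) h)))
    where e = gateValue-⇔ g b (values gs ρ)

-- Sets of inputs and their enumerations by registers.

enumerate : ∀ {n} (ρ : Subset n) → Σ[ v ∈ (Fin ∣ ρ ∣ → Fin n) ] Injective _≡_ _≡_ v × IsRange v ρ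
enumerate [] = (λ ()) , (λ { {()} }) , λ ()
enumerate (outside ∷ ρ) with enumerate ρ
... | v , v-inj , v↠ρ = suc ∘ v , v-inj ∘ suc-injective ,
  λ { zero → mk⇔ (λ ()) (λ ()) ; (suc x) → mk⇔
    (λ h → let (i , e) = to (v↠ρ x) h in i , cong suc e)
    (λ (i , e) → from (v↠ρ x) (i , suc-injective e)) }
enumerate {suc n} (inside ∷ ρ) with enumerate ρ
... | v , v-inj , v↠ρ = w , w-inj , λ { zero → mk⇔ (λ _ → zero , refl) (λ _ → refl) ; (suc x) → mk⇔
    (λ h → let (i , e) = to (v↠ρ x) h in suc i , cong suc e)
    (λ { (zero , ()) ; (suc i , e) → from (v↠ρ x) (i , suc-injective e) }) }
  where
  w : Fin (suc ∣ ρ ∣) → Fin (suc n)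
  w zero    = zero
  w (suc i) = suc (v i)
  w-inj : Injective _≡_ _≡_ w
  w-inj {zero}  {zero}  e = refl
  w-inj {suc i} {suc j} e = cong suc (v-inj (suc-injective e))

image : ∀ {k n} → (Fin k → Fin n) → Subset n
image v = tabulate (λ x → does (any? (λ i → v i ≟ x)))

isRange-image : ∀ {k n} (v : Fin k → Fin n) → IsRange v (image v)
isRange-image v x rewrite lookup∘tabulate (λ x → does (any? (λ i → v i ≟ x))) x with any? (λ i → v i ≟ x)
... | yes p = mk⇔ (λ _ → p) (λ _ → refl)
... | no ¬p = mk⇔ (λ ()) (λ p → ⊥-elim (¬p p))

injective⇒≤-image : ∀ {k m n} {v : Fin k → Fin n} {w : Fin m → Fin n} {ρ : Subset n} →
  Injective _≡_ _≡_ v → IsRange v ρ → IsRange w ρ → k ≤ m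
injective⇒≤-image {v = v} {w} v-inj v↠ρ w↠ρ = injective⇒≤ {f = proj₁ ∘ preimage} λ {i} {j} e →
  v-inj (trans (sym (proj₂ (preimage i))) (trans (cong w e) (proj₂ (preimage j))))
  where
  preimage : ∀ i → ∃[ j ] w j ≡ v i
  preimage i = to (w↠ρ (v i)) (from (v↠ρ (v i)) (i , refl))

-- Both `v` and the canonical enumeration are injective with the same range, so each has at most as
-- many arguments as the other.
∣image∣ : ∀ {k n} {v : Fin k → Fin n} → Injective _≡_ _≡_ v → ∣ image v ∣ ≡ k
∣image∣ {v = v} v-inj with enumerate (image v)
... | w , w-inj , w↠ρ = ≤-antisym
  (injective⇒≤-image {ρ = image v} w-inj w↠ρ (isRange-image v))
  (injective⇒≤-image {ρ = image v} v-inj (isRange-image v) w↠ρ)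

module _ (t d : ℕ) where

  toCode : Instance (WCS t d) → CodeInstance
  toCode ((C , _) , k) = record
    { registers = k
    ; range     = Circuit.inputs C
    ; code      = distinct ++ verify d true (Circuit.gates C) (Circuit.output C)
    }

  toCodeF : Fun
  toCodeF = cons (cons n ((cons n tl ⨟ distinctF)
    ⊞ (cons (cons nil nil) (cons (hd ⨟ tl ⨟ tl) (cons (hd ⨟ tl ⨟ hd) (cons n tl))) ⨟ verifyF d))) tl
    where n = hd ⨟ hd

  toCodeF-correct : ∀ I → ⟦ toCodeF ⟧ (Problem.input (WCS t d) I) ≡ Problem.input RegisterCode (toCode I)
  toCodeF-correct I@((C , _) , k) = cong (λ z → (encℕ inputs ∙ z) ∙ encℕ k)
    (⊞-encList (cons n tl ⨟ distinctF)
      (cons (cons nil nil) (cons (hd ⨟ tl ⨟ tl) (cons (hd ⨟ tl ⨟ hd) (cons n tl))) ⨟ verifyF d)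
      {Problem.input (WCS t d) I}
      (distinctF-correct {k} {inputs}) (verifyF-correct d true gates output))
    where
    open Circuit C
    n = hd ⨟ hd

  toCode-⇔ : ∀ I → Problem.Yes (WCS t d) I ⇔ Problem.Yes RegisterCode (toCode I)
  toCode-⇔ ((C , _ , depth≤d) , k) = mk⇔ f g
    where
    open Circuit C
    circuitCode = verify d true gates output
    f : Σ[ ρ ∈ Subset inputs ] ∣ ρ ∣ ≡ k × (C satisfies ρ) → Σ[ v ∈ (Fin k → Fin inputs) ] Run v (distinct ++ circuitCode)
    f (ρ , refl , sat) with enumerate ρ
    ... | v , v-inj , v↠ρ = v , from (verifies-distinct v circuitCode) ((λ i j i≢j e → i≢j (v-inj e)) ,
      subst (Run v) (++-identityʳ circuitCode) (from (verifies-verify v ρ v↠ρ d true gates output depth≤d []) (sat , done)))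
    g : Σ[ v ∈ (Fin k → Fin inputs) ] Run v (distinct ++ circuitCode) → Σ[ ρ ∈ Subset inputs ] ∣ ρ ∣ ≡ k × (C satisfies ρ)
    g (v , run) with to (verifies-distinct v circuitCode) run
    ... | v-distinct , run′ = image v , ∣image∣ v-inj ,
      proj₁ (to (verifies-verify v (image v) (isRange-image v) d true gates output depth≤d [])
               (subst (Run v) (sym (++-identityʳ circuitCode)) run′))
      where
      v-inj : Injective _≡_ _≡_ v
      v-inj {i} {j} e with i ≟ j
      ... | yes i≡j = i≡j
      ... | no i≢j = ⊥-elim (v-distinct i j i≢j e)

  WCS≤RegisterCode : WCS t d ≤fpt RegisterCode
  WCS≤RegisterCode = polytime-reduction toCodeF var toCode toCodeF-correct (λ I → refl) toCode-⇔

-- Abstract systems and their encoding as instances.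

data Action (D : Set) : Set where
  put get : D → Action D
  skip    : Action D

data Effect {D : Set} : Action D → D → D → Set where
  put  : ∀ {a b} → Effect (put b) a b
  get  : ∀ {a} → Effect (get a) a a
  skip : ∀ {a} → Effect skip a a

-- Leader contributor programs over arbitrary types of states and data

record System : Set₁ where
  field
    {L C D} : Set
    start unsafe : L
    begin        : C
    blank        : D
    δL           : List (L × Action D × L)
    δC           : List (C × Action D × C)

  data Move : ∀ {t} → Vec C t → Action D → Vec C t → Set where
    here  : ∀ {t q α q′} {qs : Vec C t} → (q , α , q′) ∈ δC → Move (q ∷ qs) α (q′ ∷ qs)
    there : ∀ {t q α} {qs qs′ : Vec C t} → Move qs α qs′ → Move (q ∷ qs) α (q ∷ qs′)

  infix 4 _⟶_ _⟶*_

  data _⟶_ {t} : L × Vec C t × D → L × Vec C t × D → Set where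
    leader      : ∀ {q q′ qs α a a′} → (q , α , q′) ∈ δL → Effect α a a′ → (q , qs , a) ⟶ (q′ , qs , a′)
    contributor : ∀ {q qs qs′ α a a′} → Move qs α qs′ → Effect α a a′ → (q , qs , a) ⟶ (q , qs′ , a′)

  _⟶*_ : ∀ {t} → L × Vec C t × D → L × Vec C t × D → Set
  _⟶*_ = Star _⟶_

  initial : ∀ t → L × Vec C t × D
  initial t = start , replicate t begin , blank

  Fails : Set
  Fails = ∃[ t ] Σ[ qs ∈ Vec C t ] ∃[ a ] initial t ⟶* (unsafe , qs , a)

  move-update : ∀ {t} (qs : Vec C t) i {α q′} → (lookup qs i , α , q′) ∈ δC → Move qs α (qs [ i ]≔ q′)
  move-update (q ∷ qs) zero    h = here h
  move-update (q ∷ qs) (suc i) h = there (move-update qs i h)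

  move-index : ∀ {t} {qs qs′ : Vec C t} {α} → Move qs α qs′ →
    ∃[ i ] (lookup qs i , α , lookup qs′ i) ∈ δC × (∀ j → j ≢ i → lookup qs′ j ≡ lookup qs j)
  move-index (here h) = zero , h , λ { zero j≢i → ⊥-elim (j≢i refl) ; (suc j) _ → refl }
  move-index (there m) with move-index m
  ... | i , h , others = suc i , h , λ { zero _ → refl ; (suc j) j≢i → others j (λ e → j≢i (cong suc e)) }

-- With the unsafe state numbered zero, the unsafe set is one `inside` followed by `outside` only,
-- and a list of `outside` is encoded exactly like a unary number. Numbers outside the images of the
-- codes never occur in a run.
record Coding (S : System) : Set where
  open System S
  field
    {NL NC d}   : ℕ
    codeL       : L → Fin (suc NL)
    codeC       : C → Fin NC
    codeD       : D → Fin d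
    codeL-inj   : Injective _≡_ _≡_ codeL
    codeC-inj   : Injective _≡_ _≡_ codeC
    codeD-inj   : Injective _≡_ _≡_ codeD
    unsafe-zero : codeL unsafe ≡ zero

  label : Action D → Label d
  label (put a) = just (write (codeD a))
  label (get a) = just (read (codeD a))
  label skip    = nothing

  transition : ∀ {Q : Set} {N} → (Q → Fin N) → Q × Action D × Q → Fin N × Label d × Fin N
  transition code (q , α , q′) = code q , label α , code q′

  lcr : LCRInstance
  lcr = record
    { domain      = d
    ; initial     = codeD blank
    ; leader      = record { states = suc NL ; init = codeL start ; transitions = map (transition codeL) δL }
    ; contributor = record { states = NC ; init = codeC begin ; transitions = map (transition codeC) δC }
    ; unsafe      = inside ∷ replicate NL outside
    }

  encTransition : ∀ {Q : Set} {N} → (Q → Fin N) → Q × Action D × Q → Tree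
  encTransition code (q , α , q′) = encFin (code q) ∙ encLabel (label α) ∙ encFin (code q′)

  encLCR-lcr : encLCR lcr ≡ encℕ d ∙ encFin (codeD blank) ∙
    (encℕ (suc NL) ∙ encFin (codeL start) ∙ encList (encTransition codeL) δL) ∙
    (encℕ NC ∙ encFin (codeC begin) ∙ encList (encTransition codeC) δC) ∙
    (encBool inside ∙ encℕ NL)
  encLCR-lcr = cong₂ (λ x y → encℕ d ∙ encFin (codeD blank) ∙ (encℕ (suc NL) ∙ encFin (codeL start) ∙ x) ∙ y) (enc-map δL)
    (cong₂ (λ x y → (encℕ NC ∙ encFin (codeC begin) ∙ x) ∙ (encBool inside ∙ y)) (enc-map δC) (enc-outside NL))
    where
    enc-map : ∀ {Q : Set} {N} {code : Q → Fin N} δ →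
      encList (λ (q , l , q′) → encFin q ∙ encLabel l ∙ encFin q′) (map (transition code) δ) ≡ encList (encTransition code) δ
    enc-map []      = refl
    enc-map (x ∷ δ) = cong (_ ∙_) (enc-map δ)
    enc-outside : ∀ n → encSubset (replicate n outside) ≡ encℕ n
    enc-outside zero    = refl
    enc-outside (suc n) = cong (nil ∙_) (enc-outside n)

  module _ {t : ℕ} where

    A : Program
    A = LCRInstance.instantiate lcr t

    open Config

    -- A relation rather than a map, since configurations store states in a function, and pointwise
    -- equal functions need not be propositionally equal.
    Codes : L × Vec C t × D → Config A → Set
    Codes (q , qs , a) c = pc c zero ≡ codeL q × (∀ i → pc c (suc i) ≡ codeC (lookup qs i)) × mem c ≡ codeD a

    effect⁻ : ∀ α {a m m′} → MemStep (label α) m m′ → m ≡ codeD a → ∃[ a′ ] Effect α a a′ × m′ ≡ codeD a′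
    effect⁻ (put b) write e = b , put , refl
    effect⁻ (get b) read  e with codeD-inj e
    ... | refl = b , get , refl
    effect⁻ skip silent e = _ , skip , e

    effect⁺ : ∀ {α a a′} → Effect α a a′ → MemStep (label α) (codeD a) (codeD a′)
    effect⁺ put  = write
    effect⁺ get  = read
    effect⁺ skip = silent

    simulate⁻ : ∀ {s c c′} → Codes s c → Step A c c′ → ∃[ s′ ] s ⟶ s′ × Codes s′ c′
    simulate⁻ {q , qs , a} {c} {c′} (e₀ , e , m) (zero , l , tr , others , ms) with ∈-map⁻ (transition codeL) tr
    ... | (q₁ , α , q₂) , q₁∈ , eq with codeL-inj (trans (sym e₀) (cong proj₁ eq))
    ... | refl with effect⁻ α (subst (λ l → MemStep l (mem c) (mem c′)) (cong (λ z → proj₁ (proj₂ z)) eq) ms) m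
    ... | a′ , eff , m′ = _ , leader q₁∈ eff ,
      cong (λ z → proj₂ (proj₂ z)) eq , (λ i → trans (others (suc i) λ ()) (e i)) , m′
    simulate⁻ {q , qs , a} {c} {c′} (e₀ , e , m) (suc i , l , tr , others , ms) with ∈-map⁻ (transition codeC) tr
    ... | (q₁ , α , q₂) , q₁∈ , eq with codeC-inj (trans (sym (e i)) (cong proj₁ eq))
    ... | refl with effect⁻ α (subst (λ l → MemStep l (mem c) (mem c′)) (cong (λ z → proj₁ (proj₂ z)) eq) ms) m
    ... | a′ , eff , m′ = _ , contributor (move-update qs i q₁∈) eff , trans (others zero λ ()) e₀ , pcs , m′
      where
      pcs : ∀ j → pc c′ (suc j) ≡ codeC (lookup (qs [ i ]≔ q₂) j)
      pcs j with j ≟ i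
      ... | yes refl = trans (cong (λ z → proj₂ (proj₂ z)) eq) (cong codeC (sym (lookup∘update j qs q₂)))
      ... | no j≢i = trans (others (suc j) (λ e → j≢i (suc-injective e)))
                           (trans (e j) (cong codeC (sym (lookup∘update′ j≢i qs q₂))))

    configOf : L × Vec C t × D → Config A
    configOf (q , qs , a) = record { pc = λ { zero → codeL q ; (suc i) → codeC (lookup qs i) } ; mem = codeD a }

    simulate⁺ : ∀ {s s′ c} → Codes s c → s ⟶ s′ → Step A c (configOf s′)
    simulate⁺ (e₀ , e , refl) (leader {q′ = q′} {α = α} h eff) = zero , _ ,
      subst (λ x → (x , label α , codeL q′) ∈ _) (sym e₀) (∈-map⁺ (transition codeL) h) ,
      (λ { zero j≢i → ⊥-elim (j≢i refl) ; (suc j) _ → sym (e j) }) , effect⁺ eff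
    simulate⁺ (e₀ , e , refl) (contributor {qs′ = qs′} {α = α} m eff) with move-index m
    ... | i , h , others = suc i , _ ,
      subst (λ x → (x , label α , codeC (lookup qs′ i)) ∈ _) (sym (e i)) (∈-map⁺ (transition codeC) h) ,
      (λ { zero _ → sym e₀ ; (suc j) j≢i → trans (cong codeC (others j (λ e → j≢i (cong suc e)))) (sym (e j)) }) , effect⁺ eff

    simulate*⁻ : ∀ {s c c′} → Codes s c → Star (Step A) c c′ → ∃[ s′ ] s ⟶* s′ × Codes s′ c′
    simulate*⁻ rel ε = _ , ε , rel
    simulate*⁻ rel (st ◅ sts) with simulate⁻ rel st
    ... | _ , st′ , rel′ with simulate*⁻ rel′ sts
    ... | s″ , sts′ , rel″ = s″ , st′ ◅ sts′ , rel″

    simulate*⁺ : ∀ {s s′ c} → Codes s c → s ⟶* s′ → ∃[ c′ ] Star (Step A) c c′ × Codes s′ c′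
    simulate*⁺ rel ε          = _ , ε , rel
    simulate*⁺ rel (st ◅ sts) with simulate*⁺ (refl , (λ i → refl) , refl) sts
    ... | c′ , sts′ , rel′ = c′ , simulate⁺ rel st ◅ sts′ , rel′

    codes-initial : Codes (initial t) (c⁰ A)
    codes-initial = refl , (λ i → cong codeC (sym (lookup-replicate i begin))) , refl

  fails-⇔ : Fails ⇔ LCRInstance.UnsafeReachable lcr
  fails-⇔ = mk⇔ f g
    where
    f : Fails → LCRInstance.UnsafeReachable lcr
    f (t , qs , a , run) with simulate*⁺ codes-initial run
    ... | c , run′ , e₀ , _ = t , c , run′ , subst (_∈ₛ (inside ∷ replicate NL outside)) (sym (trans e₀ unsafe-zero)) here
    g : LCRInstance.UnsafeReachable lcr → Fails
    g (t , c , run , bad) with simulate*⁻ codes-initial run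
    ... | (q , qs , a) , run′ , e₀ , _ = t , qs , a , subst (λ q → initial t ⟶* (q , qs , a)) q≡ run′
      where
      only-zero : ∀ {i} → i ∈ₛ (inside ∷ replicate NL outside) → i ≡ zero
      only-zero here       = refl
      only-zero (there i∈) = ⊥-elim (∉⊥ i∈)
      q≡ : q ≡ unsafe
      q≡ = codeL-inj (trans (sym e₀) (trans (only-zero bad) (sym unsafe-zero)))

-- Positions in a register code.

down : ∀ {n} → Fin n → ℕ → Fin n
down i       zero    = i
-- Stopping at zero agrees with `drop` beyond the end of a list.
down zero    (suc m) = zero
down (suc i) (suc m) = inject₁ (down i m)

toℕ-down : ∀ {n} (i : Fin n) m → toℕ (down i m) ≡ toℕ i ∸ m
toℕ-down i       zero    = refl
toℕ-down zero    (suc m) = refl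
toℕ-down (suc i) (suc m) = trans (toℕ-inject₁ (down i m)) (toℕ-down i m)

down-inject₁ : ∀ {n} (i : Fin n) m → down (inject₁ i) m ≡ inject₁ (down i m)
down-inject₁ i m = toℕ-injective (trans (toℕ-down (inject₁ i) m)
  (trans (cong (_∸ m) (toℕ-inject₁ i)) (sym (trans (toℕ-inject₁ (down i m)) (toℕ-down i m)))))

-- A position in a code is the number of instructions still ahead.
module _ {k n : ℕ} (v : Fin k → Fin n) where

  data RunFrom (c : Code k n) : Fin (suc (length c)) → Set where
    done  : RunFrom c zero
    check : ∀ {r L ms i} → (r , L , ms) ∈ slots c → (i , v i) ∈ L → RunFrom c (inject₁ r) → RunFrom c (suc r)
    jump  : ∀ {r L ms m} → (r , L , ms) ∈ slots c → m ∈ ms → RunFrom c (inject₁ (down r m)) → RunFrom c (suc r)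

  -- Positions are counted from the end and control only moves towards it, so an instruction put in
  -- front changes neither the old positions nor the runs from them. `restrict` is the converse: the
  -- new instruction sits at the top position, which `inject₁` avoids.
  extend : ∀ {a c q} → RunFrom c q → RunFrom (a ∷ c) (inject₁ q)
  extend done = done
  extend (check r∈ i∈ run) = check (there (∈-map⁺ _ r∈)) i∈ (extend run)
  extend {a} {c} (jump {r} {m = m} r∈ m∈ run) =
    jump (there (∈-map⁺ _ r∈)) m∈ (subst (RunFrom (a ∷ c)) (cong inject₁ (sym (down-inject₁ r m))) (extend run))

  restrict : ∀ {a c p} → RunFrom (a ∷ c) p → ∀ q → p ≡ inject₁ q → RunFrom c q
  restrict done zero eq = done
  restrict (check (here refl) i∈ run) (suc q) eq = ⊥-elim (fromℕ≢inject₁ (suc-injective eq))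
  restrict (check (there r∈) i∈ run) (suc q) eq with ∈-map⁻ _ r∈
  ... | (r , _) , r∈ , refl with inject₁-injective (suc-injective eq)
  ... | refl = check r∈ i∈ (restrict run (inject₁ r) refl)
  restrict (jump (here refl) m∈ run) (suc q) eq = ⊥-elim (fromℕ≢inject₁ (suc-injective eq))
  restrict (jump {m = m} (there r∈) m∈ run) (suc q) eq with ∈-map⁻ _ r∈
  ... | (r , _) , r∈ , refl with inject₁-injective (suc-injective eq)
  ... | refl = jump r∈ m∈ (restrict run _ (cong inject₁ (down-inject₁ r m)))

  runFrom-drop : ∀ c m → Run v (drop m c) ⇔ RunFrom c (down (fromℕ (length c)) m)
  runFrom-drop []      zero    = mk⇔ (λ _ → done) (λ _ → done)
  runFrom-drop []      (suc m) = mk⇔ (λ _ → done) (λ _ → done)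
  runFrom-drop (a ∷ c) (suc m) = mk⇔
    (λ run → extend (to (runFrom-drop c m) run))
    (λ run → from (runFrom-drop c m) (restrict run _ refl))
  runFrom-drop (a ∷ c) zero    = mk⇔ f g
    where
    f : Run v (a ∷ c) → RunFrom (a ∷ c) (suc (fromℕ (length c)))
    f (check i∈ run)        = check (here refl) i∈ (extend (to (runFrom-drop c 0) run))
    f (jump {m = m} m∈ run) = jump (here refl) m∈ (extend (to (runFrom-drop c m) run))
    g : RunFrom (a ∷ c) (suc (fromℕ (length c))) → Run v (a ∷ c)
    g (check (here refl) i∈ run) = check i∈ (from (runFrom-drop c 0) (restrict run _ refl))
    g (check (there r∈) i∈ run) with ∈-map⁻ _ r∈
    ... | _ , _ , eq = ⊥-elim (fromℕ≢inject₁ (cong proj₁ eq))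
    g (jump {m = m} (here refl) m∈ run) = jump m∈ (from (runFrom-drop c m) (restrict run _ refl))
    g (jump (there r∈) m∈ run) with ∈-map⁻ _ r∈
    ... | _ , _ , eq = ⊥-elim (fromℕ≢inject₁ (cong proj₁ eq))

encFin-inject₁ : ∀ {n} (i : Fin n) → encFin (inject₁ i) ≡ encFin i
encFin-inject₁ i = cong encℕ (toℕ-inject₁ i)

encFin-fromℕ : ∀ n → encFin (fromℕ n) ≡ encℕ n
encFin-fromℕ n = cong encℕ (toℕ-fromℕ n)

combineF : Fun → Fun → Fun → Fun
combineF i n x = (i ⊠ n) ⊞ x

combineF-correct : ∀ p q r e {k n} (i : Fin k) (x : Fin n) → ⟦ p ⟧ e ≡ encFin i → ⟦ q ⟧ e ≡ encℕ n → ⟦ r ⟧ e ≡ encFin x →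
  ⟦ combineF p q r ⟧ e ≡ encFin (combine i x)
combineF-correct p q r e {n = n} i x hp hq hr = trans
  (⊞-encℕ (p ⊠ q) r {e} {toℕ i * n} {toℕ x} (⊠-encℕ p q {e} {toℕ i} hp hq) hr)
  (cong encℕ (trans (cong (_+ toℕ x) (*-comm (toℕ i) n)) (sym (toℕ-combine i x))))

monusF : Fun → Fun → Fun
monusF p q = cons p q ⨟ strip ⨟ hd

monusF-correct : ∀ p q e {m n} → ⟦ p ⟧ e ≡ encℕ m → ⟦ q ⟧ e ≡ encℕ n → ⟦ monusF p q ⟧ e ≡ encℕ (m ∸ n)
monusF-correct p q e {m} {n} hp hq = trans (cong₂ (λ x y → head (stripCommon x y)) hp hq) (go m n)
  where
  go : ∀ m n → head (stripCommon (encℕ m) (encℕ n)) ≡ encℕ (m ∸ n)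
  go m       zero    = refl
  go zero    (suc n) = refl
  go (suc m) (suc n) = go m n

encFin-down : ∀ p q e {n} (r : Fin n) m → ⟦ p ⟧ e ≡ encFin r → ⟦ q ⟧ e ≡ encℕ m →
  ⟦ monusF p q ⟧ e ≡ encFin (inject₁ (down r m))
encFin-down p q e r m hp hq = trans (monusF-correct p q e hp hq)
  (cong encℕ (sym (trans (toℕ-inject₁ (down r m)) (toℕ-down r m))))

putF getF : Fun → Fun
putF p = cons (numeral 1) p
getF p = cons (numeral 2) p

edgeF : Fun → Fun → Fun → Fun
edgeF q l q′ = cons q (cons l q′)

edge≡ : ∀ {a a′ b b′ c c′} → a ≡ a′ → b ≡ b′ → c ≡ c′ → a ∙ b ∙ c ≡ a′ ∙ b′ ∙ c′
edge≡ refl refl refl = refl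

↑ˡ≢↑ʳ : ∀ {m n} {i : Fin m} {j : Fin n} {A : Set} → i ↑ˡ n ≡ m ↑ʳ j → A
↑ˡ≢↑ʳ {m} {n} {i} {j} eq = case trans (sym (splitAt-↑ˡ m i n)) (trans (cong (splitAt m) eq) (splitAt-↑ʳ m n j)) of λ ()

module _ {S : System} where
  open System S

  move-all : ∀ {P P′ : C → Set} {t α} {qs qs′ : Vec C t} → (∀ {q} → P q → P′ q) →
    (∀ {q q′} → (q , α , q′) ∈ δC → P q → P′ q′) → Move qs α qs′ → VAll.All P qs → VAll.All P′ qs′
  move-all P⇒P′ step (here h)  (p ∷ ps) = step h p ∷ VAll.map P⇒P′ ps
  move-all P⇒P′ step (there m) (p ∷ ps) = P⇒P′ p ∷ move-all P⇒P′ step m ps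

  move-stay : ∀ {t α} (qs : Vec C t) i → (lookup qs i , α , lookup qs i) ∈ δC → Move qs α qs
  move-stay (q ∷ qs) zero    h = here h
  move-stay (q ∷ qs) (suc i) h = there (move-stay qs i h)

  all-replicate : ∀ {P : C → Set} t {q} → P q → VAll.All P (replicate t q)
  all-replicate zero    p = []
  all-replicate (suc t) p = p ∷ all-replicate t p

-- Reduction to few leader states.

-- The leader writes the contents of the registers, one register after the
-- other, and then waits for ok.  A contributor either repeats one of these
-- messages for ever or walks through the code, reading for each check one of
-- the pairs that make it succeed.
module FewLeaderStates (I : CodeInstance) where

  open CodeInstance I renaming (registers to k; range to n)

  M : ℕ
  M = length code

  data Datum : Set where
    blank ok : Datum
    holds    : Fin k → Fin n → Datum

  data Contributor : Set where
    at   : Fin (suc M) → Contributor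
    echo : Fin k → Fin n → Contributor

  -- State 0 is unsafe, 1 waits for `ok`, and `suc (suc r)` is about to announce register `r`;
  -- announcements go from the last register down to the first.
  Leader : Set
  Leader = Fin (suc (suc k))

  announcements : List (Leader × Action Datum × Leader)
  announcements = concatMap (λ r → concatMap (λ x →
    (suc (suc r) , put (holds r x) , suc (inject₁ r)) ∷ []) (fins n)) (fins k)

  memories : List (Contributor × Action Datum × Contributor)
  memories = concatMap (λ i → concatMap (λ x →
    (at (fromℕ M) , get (holds i x) , echo i x) ∷ (echo i x , put (holds i x) , echo i x) ∷ []) (fins n)) (fins k)

  checksAt jumpsAt : Fin M × Instr k n → List (Contributor × Action Datum × Contributor)
  checksAt (r , L , ms) = concatMap (λ (i , x) → (at (suc r) , get (holds i x) , at (inject₁ r)) ∷ []) L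
  jumpsAt  (r , L , ms) = concatMap (λ m → (at (suc r) , skip , at (inject₁ (down r m))) ∷ []) ms

  walk : List (Contributor × Action Datum × Contributor)
  walk = concatMap (λ s → checksAt s ++ jumpsAt s) (slots code)

  system : System
  system = record
    { start  = suc (fromℕ k)
    ; unsafe = zero
    ; begin  = at (fromℕ M)
    ; blank  = blank
    ; δL     = (suc zero , get ok , zero) ∷ announcements
    ; δC     = (at zero , put ok , at zero) ∷ memories ++ walk
    }

  open System system hiding (blank)

  -- The lists of transitions follow the order of the generating loops; these families are their
  -- form for case analysis.
  data LeaderStep : Leader → Action Datum → Leader → Set where
    accept   : LeaderStep (suc zero) (get ok) zero
    announce : ∀ r x → LeaderStep (suc (suc r)) (put (holds r x)) (suc (inject₁ r))

  data ContributorStep : Contributor → Action Datum → Contributor → Set where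
    accept   : ContributorStep (at zero) (put ok) (at zero)
    remember : ∀ i x → ContributorStep (at (fromℕ M)) (get (holds i x)) (echo i x)
    repeat   : ∀ i x → ContributorStep (echo i x) (put (holds i x)) (echo i x)
    check    : ∀ {r L ms i x} → (r , L , ms) ∈ slots code → (i , x) ∈ L →
               ContributorStep (at (suc r)) (get (holds i x)) (at (inject₁ r))
    jump     : ∀ {r L ms m} → (r , L , ms) ∈ slots code → m ∈ ms →
               ContributorStep (at (suc r)) skip (at (inject₁ (down r m)))

  leader⁻ : ∀ {q α q′} → (q , α , q′) ∈ δL → LeaderStep q α q′
  leader⁻ (here refl) = accept
  leader⁻ (there h) with collect⁻ (fins k) h
  ... | r , _ , h with collect⁻ (fins n) h
  ... | x , _ , here refl = announce r x

  leader⁺ : ∀ {q α q′} → LeaderStep q α q′ → (q , α , q′) ∈ δL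
  leader⁺ accept         = here refl
  leader⁺ (announce r x) = there (collect⁺ (∈-fins r) (collect⁺ (∈-fins x) (here refl)))

  contributor⁻ : ∀ {q α q′} → (q , α , q′) ∈ δC → ContributorStep q α q′
  contributor⁻ (here refl) = accept
  contributor⁻ (there h) with ∈-++⁻ memories h
  contributor⁻ (there _) | inj₁ h with collect⁻ (fins k) h
  ... | i , _ , h with collect⁻ (fins n) h
  ... | x , _ , here refl         = remember i x
  ... | x , _ , there (here refl) = repeat i x
  contributor⁻ (there _) | inj₂ h with collect⁻ (slots code) h
  ... | s@(r , L , ms) , s∈ , h with ∈-++⁻ (checksAt s) h
  ... | inj₁ h with collect⁻ L h
  ... | (i , x) , i∈ , here refl = check s∈ i∈
  contributor⁻ (there _) | inj₂ _ | s@(r , L , ms) , s∈ , _ | inj₂ h with collect⁻ ms h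
  ... | m , m∈ , here refl = jump s∈ m∈

  contributor⁺ : ∀ {q α q′} → ContributorStep q α q′ → (q , α , q′) ∈ δC
  contributor⁺ accept         = here refl
  contributor⁺ (remember i x) = there (∈-++⁺ˡ (collect⁺ (∈-fins i) (collect⁺ (∈-fins x) (here refl))))
  contributor⁺ (repeat i x)   = there (∈-++⁺ˡ (collect⁺ (∈-fins i) (collect⁺ (∈-fins x) (there (here refl)))))
  contributor⁺ (check s∈ i∈)  = there (∈-++⁺ʳ memories (collect⁺ s∈ (∈-++⁺ˡ (collect⁺ i∈ (here refl)))))
  contributor⁺ (jump {r} {L} {ms} s∈ m∈) =
    there (∈-++⁺ʳ memories (collect⁺ s∈ (∈-++⁺ʳ (checksAt (r , L , ms)) (collect⁺ m∈ (here refl)))))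

  module Complete (v : Fin k → Fin n) where

    -- The witness has k + 1 contributors: a walker in front, and in `es` one future echo per
    -- register. Echoes below `r` have not heard their register yet.
    Announced : Fin (suc k) → Vec Contributor k → Set
    Announced r es = ∀ i → (toℕ r ≤ toℕ i → lookup es i ≡ echo i (v i)) × (toℕ i < toℕ r → lookup es i ≡ at (fromℕ M))

    announceAll : ∀ r es a → Announced r es →
      ∃[ es′ ] ∃[ a′ ] Announced zero es′ × (suc r , at (fromℕ M) ∷ es , a) ⟶* (suc zero , at (fromℕ M) ∷ es′ , a′)
    announceAll r es a h = go (toℕ r) r refl es a h
      where
      -- Recursion on the value of `r`, because `inject₁ r` is no structural part of `suc r`.
      go : ∀ N r → toℕ r ≡ N → ∀ es a → Announced r es →
        ∃[ es′ ] ∃[ a′ ] Announced zero es′ × (suc r , at (fromℕ M) ∷ es , a) ⟶* (suc zero , at (fromℕ M) ∷ es′ , a′)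
      go zero    zero    eq es a h = es , a , h , ε
      go (suc N) (suc r) eq es a h with go N (inject₁ r) (trans (toℕ-inject₁ r) (cong pred eq)) (es [ r ]≔ echo r (v r)) (holds r (v r)) h′
        where
        h′ : Announced (inject₁ r) (es [ r ]≔ echo r (v r))
        h′ i rewrite toℕ-inject₁ r with i ≟ r
        ... | yes refl = (λ _ → lookup∘update r es _) , λ i<i → ⊥-elim (1+n≰n i<i)
        ... | no i≢r rewrite lookup∘update′ i≢r es (echo r (v r)) =
          (λ r≤i → case m≤n⇒m<n∨m≡n r≤i of λ { (inj₁ r<i) → proj₁ (h i) r<i ; (inj₂ e) → ⊥-elim (i≢r (sym (toℕ-injective e))) }) ,
          λ i<r → proj₂ (h i) (≤-trans i<r (n≤1+n _))
      ... | es′ , a′ , h″ , run = es′ , a′ , h″ ,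
        leader (leader⁺ (announce r (v r))) put ◅
        contributor (there (move-update es r (subst (λ q → (q , _ , _) ∈ δC) (sym (proj₂ (h r) ≤-refl))
          (contributor⁺ (remember r (v r)))))) get ◅ run

    walkThrough : ∀ {q es a} → Announced zero es → RunFrom v code q →
      ∃[ a′ ] (suc zero , at q ∷ es , a) ⟶* (suc zero , at zero ∷ es , a′)
    walkThrough h done = _ , ε
    walkThrough {es = es} h (check {r} {i = i} r∈ i∈ run) with walkThrough {a = holds i (v i)} h run
    ... | a′ , sts = a′ ,
      -- Whatever the memory holds, the echo of register `i` first restores the pair that the walker
      -- is to read.
      contributor (there (move-stay es i (subst (λ q → (q , put (holds i (v i)) , q) ∈ δC) (sym (proj₁ (h i) z≤n)) (contributor⁺ (repeat i (v i)))))) put ◅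
      contributor (here (contributor⁺ (check r∈ i∈))) get ◅ sts
    walkThrough h (jump r∈ m∈ run) with walkThrough h run
    ... | a′ , sts = a′ , contributor (here (contributor⁺ (jump r∈ m∈))) skip ◅ sts

    complete : RunFrom v code (fromℕ M) → Fails
    complete run with announceAll (fromℕ k) (replicate k (at (fromℕ M))) blank
      (λ i → (λ k≤i → ⊥-elim (1+n≰n (≤-trans (toℕ<n i) (≤-trans (≤-reflexive (sym (toℕ-fromℕ k))) k≤i)))) , λ _ → lookup-replicate i _)
    ... | es , a , h , sts with walkThrough {a = a} h run
    ... | a′ , sts′ = suc k , at zero ∷ es , ok ,
      (sts ◅◅ sts′ ◅◅ contributor (here (contributor⁺ accept)) put ◅ leader (leader⁺ accept) get ◅ ε)

  -- The invariant refers to the list w of the pairs announced so far.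
  module Sound where

    Agrees : List (Fin k × Fin n) → (Fin k → Fin n) → Set
    Agrees w v = ∀ {i x} → (i , x) ∈ w → v i ≡ x

    Claim : List (Fin k × Fin n) → Set
    Claim w = ∀ v → Agrees w v → RunFrom v code (fromℕ M)

    -- A walker's past is recorded as an implication: any run from its position extends to a run
    -- from the start. Quantifying over all `v` that agree with `w` makes this meaningful before
    -- every register is announced, and stable when `w` grows.
    ContributorOk : List (Fin k × Fin n) → Contributor → Set
    ContributorOk w (at q)     = ∀ v → Agrees w v → RunFrom v code q → RunFrom v code (fromℕ M)
    ContributorOk w (echo i x) = (i , x) ∈ w

    DatumOk : List (Fin k × Fin n) → Datum → Set
    DatumOk w blank       = ⊤
    DatumOk w ok          = Claim w
    DatumOk w (holds i x) = (i , x) ∈ w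

    LeaderOk : List (Fin k × Fin n) → Leader → Set
    LeaderOk w zero    = Claim w
    LeaderOk w (suc q) = ⊤

    -- By `announced` and `total` the registers in `w` are exactly those `i` for which the leader's
    -- state is at most i + 1. As register `r` is announced from state r + 2, it is not in `w`
    -- before, so `w` stays functional.
    record Invariant {t} (s : Leader × Vec Contributor t × Datum) : Set where
      field
        w            : List (Fin k × Fin n)
        functional   : ∀ {i x y} → (i , x) ∈ w → (i , y) ∈ w → x ≡ y
        announced    : ∀ {i x} → (i , x) ∈ w → toℕ (proj₁ s) ≤ suc (toℕ i)
        total        : ∀ i → toℕ (proj₁ s) ≤ suc (toℕ i) → ∃[ x ] (i , x) ∈ w
        leaderOk     : LeaderOk w (proj₁ s)
        contributors : VAll.All (ContributorOk w) (proj₁ (proj₂ s))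
        datumOk      : DatumOk w (proj₂ (proj₂ s))

    contributor-weaken : ∀ {w p q} → ContributorOk w q → ContributorOk (p ∷ w) q
    contributor-weaken {q = at _}     h v agrees = h v (agrees ∘ there)
    contributor-weaken {q = echo _ _} h = there h

    step : ∀ {t} {s s′ : Leader × Vec Contributor t × Datum} → Invariant s → s ⟶ s′ → Invariant s′
    step inv (leader h eff) with leader⁻ h
    step inv (leader h get) | accept = record
      { w = w ; functional = functional
      ; announced = λ _ → z≤n
      ; total = λ i _ → total i (s≤s z≤n)
      ; leaderOk = datumOk ; contributors = contributors ; datumOk = datumOk }
      where open Invariant inv
    step inv (leader h put) | announce r x = record
      { w = (r , x) ∷ w ; functional = functional′ ; announced = announced′ ; total = total′
      ; leaderOk = tt ; contributors = VAll.map (λ {q} → contributor-weaken {q = q}) contributors ; datumOk = here refl }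
      where
      open Invariant inv
      functional′ : ∀ {i x₁ y} → (i , x₁) ∈ (r , x) ∷ w → (i , y) ∈ (r , x) ∷ w → x₁ ≡ y
      functional′ (here refl) (here refl) = refl
      functional′ (here refl) (there b)   = ⊥-elim (1+n≰n (announced b))
      functional′ (there a)   (here refl) = ⊥-elim (1+n≰n (announced a))
      functional′ (there a)   (there b)   = functional a b
      announced′ : ∀ {i y} → (i , y) ∈ (r , x) ∷ w → toℕ (suc (inject₁ r)) ≤ suc (toℕ i)
      announced′ (here refl) = ≤-reflexive (cong suc (toℕ-inject₁ r))
      announced′ (there a)   = ≤-trans (≤-reflexive (cong suc (toℕ-inject₁ r))) (≤-trans (n≤1+n _) (announced a))
      total′ : ∀ i → toℕ (suc (inject₁ r)) ≤ suc (toℕ i) → ∃[ y ] (i , y) ∈ (r , x) ∷ w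
      total′ i (s≤s h) with m≤n⇒m<n∨m≡n (≤-trans (≤-reflexive (sym (toℕ-inject₁ r))) h)
      ... | inj₁ r<i = let (y , y∈) = total i (s≤s r<i) in y , there y∈
      ... | inj₂ e with toℕ-injective e
      ... | refl = x , here refl
    step {s′ = q , qs′ , a′} inv (contributor {qs = qs} {α = α} {a = a} m eff) = record
      { w = w ; functional = functional ; announced = announced ; total = total ; leaderOk = leaderOk
      ; contributors = move-all {system} (λ p → p) (λ h p → proj₁ (go eff (contributor⁻ h) p datumOk)) m contributors
      ; datumOk = datum m contributors }
      where
      open Invariant inv
      go : ∀ {α a a′ q q′} → Effect α a a′ → ContributorStep q α q′ → ContributorOk w q → DatumOk w a → ContributorOk w q′ × DatumOk w a′
      -- At position zero the recorded implication applies to the empty run, which gives the claim.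
      go put  accept         p d = p , λ v agrees → p v agrees done
      go get  (remember i x) p d = d , d
      go put  (repeat i x)   p d = p , p
      go get  (check r∈ i∈)  p d = (λ v agrees run → p v agrees (check r∈ (subst (λ y → (_ , y) ∈ _) (sym (agrees d)) i∈) run)) , d
      go skip (jump r∈ m∈)   p d = (λ v agrees run → p v agrees (jump r∈ m∈ run)) , d
      datum : ∀ {t} {qs qs′ : Vec Contributor t} → Move qs α qs′ → VAll.All (ContributorOk w) qs → DatumOk w a′
      datum (here h)  (p ∷ _)  = proj₂ (go eff (contributor⁻ h) p datumOk)
      datum (there m) (_ ∷ ps) = datum m ps

    invariant-initial : ∀ t → Invariant (initial t)
    invariant-initial t = record
      { w = [] ; functional = λ () ; announced = λ ()
      ; total = λ i h → ⊥-elim (1+n≰n (≤-trans (toℕ<n i) (≤-trans (≤-reflexive (sym (toℕ-fromℕ k))) (s≤s⁻¹ h))))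
      ; leaderOk = tt ; contributors = all-replicate {system} t (λ v _ run → run) ; datumOk = tt }

    steps : ∀ {t} {s s′ : Leader × Vec Contributor t × Datum} → Invariant s → s ⟶* s′ → Invariant s′
    steps inv ε          = inv
    steps inv (st ◅ sts) = steps (step inv st) sts

    sound : Fails → Σ[ v ∈ (Fin k → Fin n) ] RunFrom v code (fromℕ M)
    sound (t , qs , a , sts) = v , leaderOk v (λ {i} i∈ → functional (proj₂ (total i z≤n)) i∈)
      where
      open Invariant (steps (invariant-initial t) sts)
      v : Fin k → Fin n
      v i = proj₁ (total i z≤n)

-- Generating the instances with few leader states.

sucF : Fun → Fun
sucF p = cons nil p

encFin-↑ˡ : ∀ {m} (i : Fin m) n → encFin (i ↑ˡ n) ≡ encFin i
encFin-↑ˡ i n = cong encℕ (toℕ-↑ˡ i n)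

encFin-↑ʳ : ∀ p q e m {n} (i : Fin n) → ⟦ p ⟧ e ≡ encℕ m → ⟦ q ⟧ e ≡ encFin i → ⟦ p ⊞ q ⟧ e ≡ encFin (m ↑ʳ i)
encFin-↑ʳ p q e m i hp hq = trans (⊞-encℕ p q {e} {m} {toℕ i} hp hq) (cong encℕ (sym (toℕ-↑ʳ m i)))

-- The environment of the generators below lists n, k, the length of the code
-- and the code.
setupF : Fun
setupF = cons (hd ⨟ hd) (cons tl (cons (lengthOf (hd ⨟ tl)) (hd ⨟ tl)))

environment : CodeInstance → Tree
environment I = encℕ range ∙ encℕ registers ∙ encℕ (length code) ∙ encList encInstr code
  where open CodeInstance I

setupF-correct : ∀ I → ⟦ setupF ⟧ (Problem.input RegisterCode I) ≡ environment I
setupF-correct I = cong (λ z → encℕ range ∙ encℕ registers ∙ z ∙ encList encInstr code)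
  (lengthOf-encList (hd ⨟ tl) {x = Problem.input RegisterCode I} code refl)
  where open CodeInstance I

module FewLeaderStatesF where

  holdsF : Fun → Fun → Fun → Fun
  holdsF i n x = sucF (sucF (combineF i n x))

  announcementsF memoriesF walkF : Fun
  -- The outer `v₁` is `k`; the second one, behind a loop variable, is `n`.
  announcementsF = for v₁ collect (for v₁ collect
    cons (edgeF (sucF (sucF (v₁ ⨟ tl))) (putF (holdsF (v₁ ⨟ tl) v₂ (v₀ ⨟ tl))) (sucF (v₁ ⨟ tl))) nil)
  memoriesF = for v₁ collect (for v₁ collect
    cons (edgeF v₄ (getF h) s) (cons (edgeF s (putF h) s) nil))
    where
    h = holdsF (v₁ ⨟ tl) v₂ (v₀ ⨟ tl)
    s = sucF v₄ ⊞ combineF (v₁ ⨟ tl) v₂ (v₀ ⨟ tl)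
  walkF = for tl ⨟ tl ⨟ tl collect (
    (for v₀ ⨟ hd ⨟ hd collect cons (edgeF (sucF r) (getF (holdsF (v₀ ⨟ hd ⨟ hd) v₂ (v₀ ⨟ hd ⨟ tl))) r) nil)
    ⊞ (for v₀ ⨟ hd ⨟ tl collect cons (edgeF (sucF r) nil (monusF r (v₀ ⨟ hd))) nil))
    where r = lengthOf (v₁ ⨟ tl)

  lcrF : Fun
  lcrF =
    cons (sucF (sucF (v₁ ⊠ v₀))) (cons nil (cons
      (cons (sucF (sucF v₁)) (cons (sucF v₁) (cons (edgeF (numeral 1) (getF (numeral 1)) nil) announcementsF)))
      (cons (cons (sucF v₂ ⊞ (v₁ ⊠ v₀)) (cons v₂ (cons (edgeF nil (putF (numeral 1)) nil) (memoriesF ⊞ walkF))))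
        -- The unsafe set: `numeral 1` encodes `inside`, and the number k + 1 doubles as the list of
        -- k + 1 times `outside`.
        (cons (numeral 1) (sucF v₁)))))

  reductionF : Fun
  reductionF = setupF ⨟ cons lcrF (sucF (sucF v₁))

module FewLeaderStatesCoding (I : CodeInstance) where

  open CodeInstance I renaming (registers to k; range to n)
  open FewLeaderStates I
  open FewLeaderStatesF

  codeD : Datum → Fin (2 + k * n)
  codeD blank       = zero
  codeD ok          = suc zero
  codeD (holds i x) = suc (suc (combine i x))

  codeC : Contributor → Fin (suc M + k * n)
  codeC (at q)     = q ↑ˡ (k * n)
  codeC (echo i x) = suc M ↑ʳ combine i x

  codeD-inj : Injective _≡_ _≡_ codeD
  codeD-inj {blank}     {blank}     e = refl
  codeD-inj {ok}        {ok}        e = refl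
  codeD-inj {holds i x} {holds j y} e with combine-injective i x j y (suc-injective (suc-injective e))
  ... | refl , refl = refl

  codeC-inj : Injective _≡_ _≡_ codeC
  codeC-inj {at q}     {at p}     e = cong at (↑ˡ-injective _ _ _ e)
  codeC-inj {at q}     {echo i x} e = ↑ˡ≢↑ʳ {i = q} e
  codeC-inj {echo i x} {at q}     e = ↑ˡ≢↑ʳ {i = q} (sym e)
  codeC-inj {echo i x} {echo j y} e with combine-injective i x j y (↑ʳ-injective (suc M) _ _ e)
  ... | refl , refl = refl

  coding : Coding system
  coding = record
    { codeL = λ q → q ; codeC = codeC ; codeD = codeD
    ; codeL-inj = λ e → e ; codeC-inj = codeC-inj ; codeD-inj = codeD-inj
    ; unsafe-zero = refl
    }

  open Coding coding using (encTransition; encLCR-lcr; lcr; fails-⇔)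

  env : Tree
  env = environment I

  code-at : ∀ q → encFin (codeC (at q)) ≡ encFin q
  code-at q = encFin-↑ˡ q (k * n)

  announcementsF-correct : ⟦ announcementsF ⟧ env ≡ encList (encTransition (λ q → q)) announcements
  announcementsF-correct = forEach-fins _ k _ λ r → forEach-fins _ n _ λ x → cong (_∙ nil)
    (edge≡ refl
      (cong (λ z → encℕ 1 ∙ (nil ∙ nil ∙ z)) (combineF-correct (v₁ ⨟ tl) v₂ (v₀ ⨟ tl) ((nil ∙ encFin x) ∙ (nil ∙ encFin r) ∙ env) r x refl refl refl))
      (cong (nil ∙_) (sym (encFin-inject₁ r))))

  memoriesF-correct : ⟦ memoriesF ⟧ env ≡ encList (encTransition codeC) memories
  memoriesF-correct = forEach-fins _ k _ λ i → forEach-fins _ n _ λ x →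
    let e = (nil ∙ encFin x) ∙ (nil ∙ encFin i) ∙ env
        h = combineF-correct (v₁ ⨟ tl) v₂ (v₀ ⨟ tl) e i x refl refl refl
        s = encFin-↑ʳ (sucF v₄) (combineF (v₁ ⨟ tl) v₂ (v₀ ⨟ tl)) e (suc M) (combine i x) refl h
    in cong₂ (λ a b → a ∙ b ∙ nil)
      (edge≡ (sym (trans (code-at (fromℕ M)) (encFin-fromℕ M))) (cong (λ z → encℕ 2 ∙ (nil ∙ nil ∙ z)) h) s)
      (edge≡ s (cong (λ z → encℕ 1 ∙ (nil ∙ nil ∙ z)) h) s)

  walkF-correct : ⟦ walkF ⟧ env ≡ encList (encTransition codeC) walk
  walkF-correct = forEach-slots _ code _ λ { r (L , ms) rest eq →
    let e = (encInstr (L , ms) ∙ encList encInstr rest) ∙ env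
        r≡ : ∀ y → ⟦ lengthOf (v₁ ⨟ tl) ⟧ (y ∙ e) ≡ encFin r
        r≡ y = trans (lengthOf-encList (v₁ ⨟ tl) {x = y ∙ e} rest refl) (cong encℕ (sym eq))
        at≡ : ∀ {t} q → t ≡ encFin q → t ≡ encFin (codeC (at q))
        at≡ q h = trans h (sym (code-at q))
    in ⊞-encList (for v₀ ⨟ hd ⨟ hd collect cons (edgeF (sucF (lengthOf (v₁ ⨟ tl))) (getF (holdsF (v₀ ⨟ hd ⨟ hd) v₂ (v₀ ⨟ hd ⨟ tl))) (lengthOf (v₁ ⨟ tl))) nil)
        (for v₀ ⨟ hd ⨟ tl collect cons (edgeF (sucF (lengthOf (v₁ ⨟ tl))) nil (monusF (lengthOf (v₁ ⨟ tl)) (v₀ ⨟ hd))) nil) {e}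
      (forEach-encList _ _ L λ { (i , x) ys → cong (_∙ nil)
        (edge≡ (at≡ (suc r) (cong (nil ∙_) (r≡ ((encPair (i , x)) ∙ ys))))
          (cong (λ z → encℕ 2 ∙ (nil ∙ nil ∙ z)) (combineF-correct (v₀ ⨟ hd ⨟ hd) v₂ (v₀ ⨟ hd ⨟ tl) ((encPair (i , x) ∙ ys) ∙ e) i x refl refl refl))
          (at≡ (inject₁ r) (trans (r≡ (encPair (i , x) ∙ ys)) (sym (encFin-inject₁ r))))) })
      (forEach-encList _ _ ms λ m ys → cong (_∙ nil)
        (edge≡ (at≡ (suc r) (cong (nil ∙_) (r≡ (encℕ m ∙ ys)))) refl
          (at≡ (inject₁ (down r m)) (encFin-down (lengthOf (v₁ ⨟ tl)) (v₀ ⨟ hd) ((encℕ m ∙ ys) ∙ e) r m (r≡ (encℕ m ∙ ys)) refl)))) }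

  lcrF-correct : ⟦ lcrF ⟧ env ≡ encLCR lcr
  lcrF-correct = trans
    (cong₂ _∙_ (cong (λ z → nil ∙ nil ∙ z) kn) (cong (nil ∙_) (cong₂ _∙_
      (edge≡ refl (cong (nil ∙_) (sym (encFin-fromℕ k))) (cong ((encℕ 1 ∙ encLabel (just (read (codeD ok))) ∙ nil) ∙_) announcementsF-correct))
      (cong (_∙ (encBool inside ∙ encℕ (suc k)))
        (edge≡ (⊞-encℕ (sucF v₂) (v₁ ⊠ v₀) {env} {suc M} {k * n} refl kn)
          (sym (trans (code-at (fromℕ M)) (encFin-fromℕ M)))
          (cong₂ _∙_ (edge≡ (sym (code-at zero)) refl (sym (code-at zero)))
            (⊞-encList memoriesF walkF {env} memoriesF-correct walkF-correct)))))))
    (sym encLCR-lcr)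
    where
    kn : ⟦ v₁ ⊠ v₀ ⟧ env ≡ encℕ (k * n)
    kn = ⊠-encℕ v₁ v₀ {env} {k} {n} refl refl

  yes-⇔ : Problem.Yes RegisterCode I ⇔ LCRInstance.UnsafeReachable lcr
  yes-⇔ = fails-⇔ ⇔-∘ mk⇔
    (λ (v , run) → Complete.complete v (to (runFrom-drop v code 0) run))
    (λ bad → let (v , run) = Sound.sound bad in v , from (runFrom-drop v code 0) run)

RegisterCode≤LCR[L] : RegisterCode ≤fpt LCR[L]
RegisterCode≤LCR[L] = polytime-reduction FewLeaderStatesF.reductionF (con 2 ⊕ var)
  (λ I → Coding.lcr (FewLeaderStatesCoding.coding I))
  (λ I → trans (cong ⟦ cons FewLeaderStatesF.lcrF (sucF (sucF v₁)) ⟧ (setupF-correct I))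
    (cong (_∙ encℕ (2 + CodeInstance.registers I)) (FewLeaderStatesCoding.lcrF-correct I)))
  (λ I → refl)
  FewLeaderStatesCoding.yes-⇔

-- Reduction to a small domain.

slot-at : ∀ {A : Set} (c : List A) r → ∃[ a ] (r , a) ∈ slots c
slot-at (a ∷ c) r with view r
... | ‵fromℕ     = a , here refl
... | ‵inject₁ j = let (b , b∈) = slot-at c j in b , there (∈-map⁺ _ b∈)

module _ {S : System} where
  open System S

  -- Actions that leave the memory unchanged can be performed by all contributors in turn, so one
  -- message reaches everybody.
  sweep : ∀ {t α} (qs : Vec C t) (g : Fin t → C) → (∀ i → (lookup qs i , α , g i) ∈ δC) →
    Star (λ qs qs′ → Move qs α qs′) qs (tabulate g)
  sweep []       g h = ε
  sweep (q ∷ qs) g h = here (h zero) ◅ gmap (g zero ∷_) there (sweep qs (g ∘ suc) (h ∘ suc))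

  sweep-⟶* : ∀ {t α q a} (qs : Vec C t) (g : Fin t → C) → Effect α a a → (∀ i → (lookup qs i , α , g i) ∈ δC) →
    (q , qs , a) ⟶* (q , tabulate g , a)
  sweep-⟶* {q = q} {a} qs g eff h = gmap (λ qs → q , qs , a) (λ m → contributor m eff) (sweep qs g h)

-- The leader runs through all positions of the code, executing only the
-- instruction at its current target τ.  At each position it writes tick and
-- then either pass or claim i, the latter asserting that register i makes the
-- check succeed.  A contributor that has guessed that register i contains x
-- refuses claim i where (i , x) is not listed.  Since ticks alternate with
-- the other messages, only a contributor that has read every message can
-- reach position 0.
module SmallDomain (I : CodeInstance) where

  open CodeInstance I renaming (registers to k; range to n)

  M : ℕ
  M = length code

  data Datum : Set where
    blank tick pass : Datum
    claim ok        : Fin k → Datum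

  -- In `ready r τ` and `ticked r τ` the first index is the place in the count of messages and `τ`
  -- the position of the next instruction to execute. `finish j` still awaits `ok` for the registers
  -- below `j`.
  data Leader : Set where
    finish : Fin (suc k) → Leader
    ready  : Fin (suc M) → Fin (suc M) → Leader
    ticked : Fin M → Fin (suc M) → Leader

  data Contributor : Set where
    fresh  : Contributor
    ready  : Fin k → Fin n → Fin (suc M) → Contributor
    ticked : Fin k → Fin n → Fin M → Contributor

  LeaderEdge ContributorEdge : Set
  LeaderEdge      = Leader × Action Datum × Leader
  ContributorEdge = Contributor × Action Datum × Contributor

  collectEdges : List LeaderEdge
  collectEdges = concatMap (λ i → (finish (suc i) , get (ok i) , finish (inject₁ i)) ∷ []) (fins k)

  -- The second edge exists also for `τ` equal to `suc r`. A leader that takes it there leaves its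
  -- target behind for good and cannot reach `ready zero zero`.
  passEdgesAt : Fin M → Fin (suc M) → List LeaderEdge
  passEdgesAt r τ = (ready (suc r) τ , put tick , ticked r τ) ∷ (ticked r τ , put pass , ready (inject₁ r) τ) ∷ []

  passEdges claimEdges jumpEdges : Fin M × Instr k n → List LeaderEdge
  passEdges (r , _) = concatMap (passEdgesAt r) (fins (suc M))
  claimEdges (r , _) = concatMap (λ i → (ticked r (suc r) , put (claim i) , ready (inject₁ r) (inject₁ r)) ∷ []) (fins k)
  jumpEdges (r , L , ms) = concatMap (λ m → (ticked r (suc r) , put pass , ready (inject₁ r) (inject₁ (down r m))) ∷ []) ms

  slotEdges : List LeaderEdge
  slotEdges = concatMap (λ s → passEdges s ++ claimEdges s ++ jumpEdges s) (slots code)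

  otherEdges : Fin k → Fin n → Fin M → List ContributorEdge
  otherEdges i x r = concatMap (λ j → unless (does (i ≟ j)) ((ticked i x r , get (claim j) , ready i x (inject₁ r)) ∷ [])) (fins k)

  followEdges : Fin k → Fin n → List ContributorEdge
  followEdges i x = concatMap (λ r → (ready i x (suc r) , get tick , ticked i x r) ∷
    (ticked i x r , get pass , ready i x (inject₁ r)) ∷ otherEdges i x r) (fins M)

  guessEdges checkEdges : List ContributorEdge
  guessEdges = concatMap (λ i → concatMap (λ x → (fresh , skip , ready i x (fromℕ M)) ∷
    (ready i x zero , put (ok i) , ready i x zero) ∷ followEdges i x) (fins n)) (fins k)
  checkEdges = concatMap (λ (r , L , _) → concatMap (λ (i , x) →
    (ticked i x r , get (claim i) , ready i x (inject₁ r)) ∷ []) L) (slots code)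

  system : System
  system = record
    { start  = ready (fromℕ M) (fromℕ M)
    ; unsafe = finish zero
    ; begin  = fresh
    ; blank  = blank
    ; δL     = (ready zero zero , skip , finish (fromℕ k)) ∷ collectEdges ++ slotEdges
    ; δC     = guessEdges ++ checkEdges
    }

  open System system hiding (blank)

  data LeaderStep : Leader → Action Datum → Leader → Set where
    finish  : LeaderStep (ready zero zero) skip (finish (fromℕ k))
    collect : ∀ i → LeaderStep (finish (suc i)) (get (ok i)) (finish (inject₁ i))
    tick    : ∀ r τ → LeaderStep (ready (suc r) τ) (put tick) (ticked r τ)
    pass    : ∀ r τ → LeaderStep (ticked r τ) (put pass) (ready (inject₁ r) τ)
    claim   : ∀ r i → LeaderStep (ticked r (suc r)) (put (claim i)) (ready (inject₁ r) (inject₁ r))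
    jump    : ∀ {r L ms m} → (r , L , ms) ∈ slots code → m ∈ ms →
              LeaderStep (ticked r (suc r)) (put pass) (ready (inject₁ r) (inject₁ (down r m)))

  data ContributorStep : Contributor → Action Datum → Contributor → Set where
    guess  : ∀ i x → ContributorStep fresh skip (ready i x (fromℕ M))
    accept : ∀ i x → ContributorStep (ready i x zero) (put (ok i)) (ready i x zero)
    tick   : ∀ i x r → ContributorStep (ready i x (suc r)) (get tick) (ticked i x r)
    pass   : ∀ i x r → ContributorStep (ticked i x r) (get pass) (ready i x (inject₁ r))
    other  : ∀ i x r j → i ≢ j → ContributorStep (ticked i x r) (get (claim j)) (ready i x (inject₁ r))
    own    : ∀ {r L ms i x} → (r , L , ms) ∈ slots code → (i , x) ∈ L →
             ContributorStep (ticked i x r) (get (claim i)) (ready i x (inject₁ r))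

  leader⁻ : ∀ {q α q′} → (q , α , q′) ∈ δL → LeaderStep q α q′
  leader⁻ (here refl) = finish
  leader⁻ (there h) with ∈-++⁻ collectEdges h
  leader⁻ (there _) | inj₁ h with collect⁻ (fins k) h
  ... | i , _ , here refl = collect i
  leader⁻ (there _) | inj₂ h with collect⁻ (slots code) h
  ... | s@(r , L , ms) , s∈ , h with ∈-++⁻ (passEdges s) h
  ... | inj₁ h with collect⁻ {F = passEdgesAt r} (fins (suc M)) h
  ... | τ , _ , here refl         = tick r τ
  ... | τ , _ , there (here refl) = pass r τ
  leader⁻ (there _) | inj₂ _ | s@(r , L , ms) , s∈ , _ | inj₂ h with ∈-++⁻ (claimEdges s) h
  ... | inj₁ h with collect⁻ (fins k) h
  ... | i , _ , here refl = claim r i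
  leader⁻ (there _) | inj₂ _ | s@(r , L , ms) , s∈ , _ | inj₂ _ | inj₂ h with collect⁻ ms h
  ... | m , m∈ , here refl = jump s∈ m∈

  leader⁺ : ∀ {q α q′} → LeaderStep q α q′ → (q , α , q′) ∈ δL
  leader⁺ finish      = here refl
  leader⁺ (collect i) = there (∈-++⁺ˡ (collect⁺ (∈-fins i) (here refl)))
  leader⁺ (tick r τ)  = there (∈-++⁺ʳ collectEdges (collect⁺ (proj₂ (slot-at code r)) (∈-++⁺ˡ (collect⁺ {F = passEdgesAt r} (∈-fins τ) (here refl)))))
  leader⁺ (pass r τ)  = there (∈-++⁺ʳ collectEdges (collect⁺ (proj₂ (slot-at code r)) (∈-++⁺ˡ (collect⁺ {F = passEdgesAt r} (∈-fins τ) (there (here refl))))))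
  leader⁺ (claim r i) = there (∈-++⁺ʳ collectEdges (collect⁺ (proj₂ (slot-at code r))
    (∈-++⁺ʳ (passEdges (r , proj₁ (slot-at code r))) (∈-++⁺ˡ (collect⁺ (∈-fins i) (here refl))))))
  leader⁺ (jump {r} {L} {ms} s∈ m∈) = there (∈-++⁺ʳ collectEdges (collect⁺ s∈
    (∈-++⁺ʳ (passEdges (r , L , ms)) (∈-++⁺ʳ (claimEdges (r , L , ms)) (collect⁺ m∈ (here refl))))))

  contributor⁻ : ∀ {q α q′} → (q , α , q′) ∈ δC → ContributorStep q α q′
  contributor⁻ h with ∈-++⁻ guessEdges h
  contributor⁻ _ | inj₁ h with collect⁻ (fins k) h
  ... | i , _ , h with collect⁻ (fins n) h
  ... | x , _ , here refl         = guess i x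
  ... | x , _ , there (here refl) = accept i x
  ... | x , _ , there (there h) with collect⁻ (fins M) h
  ... | r , _ , here refl         = tick i x r
  ... | r , _ , there (here refl) = pass i x r
  ... | r , _ , there (there h) with collect⁻ (fins k) h
  ... | j , _ , h with ∈-unless⁻ i j h
  ... | i≢j , here refl = other i x r j i≢j
  contributor⁻ _ | inj₂ h with collect⁻ (slots code) h
  ... | (r , L , ms) , s∈ , h with collect⁻ L h
  ... | (i , x) , i∈ , here refl = own s∈ i∈

  contributor⁺ : ∀ {q α q′} → ContributorStep q α q′ → (q , α , q′) ∈ δC
  contributor⁺ (guess i x)  = ∈-++⁺ˡ (collect⁺ (∈-fins i) (collect⁺ (∈-fins x) (here refl)))
  contributor⁺ (accept i x) = ∈-++⁺ˡ (collect⁺ (∈-fins i) (collect⁺ (∈-fins x) (there (here refl))))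
  contributor⁺ (tick i x r) = ∈-++⁺ˡ (collect⁺ (∈-fins i) (collect⁺ (∈-fins x) (there (there (collect⁺ (∈-fins r) (here refl))))))
  contributor⁺ (pass i x r) = ∈-++⁺ˡ (collect⁺ (∈-fins i) (collect⁺ (∈-fins x) (there (there (collect⁺ (∈-fins r) (there (here refl)))))))
  contributor⁺ (other i x r j i≢j) = ∈-++⁺ˡ (collect⁺ (∈-fins i) (collect⁺ (∈-fins x) (there (there (collect⁺ (∈-fins r)
    (there (there (collect⁺ (∈-fins j) (∈-unless⁺ i j i≢j (here refl))))))))))
  contributor⁺ (own s∈ i∈) = ∈-++⁺ʳ guessEdges (collect⁺ s∈ (collect⁺ i∈ (here refl)))

  module Complete (v : Fin k → Fin n) where

    allReady : Fin (suc M) → Vec Contributor k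
    allReady r = tabulate (λ i → ready i (v i) r)

    -- Between slots all contributors are level with the leader. The datum can be arbitrary because
    -- every segment of the run writes before it reads.
    Reach : Leader × Fin (suc M) → Leader × Fin (suc M) → Set
    Reach (q , r) (q′ , r′) = ∀ a → ∃[ a′ ] (q , allReady r , a) ⟶* (q′ , allReady r′ , a′)

    _∘⟶_ : ∀ {x y z} → Reach x y → Reach y z → Reach x z
    (f ∘⟶ g) a = let (a′ , s) = f a ; (a″ , s′) = g a′ in a″ , s ◅◅ s′

    advance : ∀ {α q a} (f g : Fin k → Contributor) → Effect α a a → (∀ i → ContributorStep (f i) α (g i)) →
      (q , tabulate f , a) ⟶* (q , tabulate g , a)
    advance {α} f g eff h = sweep-⟶* {system} (tabulate f) g eff
      (λ i → subst (λ q → (q , α , g i) ∈ δC) (sym (lookup∘tabulate f i)) (contributor⁺ (h i)))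

    slot : ∀ {r τ τ′ b} → LeaderStep (ticked r τ) (put b) (ready (inject₁ r) τ′) →
      (∀ i → ContributorStep (ticked i (v i) r) (get b) (ready i (v i) (inject₁ r))) →
      Reach (ready (suc r) τ , suc r) (ready (inject₁ r) τ′ , inject₁ r)
    slot {r} {τ} {b = b} st accepts a = b ,
      (leader (leader⁺ (tick r τ)) put ◅
       (advance (λ i → ready i (v i) (suc r)) (λ i → ticked i (v i) r) get (λ i → tick i (v i) r) ◅◅
        leader (leader⁺ st) put ◅
        advance (λ i → ticked i (v i) r) (λ i → ready i (v i) (inject₁ r)) get accepts))

    passTo : ∀ r τ → toℕ τ ≤ toℕ r → Reach (ready r τ , r) (ready τ τ , τ)
    passTo r τ τ≤r = go (toℕ r) r refl τ≤r
      where
      go : ∀ N r → toℕ r ≡ N → toℕ τ ≤ toℕ r → Reach (ready r τ , r) (ready τ τ , τ)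
      go N r eq τ≤r with m≤n⇒m<n∨m≡n τ≤r
      ... | inj₂ e with toℕ-injective e
      ... | refl = λ a → a , ε
      go (suc N) (suc r) eq τ≤r | inj₁ (s≤s τ≤r′) =
        slot (pass r τ) (λ i → pass i (v i) r) ∘⟶
        go N (inject₁ r) (trans (toℕ-inject₁ r) (cong pred eq)) (≤-trans τ≤r′ (≤-reflexive (sym (toℕ-inject₁ r))))

    execute : ∀ {q} → RunFrom v code q → Reach (ready q q , q) (ready zero zero , zero)
    execute done = λ a → a , ε
    execute (check {r} {L} {ms} {i} r∈ i∈ run) = slot (claim r i) accepts ∘⟶ execute run
      where
      accepts : ∀ j → ContributorStep (ticked j (v j) r) (get (claim i)) (ready j (v j) (inject₁ r))
      accepts j with j ≟ i
      ... | yes refl = own r∈ i∈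
      ... | no j≢i   = other j (v j) r i j≢i
    execute (jump {r} {m = m} r∈ m∈ run) =
      slot (jump r∈ m∈) (λ i → pass i (v i) r) ∘⟶ (passTo _ _ down≤ ∘⟶ execute run)
      where
      down≤ : toℕ (inject₁ (down r m)) ≤ toℕ (inject₁ r)
      down≤ rewrite toℕ-inject₁ (down r m) | toℕ-inject₁ r | toℕ-down r m = m∸n≤m (toℕ r) m

    collectAll : ∀ j → Reach (finish j , zero) (finish zero , zero)
    collectAll j = go (toℕ j) j refl
      where
      go : ∀ N j → toℕ j ≡ N → Reach (finish j , zero) (finish zero , zero)
      go zero    zero    eq a = a , ε
      go (suc N) (suc i) eq a with go N (inject₁ i) (trans (toℕ-inject₁ i) (cong pred eq)) (ok i)
      ... | a′ , sts = a′ ,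
        (contributor (move-stay (allReady zero) i (subst (λ q → (q , put (ok i) , q) ∈ δC) (sym (lookup∘tabulate _ i)) (contributor⁺ (accept i (v i))))) put ◅
         leader (leader⁺ (collect i)) get ◅ sts)

    complete : RunFrom v code (fromℕ M) → Fails
    complete run with execute run blank
    ... | a , sts with collectAll (fromℕ k) a
    ... | a′ , sts′ = k , allReady zero , a′ ,
      (sweep-⟶* {system} (replicate k fresh) (λ i → ready i (v i) (fromℕ M)) skip
         (λ i → subst (λ q → (q , skip , ready i (v i) (fromℕ M)) ∈ δC) (sym (lookup-replicate i fresh)) (contributor⁺ (guess i (v i)))) ◅◅
       sts ◅◅ leader (leader⁺ finish) skip ◅ sts′)

-- alive i x: a contributor that guessed that register i contains x would not
-- have refused any message so far.  A contributor lagging behind the leader by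
-- at least two messages never catches up again, because it can only read a
-- message of the right kind, so its lag changes from odd to even values only.
module SmallDomainSound (I : CodeInstance) where

  open CodeInstance I renaming (registers to k; range to n)
  open SmallDomain I
  open System system hiding (blank)

  Alive : Set₁
  Alive = Fin k → Fin n → Set

  data Phase : Set where
    ready  : Fin (suc M) → Phase
    ticked : Fin M → Phase

  phase : Leader → Phase
  phase (finish _)   = ready zero
  phase (ready r _)  = ready r
  phase (ticked r _) = ticked r

  target : Leader → Fin (suc M)
  target (finish _)   = zero
  target (ready _ τ)  = τ
  target (ticked _ τ) = τ

  Accepts : Fin M → Datum → Alive
  Accepts r a i x = ContributorStep (ticked i x r) (get a) (ready i x (inject₁ r))

  -- The leader's past as an implication. Jumps and claims extend the run at its front, so in the
  -- end it is applied to the empty run.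
  Transfer : Alive → Fin (suc M) → Set
  Transfer alive τ = ∀ v → (∀ i → alive i (v i)) → RunFrom v code τ → RunFrom v code (fromℕ M)

  -- A contributor may guess at any time. Up to the first tick, or one message late after it, its
  -- guess has to count as alive; later newcomers lag behind and nothing is promised about them.
  Untested : Alive → Phase → Set
  Untested alive (ready r)  = toℕ (fromℕ M) ≡ toℕ r → ∀ i x → alive i x
  Untested alive (ticked r) = toℕ (fromℕ M) ≡ suc (toℕ r) → ∀ i x → alive i x

  -- Let `ready p` have 2p and `ticked p` have 2p + 1 messages ahead. The inequalities say that no
  -- contributor is ahead of the leader; the equations single out a lag of 0 or 1. If the missed
  -- message is a `pass` or `claim`, the contributor is alive provided that it would accept the
  -- current datum.
  ContributorOk : Alive → Phase → Datum → Contributor → Set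
  ContributorOk alive ph         a fresh          = ⊤
  ContributorOk alive (ready r)  a (ready i x p)  = toℕ r ≤ toℕ p × (toℕ p ≡ toℕ r → alive i x)
  ContributorOk alive (ready r)  a (ticked i x p) = toℕ r ≤ toℕ p × (toℕ p ≡ toℕ r → Accepts p a i x → alive i x)
  ContributorOk alive (ticked r) a (ready i x p)  = suc (toℕ r) ≤ toℕ p × (toℕ p ≡ suc (toℕ r) → alive i x)
  ContributorOk alive (ticked r) a (ticked i x p) = toℕ r ≤ toℕ p × (toℕ p ≡ toℕ r → alive i x)

  -- Contributors write only `ok`, and only at position zero. Never being ahead, they do so only
  -- after the leader's last message, so no tick is ever destroyed.
  DatumOk : Alive → Phase → Datum → Set
  DatumOk alive (ready r)  tick   = ⊥
  DatumOk alive (ready r)  (ok i) = ∃[ x ] alive i x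
  DatumOk alive (ready r)  _      = ⊤
  DatumOk alive (ticked r) a      = a ≡ tick

  Collected : Alive → Leader → Set
  Collected alive (finish j) = ∀ i → toℕ j ≤ toℕ i → ∃[ x ] alive i x
  Collected alive _          = ⊤

  record Invariant {t} (s : Leader × Vec Contributor t × Datum) : Set₁ where
    private
      q  = proj₁ s
      qs = proj₁ (proj₂ s)
      a  = proj₂ (proj₂ s)
    field
      alive        : Alive
      transfer     : Transfer alive (target q)
      untested     : Untested alive (phase q)
      contributors : VAll.All (ContributorOk alive (phase q) a) qs
      datumOk      : DatumOk alive (phase q) a
      collected    : Collected alive q

  -- A contributor one message behind falls two behind when the leader writes again: the equation in
  -- its condition then contradicts the inequality.
  after-tick : ∀ {alive} r {a} q → ContributorOk alive (ready (suc r)) a q → ContributorOk alive (ticked r) tick q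
  after-tick r fresh          h       = tt
  after-tick r (ready i x p)  h       = h
  after-tick r (ticked i x p) (h , _) = ≤-trans (n≤1+n _) h , λ e → ⊥-elim (1+n≰n (≤-trans h (≤-reflexive e)))

  after-message : ∀ {alive} r b q → ContributorOk alive (ticked r) tick q →
    ContributorOk (λ i x → alive i x × Accepts r b i x) (ready (inject₁ r)) b q
  after-message r b fresh          h       = tt
  after-message r b (ready i x p)  (h , _) rewrite toℕ-inject₁ r =
    ≤-trans (n≤1+n _) h , λ e → ⊥-elim (1+n≰n (≤-trans h (≤-reflexive e)))
  after-message r b (ticked i x p) (h , f) rewrite toℕ-inject₁ r = h , λ e → g (toℕ-injective e) (f e)
    where
    g : ∀ {p alive} → p ≡ r → alive → Accepts p b i x → alive × Accepts r b i x
    g refl al acc = al , acc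

  after-ok : ∀ {alive r a j} q → ContributorOk alive (ready r) a q → ContributorOk alive (ready r) (ok j) q
  after-ok fresh          h       = tt
  after-ok (ready i x p)  h       = h
  after-ok (ticked i x p) (h , _) = h , λ _ ()

  message : ∀ {t r τ τ′ b} {qs : Vec Contributor t} {a} (inv : Invariant (ticked r τ , qs , a)) →
    (∀ {alive} → DatumOk alive (ready (inject₁ r)) b) →
    Transfer (λ i x → Invariant.alive inv i x × Accepts r b i x) τ′ →
    Invariant (ready (inject₁ r) τ′ , qs , b)
  message {r = r} {b = b} inv b-ok transfer′ = record
    { alive        = λ i x → alive i x × Accepts r b i x
    ; transfer     = transfer′
    ; untested     = λ e → ⊥-elim (fromℕ≢inject₁ (toℕ-injective e))
    ; contributors = VAll.map (λ {q} h → after-message r b q (subst (λ a → ContributorOk alive (ticked r) a q) datumOk h)) contributors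
    ; datumOk      = b-ok
    ; collected    = tt
    }
    where open Invariant inv

  leader-step : ∀ {t q q′ α a a′} {qs : Vec Contributor t} → LeaderStep q α q′ → Effect α a a′ →
    Invariant (q , qs , a) → Invariant (q′ , qs , a′)
  leader-step finish skip inv = record
    { alive = alive ; transfer = transfer ; untested = untested ; contributors = contributors ; datumOk = datumOk
    ; collected = λ i h → ⊥-elim (1+n≰n (≤-trans (toℕ<n i) (≤-trans (≤-reflexive (sym (toℕ-fromℕ k))) h))) }
    where open Invariant inv
  leader-step (collect j) get inv = record
    { alive = alive ; transfer = transfer ; untested = untested ; contributors = contributors ; datumOk = datumOk
    ; collected = collected′ }
    where
    open Invariant inv
    collected′ : ∀ i → toℕ (inject₁ j) ≤ toℕ i → ∃[ x ] alive i x
    collected′ i h with m≤n⇒m<n∨m≡n (≤-trans (≤-reflexive (sym (toℕ-inject₁ j))) h)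
    ... | inj₁ j<i = collected i j<i
    ... | inj₂ e with toℕ-injective e
    ... | refl = datumOk
  leader-step (tick r τ) put inv = record
    { alive = alive ; transfer = transfer ; untested = untested
    ; contributors = VAll.map (λ {q} → after-tick r q) contributors
    ; datumOk = refl ; collected = tt }
    where open Invariant inv
  leader-step (pass r τ) put inv = message inv tt λ v al → transfer v (proj₁ ∘ al)
    where open Invariant inv
  -- An alive content of register `i` must itself have accepted `claim i`. The edge for other
  -- registers is excluded, so the pair is listed and the check succeeds.
  leader-step (claim r i) put inv = message inv tt λ v al run → transfer v (proj₁ ∘ al) (go (proj₂ (al i)) run)
    where
    open Invariant inv
    go : ∀ {v : Fin k → Fin n} → Accepts r (claim i) i (v i) → RunFrom v code (inject₁ r) → RunFrom v code (suc r)
    go (other _ _ _ _ i≢i) run = ⊥-elim (i≢i refl)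
    go (own r∈ i∈)         run = check r∈ i∈ run
  leader-step (jump r∈ m∈) put inv = message inv tt λ v al run → transfer v (proj₁ ∘ al) (jump r∈ m∈ run)
    where open Invariant inv

  step-ok : ∀ {alive α q q′ a a′} ph → ContributorStep q α q′ → Effect α a a′ →
    Untested alive ph → ContributorOk alive ph a q → DatumOk alive ph a →
    ContributorOk alive ph a′ q′ × DatumOk alive ph a′
  step-ok (ready r) (guess i x) skip u h d =
    (≤-trans (s≤s⁻¹ (toℕ<n r)) (≤-reflexive (sym (toℕ-fromℕ M))) , λ e → u e i x) , d
  step-ok (ready zero) (accept i x) put u h d = h , x , proj₂ h refl
  step-ok (ready r) (pass i x p) get u (h , f) d rewrite toℕ-inject₁ p = (h , λ e → f e (pass i x p)) , d
  step-ok (ready r) (other i x p j i≢j) get u (h , f) d rewrite toℕ-inject₁ p = (h , λ e → f e (other i x p j i≢j)) , d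
  step-ok (ready r) (own {p} r∈ i∈) get u (h , f) d rewrite toℕ-inject₁ p = (h , λ e → f e (own r∈ i∈)) , d
  step-ok (ticked r) (guess i x) skip u h d =
    (≤-trans (toℕ<n r) (≤-reflexive (sym (toℕ-fromℕ M))) , λ e → u e i x) , d
  step-ok (ticked r) (tick i x p) get u (h , f) d = (s≤s⁻¹ h , λ e → f (cong suc e)) , d
  step-ok (ticked r) (accept i x) put u (() , _) d

  others-ok : ∀ {alive α q q′ a a′} ph → ContributorStep q α q′ → Effect α a a′ → ContributorOk alive ph a q →
    ∀ {p} → ContributorOk alive ph a p → ContributorOk alive ph a′ p
  others-ok ph         st           get  _        h = h
  others-ok ph         st           skip _        h = h
  others-ok (ready r)  (accept i x) put  _        {p} h = after-ok p h
  others-ok (ticked r) (accept i x) put  (() , _) h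

  contributor-step : ∀ {alive α a a′} ph {t} {qs qs′ : Vec Contributor t} → Move qs α qs′ → Effect α a a′ →
    Untested alive ph → DatumOk alive ph a → VAll.All (ContributorOk alive ph a) qs →
    VAll.All (ContributorOk alive ph a′) qs′ × DatumOk alive ph a′ × (∀ {p} → ContributorOk alive ph a p → ContributorOk alive ph a′ p)
  contributor-step ph (here h) eff u d (p ∷ ps) =
    let st = contributor⁻ h
        (p′ , d′) = step-ok ph st eff u p d
        others = others-ok ph st eff p
    in p′ ∷ VAll.map (λ {q} → others {q}) ps , d′ , λ {q} → others {q}
  contributor-step ph (there m) eff u d (p ∷ ps) =
    let (ps′ , d′ , others) = contributor-step ph m eff u d ps in others p ∷ ps′ , d′ , λ {q} → others {q}

  step : ∀ {t} {s s′ : Leader × Vec Contributor t × Datum} → Invariant s → s ⟶ s′ → Invariant s′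
  step inv (leader h eff) = leader-step (leader⁻ h) eff inv
  step inv (contributor {q = q} m eff) =
    let (cs , d , _) = contributor-step (phase q) m eff untested datumOk contributors in record
    { alive = alive ; transfer = transfer ; untested = untested
    ; contributors = cs ; datumOk = d ; collected = collected }
    where open Invariant inv

  invariant-initial : ∀ t → Invariant (initial t)
  invariant-initial t = record
    { alive = λ _ _ → ⊤ ; transfer = λ v _ run → run ; untested = λ _ _ _ → tt
    ; contributors = all-replicate {system} t tt ; datumOk = tt ; collected = tt }

  steps : ∀ {t} {s s′ : Leader × Vec Contributor t × Datum} → Invariant s → s ⟶* s′ → Invariant s′
  steps inv ε          = inv
  steps inv (st ◅ sts) = steps (step inv st) sts

  sound : Fails → Σ[ v ∈ (Fin k → Fin n) ] RunFrom v code (fromℕ M)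
  -- In the unsafe state every register has an alive content and the target is zero, where the run
  -- is `done`.
  sound (t , qs , a , sts) = (λ i → proj₁ (collected i z≤n)) , transfer _ (λ i → proj₂ (collected i z≤n)) done
    where open Invariant (steps (invariant-initial t) sts)

-- Generating the instances with a small domain.

v₅ v₆ : Fun
v₅ = tl ⨟ v₄
v₆ = tl ⨟ v₅

module SmallDomainF where

  claimD : Fun → Fun
  claimD i = sucF (sucF (sucF i))

  okD : Fun → Fun → Fun
  okD k i = sucF (sucF (sucF (k ⊞ i)))

  -- The offsets skip the numbers of the preceding constructors: k + 1 for `finish` and (M + 1)² for
  -- `ready`.
  readyL tickedL : (k M r τ : Fun) → Fun
  readyL  k M r τ = sucF k ⊞ combineF r (sucF M) τ
  tickedL k M r τ = sucF k ⊞ ((sucF M ⊠ sucF M) ⊞ combineF r (sucF M) τ)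

  readyC : (n M i x r : Fun) → Fun
  readyC n M i x r = sucF (combineF (combineF i n x) (sucF M) r)

  tickedC : (n k M i x r : Fun) → Fun
  tickedC n k M i x r = sucF (((k ⊠ n) ⊠ sucF M) ⊞ combineF (combineF i n x) M r)

  collectF passAtF passF claimF jumpF slotF : Fun
  collectF = for v₁ collect cons (edgeF (sucF (v₀ ⨟ tl)) (getF (okD v₂ (v₀ ⨟ tl))) (v₀ ⨟ tl)) nil
  passAtF =
    cons (edgeF (readyL v₃ v₄ (sucF r) τ) (putF (numeral 1)) (tickedL v₃ v₄ r τ))
    (cons (edgeF (tickedL v₃ v₄ r τ) (putF (numeral 2)) (readyL v₃ v₄ r τ)) nil)
    where
    r = lengthOf (v₁ ⨟ tl)
    τ = v₀ ⨟ tl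
  passF = for sucF v₃ collect passAtF
  claimF = for v₂ collect
    cons (edgeF (tickedL v₃ v₄ r (sucF r)) (putF (claimD (v₀ ⨟ tl))) (readyL v₃ v₄ r r)) nil
    where r = lengthOf (v₁ ⨟ tl)
  jumpF = for v₀ ⨟ hd ⨟ tl collect
    cons (edgeF (tickedL v₃ v₄ r (sucF r)) (putF (numeral 2)) (readyL v₃ v₄ r (monusF r (v₀ ⨟ hd)))) nil
    where r = lengthOf (v₁ ⨟ tl)
  slotF = for tl ⨟ tl ⨟ tl collect (passF ⊞ (claimF ⊞ jumpF))

  otherF followF guessF checkF : Fun
  otherF = for v₄ collect (if differ (v₃ ⨟ tl) (v₀ ⨟ tl) then
    cons (edgeF (tickedC v₄ v₅ v₆ (v₃ ⨟ tl) (v₂ ⨟ tl) (v₁ ⨟ tl)) (getF (claimD (v₀ ⨟ tl)))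
                (readyC v₄ v₆ (v₃ ⨟ tl) (v₂ ⨟ tl) (v₁ ⨟ tl))) nil
    else nil)
  followF = for v₄ collect
    cons (edgeF (readyC v₃ v₅ (v₂ ⨟ tl) (v₁ ⨟ tl) (sucF (v₀ ⨟ tl))) (getF (numeral 1))
                (tickedC v₃ v₄ v₅ (v₂ ⨟ tl) (v₁ ⨟ tl) (v₀ ⨟ tl)))
    (cons (edgeF (tickedC v₃ v₄ v₅ (v₂ ⨟ tl) (v₁ ⨟ tl) (v₀ ⨟ tl)) (getF (numeral 2))
                 (readyC v₃ v₅ (v₂ ⨟ tl) (v₁ ⨟ tl) (v₀ ⨟ tl)))
    otherF)
  guessF = for v₁ collect (for v₁ collect
    cons (edgeF nil nil (readyC v₂ v₄ (v₁ ⨟ tl) (v₀ ⨟ tl) v₄))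
    (cons (edgeF (readyC v₂ v₄ (v₁ ⨟ tl) (v₀ ⨟ tl) nil) (putF (okD v₃ (v₁ ⨟ tl)))
                 (readyC v₂ v₄ (v₁ ⨟ tl) (v₀ ⨟ tl) nil))
    followF))
  checkF = for tl ⨟ tl ⨟ tl collect (for v₀ ⨟ hd ⨟ hd collect
    cons (edgeF (tickedC v₂ v₃ v₄ i x r) (getF (claimD i)) (readyC v₂ v₄ i x r)) nil)
    where
    i = v₀ ⨟ hd ⨟ hd
    x = v₀ ⨟ hd ⨟ tl
    r = lengthOf (v₁ ⨟ tl)

  lcrF : Fun
  lcrF =
    cons (sucF (sucF (sucF (v₁ ⊞ v₁)))) (cons nil (cons
      (cons (sucF nl) (cons (readyL v₁ v₂ v₂ v₂) (cons (edgeF (readyL v₁ v₂ nil nil) nil v₁) (collectF ⊞ slotF))))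
      (cons (cons (sucF (((v₁ ⊠ v₀) ⊠ sucF v₂) ⊞ ((v₁ ⊠ v₀) ⊠ v₂))) (cons nil (guessF ⊞ checkF)))
        (cons (numeral 1) nl))))
    where nl = v₁ ⊞ ((sucF v₂ ⊠ sucF v₂) ⊞ (v₂ ⊠ sucF v₂))

  reductionF : Fun
  reductionF = setupF ⨟ cons lcrF (sucF (sucF (sucF (v₁ ⊞ v₁))))

module SmallDomainCoding (I : CodeInstance) where

  open CodeInstance I renaming (registers to k; range to n)
  open SmallDomain I
  open SmallDomainF

  -- Contents of registers occur only in contributor states, which is what keeps the domain at 2k +
  -- 3 elements.
  codeD : Datum → Fin (3 + (k + k))
  codeD blank     = zero
  codeD tick      = suc zero
  codeD pass      = suc (suc zero)
  codeD (claim i) = suc (suc (suc (i ↑ˡ k)))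
  codeD (ok i)    = suc (suc (suc (k ↑ʳ i)))

  NL : ℕ
  NL = k + (suc M * suc M + M * suc M)

  codeL : Leader → Fin (suc NL)
  codeL (finish i)   = i ↑ˡ (suc M * suc M + M * suc M)
  codeL (ready r τ)  = suc k ↑ʳ (combine r τ ↑ˡ (M * suc M))
  codeL (ticked r τ) = suc k ↑ʳ ((suc M * suc M) ↑ʳ combine r τ)

  codeC : Contributor → Fin (suc (k * n * suc M + k * n * M))
  codeC fresh          = zero
  codeC (ready i x r)  = suc (combine (combine i x) r ↑ˡ (k * n * M))
  codeC (ticked i x r) = suc ((k * n * suc M) ↑ʳ combine (combine i x) r)

  codeD-inj : Injective _≡_ _≡_ codeD
  codeD-inj {blank}   {blank}   e = refl
  codeD-inj {tick}    {tick}    e = refl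
  codeD-inj {pass}    {pass}    e = refl
  codeD-inj {claim i} {claim j} e = cong claim (↑ˡ-injective _ _ _ (suc-injective (suc-injective (suc-injective e))))
  codeD-inj {claim i} {ok j}    e = ↑ˡ≢↑ʳ {i = i} (suc-injective (suc-injective (suc-injective e)))
  codeD-inj {ok i}    {claim j} e = ↑ˡ≢↑ʳ {i = j} (sym (suc-injective (suc-injective (suc-injective e))))
  codeD-inj {ok i}    {ok j}    e = cong ok (↑ʳ-injective _ _ _ (suc-injective (suc-injective (suc-injective e))))

  codeL-inj : Injective _≡_ _≡_ codeL
  codeL-inj {finish i} {finish j} e = cong finish (↑ˡ-injective _ _ _ e)
  codeL-inj {finish i} {ready _ _} e = ↑ˡ≢↑ʳ {i = i} e
  codeL-inj {finish i} {ticked _ _} e = ↑ˡ≢↑ʳ {i = i} e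
  codeL-inj {ready _ _} {finish j} e = ↑ˡ≢↑ʳ {i = j} (sym e)
  codeL-inj {ticked _ _} {finish j} e = ↑ˡ≢↑ʳ {i = j} (sym e)
  codeL-inj {ready r τ} {ready r′ τ′} e with combine-injective r τ r′ τ′ (↑ˡ-injective _ _ _ (↑ʳ-injective (suc k) _ _ e))
  ... | refl , refl = refl
  codeL-inj {ready r τ} {ticked _ _} e = ↑ˡ≢↑ʳ {i = combine r τ} (↑ʳ-injective (suc k) _ _ e)
  codeL-inj {ticked _ _} {ready r τ} e = ↑ˡ≢↑ʳ {i = combine r τ} (sym (↑ʳ-injective (suc k) _ _ e))
  codeL-inj {ticked r τ} {ticked r′ τ′} e with combine-injective r τ r′ τ′ (↑ʳ-injective (suc M * suc M) _ _ (↑ʳ-injective (suc k) _ _ e))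
  ... | refl , refl = refl

  combine₃-injective : ∀ {N} i x (r : Fin N) j y s → combine (combine i x) r ≡ combine (combine j y) s → (i , x , r) ≡ (j , y , s)
  combine₃-injective i x r j y s e with combine-injective (combine i x) r (combine j y) s e
  ... | e′ , refl with combine-injective {k} {n} i x j y e′
  ... | refl , refl = refl

  codeC-inj : Injective _≡_ _≡_ codeC
  codeC-inj {fresh} {fresh} e = refl
  codeC-inj {ready i x r} {ready j y s} e with combine₃-injective i x r j y s (↑ˡ-injective _ _ _ (suc-injective e))
  ... | refl = refl
  codeC-inj {ready i x r} {ticked _ _ _} e = ↑ˡ≢↑ʳ {i = combine (combine i x) r} (suc-injective e)
  codeC-inj {ticked _ _ _} {ready i x r} e = ↑ˡ≢↑ʳ {i = combine (combine i x) r} (sym (suc-injective e))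
  codeC-inj {ticked i x r} {ticked j y s} e with combine₃-injective i x r j y s (↑ʳ-injective (k * n * suc M) _ _ (suc-injective e))
  ... | refl = refl

  coding : Coding system
  coding = record
    { codeL = codeL ; codeC = codeC ; codeD = codeD
    ; codeL-inj = codeL-inj ; codeC-inj = codeC-inj ; codeD-inj = codeD-inj
    ; unsafe-zero = refl
    }

  open Coding coding using (encTransition; encLCR-lcr; lcr; fails-⇔)

  env : Tree
  env = environment I

  enc-claim : ∀ p e i → ⟦ p ⟧ e ≡ encFin i → ⟦ claimD p ⟧ e ≡ encFin (codeD (claim i))
  enc-claim p e i h = cong (λ z → nil ∙ nil ∙ nil ∙ z) (trans h (sym (encFin-↑ˡ i k)))

  enc-ok : ∀ K p e i → ⟦ K ⟧ e ≡ encℕ k → ⟦ p ⟧ e ≡ encFin i → ⟦ okD K p ⟧ e ≡ encFin (codeD (ok i))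
  enc-ok K p e i hk h = cong (λ z → nil ∙ nil ∙ nil ∙ z) (encFin-↑ʳ K p e k i hk h)

  enc-readyL : ∀ K N p q e r τ → ⟦ K ⟧ e ≡ encℕ k → ⟦ N ⟧ e ≡ encℕ M → ⟦ p ⟧ e ≡ encFin r → ⟦ q ⟧ e ≡ encFin τ →
    ⟦ readyL K N p q ⟧ e ≡ encFin (codeL (ready r τ))
  enc-readyL K N p q e r τ hk hM hr hτ = encFin-↑ʳ (sucF K) (combineF p (sucF N) q) e (suc k) (combine r τ ↑ˡ (M * suc M))
    (cong (nil ∙_) hk) (trans (combineF-correct p (sucF N) q e r τ hr (cong (nil ∙_) hM) hτ) (sym (encFin-↑ˡ (combine r τ) (M * suc M))))

  enc-tickedL : ∀ K N p q e r τ → ⟦ K ⟧ e ≡ encℕ k → ⟦ N ⟧ e ≡ encℕ M → ⟦ p ⟧ e ≡ encFin r → ⟦ q ⟧ e ≡ encFin τ →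
    ⟦ tickedL K N p q ⟧ e ≡ encFin (codeL (ticked r τ))
  enc-tickedL K N p q e r τ hk hM hr hτ = encFin-↑ʳ (sucF K) ((sucF N ⊠ sucF N) ⊞ combineF p (sucF N) q) e (suc k) _
    (cong (nil ∙_) hk) (encFin-↑ʳ (sucF N ⊠ sucF N) (combineF p (sucF N) q) e (suc M * suc M) (combine r τ)
      (⊠-encℕ (sucF N) (sucF N) {e} {suc M} {suc M} (cong (nil ∙_) hM) (cong (nil ∙_) hM))
      (combineF-correct p (sucF N) q e r τ hr (cong (nil ∙_) hM) hτ))

  enc-readyC : ∀ N′ N p q s e i x r → ⟦ N′ ⟧ e ≡ encℕ n → ⟦ N ⟧ e ≡ encℕ M →
    ⟦ p ⟧ e ≡ encFin i → ⟦ q ⟧ e ≡ encFin x → ⟦ s ⟧ e ≡ encFin r → ⟦ readyC N′ N p q s ⟧ e ≡ encFin (codeC (ready i x r))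
  enc-readyC N′ N p q s e i x r hn hM hi hx hr = cong (nil ∙_)
    (trans (combineF-correct (combineF p N′ q) (sucF N) s e (combine i x) r (combineF-correct p N′ q e i x hi hn hx) (cong (nil ∙_) hM) hr)
      (sym (encFin-↑ˡ (combine (combine i x) r) (k * n * M))))

  enc-tickedC : ∀ N′ K N p q s e i x r → ⟦ N′ ⟧ e ≡ encℕ n → ⟦ K ⟧ e ≡ encℕ k → ⟦ N ⟧ e ≡ encℕ M →
    ⟦ p ⟧ e ≡ encFin i → ⟦ q ⟧ e ≡ encFin x → ⟦ s ⟧ e ≡ encFin r → ⟦ tickedC N′ K N p q s ⟧ e ≡ encFin (codeC (ticked i x r))
  enc-tickedC N′ K N p q s e i x r hn hk hM hi hx hr = cong (nil ∙_)
    (encFin-↑ʳ ((K ⊠ N′) ⊠ sucF N) (combineF (combineF p N′ q) N s) e (k * n * suc M) (combine (combine i x) r)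
      (⊠-encℕ (K ⊠ N′) (sucF N) {e} {k * n} {suc M} (⊠-encℕ K N′ {e} {k} {n} hk hn) (cong (nil ∙_) hM))
      (combineF-correct (combineF p N′ q) N s e (combine i x) r (combineF-correct p N′ q e i x hi hn hx) hM hr))

  collectF-correct : ⟦ collectF ⟧ env ≡ encList (encTransition codeL) collectEdges
  collectF-correct = forEach-fins _ k _ λ i → cong (_∙ nil)
    (edge≡ (sym (encFin-↑ˡ (suc i) (suc M * suc M + M * suc M)))
      (cong (encℕ 2 ∙_) (enc-ok v₂ (v₀ ⨟ tl) ((nil ∙ encFin i) ∙ env) i refl refl))
      (sym (trans (encFin-↑ˡ (inject₁ i) (suc M * suc M + M * suc M)) (encFin-inject₁ i))))

  length≡ : ∀ {A : Set} {encA : A → Tree} rest (y z e : Tree) {N} (r : Fin N) → toℕ r ≡ length rest →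
    ⟦ lengthOf (v₁ ⨟ tl) ⟧ (y ∙ (z ∙ encList encA rest) ∙ e) ≡ encFin r
  length≡ rest y z e r eq = trans (lengthOf-encList (v₁ ⨟ tl) {x = y ∙ (z ∙ _) ∙ e} rest refl) (cong encℕ (sym eq))

  slotF-correct : ⟦ slotF ⟧ env ≡ encList (encTransition codeL) slotEdges
  slotF-correct = forEach-slots _ code _ λ { r (L , ms) rest eq →
    let z = encInstr (L , ms)
        e = (z ∙ encList encInstr rest) ∙ env
        ℓ = lengthOf (v₁ ⨟ tl)
        r≡ : ∀ y → ⟦ ℓ ⟧ (y ∙ e) ≡ encFin r
        r≡ y = length≡ rest y z env r eq
        r≡′ : ∀ y → ⟦ ℓ ⟧ (y ∙ e) ≡ encFin (inject₁ r)
        r≡′ y = trans (r≡ y) (sym (encFin-inject₁ r))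
    in ⊞-encList passF (claimF ⊞ jumpF) {e} {passEdges (r , L , ms)}
      (forEach-fins {encB = encTransition codeL} ⟦ passAtF ⟧ {e} (suc M) (passEdgesAt r) λ τ →
        let y = nil ∙ encFin τ
            t = enc-tickedL v₃ v₄ ℓ (v₀ ⨟ tl) (y ∙ e) r τ refl refl (r≡ y) refl
        in cong₂ (λ a b → a ∙ b ∙ nil)
          (edge≡ (enc-readyL v₃ v₄ (sucF ℓ) (v₀ ⨟ tl) (y ∙ e) (suc r) τ refl refl (cong (nil ∙_) (r≡ y)) refl) refl t)
          (edge≡ t refl (enc-readyL v₃ v₄ ℓ (v₀ ⨟ tl) (y ∙ e) (inject₁ r) τ refl refl (r≡′ y) refl)))
      (⊞-encList claimF jumpF {e}
        (forEach-fins _ k _ λ i →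
          let y = nil ∙ encFin i
          in cong (_∙ nil) (edge≡
            (enc-tickedL v₃ v₄ ℓ (sucF ℓ) (y ∙ e) r (suc r) refl refl (r≡ y) (cong (nil ∙_) (r≡ y)))
            (cong (encℕ 1 ∙_) (enc-claim (v₀ ⨟ tl) (y ∙ e) i refl))
            (enc-readyL v₃ v₄ ℓ ℓ (y ∙ e) (inject₁ r) (inject₁ r) refl refl (r≡′ y) (r≡′ y))))
        (forEach-encList _ _ ms λ m ys →
          let y = encℕ m ∙ ys
          in cong (_∙ nil) (edge≡
            (enc-tickedL v₃ v₄ ℓ (sucF ℓ) (y ∙ e) r (suc r) refl refl (r≡ y) (cong (nil ∙_) (r≡ y)))
            refl
            (enc-readyL v₃ v₄ ℓ (monusF ℓ (v₀ ⨟ hd)) (y ∙ e) (inject₁ r) (inject₁ (down r m)) refl refl (r≡′ y)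
              (encFin-down ℓ (v₀ ⨟ hd) (y ∙ e) r m (r≡ y) refl))))) }

  otherF-correct : ∀ i x r → let e = (nil ∙ encFin r) ∙ (nil ∙ encFin x) ∙ (nil ∙ encFin i) ∙ env in
    ⟦ otherF ⟧ e ≡ encList (encTransition codeC) (otherEdges i x r)
  otherF-correct i x r = forEach-fins _ k _ λ j →
    let e = (nil ∙ encFin j) ∙ (nil ∙ encFin r) ∙ (nil ∙ encFin x) ∙ (nil ∙ encFin i) ∙ env
    in choose-differ i j (cong (_∙ nil) (edge≡
      (enc-tickedC v₄ v₅ v₆ (v₃ ⨟ tl) (v₂ ⨟ tl) (v₁ ⨟ tl) e i x r refl refl refl refl refl refl)
      (cong (encℕ 2 ∙_) (enc-claim (v₀ ⨟ tl) e j refl))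
      (enc-readyC v₄ v₆ (v₃ ⨟ tl) (v₂ ⨟ tl) (v₁ ⨟ tl) e i x (inject₁ r) refl refl refl refl (sym (encFin-inject₁ r)))))

  followF-correct : ∀ i x → let e = (nil ∙ encFin x) ∙ (nil ∙ encFin i) ∙ env in
    ⟦ followF ⟧ e ≡ encList (encTransition codeC) (followEdges i x)
  followF-correct i x = forEach-fins _ M _ λ r →
    let e = (nil ∙ encFin r) ∙ (nil ∙ encFin x) ∙ (nil ∙ encFin i) ∙ env
        t = enc-tickedC v₃ v₄ v₅ (v₂ ⨟ tl) (v₁ ⨟ tl) (v₀ ⨟ tl) e i x r refl refl refl refl refl refl
    in cong₂ _∙_
      (edge≡ (enc-readyC v₃ v₅ (v₂ ⨟ tl) (v₁ ⨟ tl) (sucF (v₀ ⨟ tl)) e i x (suc r) refl refl refl refl refl) refl t)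
      (cong₂ _∙_
        (edge≡ t refl (enc-readyC v₃ v₅ (v₂ ⨟ tl) (v₁ ⨟ tl) (v₀ ⨟ tl) e i x (inject₁ r) refl refl refl refl (sym (encFin-inject₁ r))))
        (otherF-correct i x r))

  guessF-correct : ⟦ guessF ⟧ env ≡ encList (encTransition codeC) guessEdges
  guessF-correct = forEach-fins _ k _ λ i → forEach-fins _ n _ λ x →
    let e = (nil ∙ encFin x) ∙ (nil ∙ encFin i) ∙ env
        a = enc-readyC v₂ v₄ (v₁ ⨟ tl) (v₀ ⨟ tl) nil e i x zero refl refl refl refl refl
    in cong₂ _∙_
      (edge≡ refl refl (enc-readyC v₂ v₄ (v₁ ⨟ tl) (v₀ ⨟ tl) v₄ e i x (fromℕ M) refl refl refl refl (sym (encFin-fromℕ M))))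
      (cong₂ _∙_ (edge≡ a (cong (encℕ 1 ∙_) (enc-ok v₃ (v₁ ⨟ tl) e i refl refl)) a) (followF-correct i x))

  checkF-correct : ⟦ checkF ⟧ env ≡ encList (encTransition codeC) checkEdges
  checkF-correct = forEach-slots _ code _ λ { r (L , ms) rest eq → forEach-encList _ _ L λ { (i , x) ys →
    let z = encInstr (L , ms)
        y = encPair (i , x) ∙ ys
        e = y ∙ (z ∙ encList encInstr rest) ∙ env
        ℓ = lengthOf (v₁ ⨟ tl)
        r≡ : ⟦ ℓ ⟧ e ≡ encFin r
        r≡ = length≡ rest y z env r eq
    in cong (_∙ nil) (edge≡
      (enc-tickedC v₂ v₃ v₄ (v₀ ⨟ hd ⨟ hd) (v₀ ⨟ hd ⨟ tl) ℓ e i x r refl refl refl refl refl r≡)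
      (cong (encℕ 2 ∙_) (enc-claim (v₀ ⨟ hd ⨟ hd) e i refl))
      (enc-readyC v₂ v₄ (v₀ ⨟ hd ⨟ hd) (v₀ ⨟ hd ⨟ tl) ℓ e i x (inject₁ r) refl refl refl refl (trans r≡ (sym (encFin-inject₁ r))))) } }

  domain≡ : ⟦ sucF (sucF (sucF (v₁ ⊞ v₁))) ⟧ env ≡ encℕ (3 + (k + k))
  domain≡ = cong (λ z → nil ∙ nil ∙ nil ∙ z) (⊞-encℕ v₁ v₁ {env} {k} {k} refl refl)

  lcrF-correct : ⟦ lcrF ⟧ env ≡ encLCR lcr
  lcrF-correct = trans
    (cong₂ _∙_ domain≡ (cong (nil ∙_) (cong₂ _∙_
      (edge≡ (cong (nil ∙_) nl)
        (enc-readyL v₁ v₂ v₂ v₂ env (fromℕ M) (fromℕ M) refl refl (sym (encFin-fromℕ M)) (sym (encFin-fromℕ M)))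
        (cong₂ _∙_ (edge≡ (enc-readyL v₁ v₂ nil nil env zero zero refl refl refl refl) refl
            (sym (trans (encFin-↑ˡ (fromℕ k) (suc M * suc M + M * suc M)) (encFin-fromℕ k))))
          (⊞-encList collectF slotF {env} collectF-correct slotF-correct)))
      (cong₂ _∙_
        (edge≡ (cong (nil ∙_) nc) refl (⊞-encList guessF checkF {env} guessF-correct checkF-correct))
        (cong (encBool inside ∙_) nl)))))
    (sym encLCR-lcr)
    where
    nl : ⟦ v₁ ⊞ ((sucF v₂ ⊠ sucF v₂) ⊞ (v₂ ⊠ sucF v₂)) ⟧ env ≡ encℕ NL
    nl = ⊞-encℕ v₁ ((sucF v₂ ⊠ sucF v₂) ⊞ (v₂ ⊠ sucF v₂)) {env} {k} {suc M * suc M + M * suc M} refl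
      (⊞-encℕ (sucF v₂ ⊠ sucF v₂) (v₂ ⊠ sucF v₂) {env} {suc M * suc M} {M * suc M}
        (⊠-encℕ (sucF v₂) (sucF v₂) {env} {suc M} {suc M} refl refl) (⊠-encℕ v₂ (sucF v₂) {env} {M} {suc M} refl refl))
    kn : ⟦ v₁ ⊠ v₀ ⟧ env ≡ encℕ (k * n)
    kn = ⊠-encℕ v₁ v₀ {env} {k} {n} refl refl
    nc : ⟦ ((v₁ ⊠ v₀) ⊠ sucF v₂) ⊞ ((v₁ ⊠ v₀) ⊠ v₂) ⟧ env ≡ encℕ (k * n * suc M + k * n * M)
    nc = ⊞-encℕ ((v₁ ⊠ v₀) ⊠ sucF v₂) ((v₁ ⊠ v₀) ⊠ v₂) {env} {k * n * suc M} {k * n * M}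
      (⊠-encℕ (v₁ ⊠ v₀) (sucF v₂) {env} {k * n} {suc M} kn refl) (⊠-encℕ (v₁ ⊠ v₀) v₂ {env} {k * n} {M} kn refl)

  yes-⇔ : Problem.Yes RegisterCode I ⇔ LCRInstance.UnsafeReachable lcr
  yes-⇔ = fails-⇔ ⇔-∘ mk⇔
    (λ (v , run) → Complete.complete v (to (runFrom-drop v code 0) run))
    (λ bad → let (v , run) = SmallDomainSound.sound I bad in v , from (runFrom-drop v code 0) run)

RegisterCode≤LCR[D] : RegisterCode ≤fpt LCR[D]
RegisterCode≤LCR[D] = polytime-reduction SmallDomainF.reductionF (con 3 ⊕ (var ⊕ var))
  (λ I → Coding.lcr (SmallDomainCoding.coding I))
  (λ I → trans (cong ⟦ cons SmallDomainF.lcrF (sucF (sucF (sucF (v₁ ⊞ v₁)))) ⟧ (setupF-correct I))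
    (cong₂ _∙_ (SmallDomainCoding.lcrF-correct I) (SmallDomainCoding.domain≡ I)))
  (λ I → refl)
  SmallDomainCoding.yes-⇔

proposition19 : W[ 1 ]-hard LCR[D] × W[ 1 ]-hard LCR[L]
proposition19 =
  -- The depth bound `d` that comes with membership in W[1] selects the program `verifyF d`.
  (λ P (d , P≤WCS) → ≤fpt-trans P≤WCS (≤fpt-trans (WCS≤RegisterCode 1 d) RegisterCode≤LCR[D])) ,
  (λ P (d , P≤WCS) → ≤fpt-trans P≤WCS (≤fpt-trans (WCS≤RegisterCode 1 d) RegisterCode≤LCR[L]))
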